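{- Let $m$ and $n$ be positive integers with $n\le m\le \binom{2n}{2}$. Then: (1) For every $G=(V,E)\in\mathcal{G}(2n,m)$, $$\prod_{v\in V}(\deg(v)!)^{\frac{1}{2\deg(v)}}\le \omega(2n,m),$$ and equality holds if and only if $G$ is almost regular. (2) $\mu(2n,m)\le \omega(2n,m)$. Equality $\mu(2n,m)=\omega(2n,m)$ holds if and only if $\mathcal{G}(2n,m)$ contains a graph $G^\star$ which is a disjoint union of $\ell_1\ge 1$ copies of $K_{n_1,n_1}$ and $\ell_2\ge 0$ copies of $K_{n_1+1,n_1+1}$ for some positive integer $n_1$ and integers $\ell_1\ge 1$, $\ell_2\ge 0$; i.e. $n=\ell_1n_1+\ell_2(n_1+1)$ and $m=\ell_1n_1^2+\ell_2(n_1+1)^2$. (3) For such values of $n$ and $m$, the graph in $\mathcal{G}(2n,m)$ whose number of perfect matchings equals $\mu(2n,m)$ is unique up to isomorphism, and it is the disjoint union $\ell_1K_{n_1,n_1}\cup \ell_2K_{n_1+1,n_1+1}$.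
   Context: $\mathcal{G}(2n,m)$ is the set of all simple graphs with $2n$ vertices and $m$ edges. $\deg(v)$ is the degree of the vertex $v$. ${\rm perfmat}\,G$ is the number of perfect matchings of $G$, and $\mu(2n,m):=\max_{G\in\mathcal{G}(2n,m)}{\rm perfmat}\,G$. $K_{r,r}$ is the complete bipartite graph with both parts of size $r$. A graph is almost regular if $|\deg(u)-\deg(v)|\le 1$ for all vertices $u,v$. Define $$\omega(2n,m):=\left(\lfloor \tfrac{m}{n}\rfloor !\right)^{\frac{n-\alpha}{\lfloor m/n\rfloor}}\left(\lceil \tfrac{m}{n}\rceil !\right)^{\frac{\alpha}{\lceil m/n\rceil}},\qquad \alpha:=m-n\lfloor \tfrac{m}{n}\rfloor .$$ Convention: for a vertex of degree $0$ the factor $(0!)^{1/0}$ (or $(0!)^{1/(2\cdot 0)}$) is interpreted as $0$. -}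

module Defs where

open import Level using (0ℓ)
open import Data.Empty using (⊥)
open import Data.Fin.Base using (Fin; _<_)
open import Data.Fin.Properties as Fin using (all?)
open import Data.List.Base
  using (List; []; _∷_; _++_; map; filter; foldr; length; allFin; cartesianProduct)
open import Data.List.Extrema.Nat using (max)
open import Data.List.Membership.Propositional using (_∈_)
open import Data.List.Membership.Propositional.Properties
  using (∈-map⁺; ∈-++⁺ˡ; ∈-++⁺ʳ; ∈-filter⁺; ∈-filter⁻; ∈-cartesianProduct⁺; ∈-allFin)
open import Data.List.Relation.Unary.Any using (here)
open import Data.Nat.Base
  using (ℕ; zero; suc; pred; _+_; _*_; _∸_; _^_; _≤_; _!; ∣_-_∣; NonZero)
open import Data.Nat.DivMod using (_/_)
open import Data.Nat.Properties as ℕ using (m*n≢0)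
open import Data.Product.Base using (_×_; _,_; proj₁; proj₂; ∃-syntax)
open import Data.Product.Properties using (≡-dec)
open import Data.Product.Relation.Binary.Pointwise.NonDependent as × using (×-decidable)
open import Data.Sum.Base using (_⊎_; inj₁; inj₂; [_,_]′; swap)
open import Data.Sum.Relation.Binary.Pointwise as ⊎ using (⊎-symmetric; ⊎-decidable; inj₁; inj₂)
open import Data.Unit.Base using (⊤; tt)
open import Function.Base using (_∘_)
open import Function.Bundles using (_⇔_; _↔_; Inverse; mk⇔)
open import Relation.Binary.Core using (Rel)
open import Relation.Binary.Definitions using (Symmetric; Decidable; tri<; tri≈; tri>)
open import Relation.Binary.PropositionalEquality using (_≡_; refl; sym; _≢_)
open import Relation.Nullary using (¬_; yes; no; contradiction)
open import Relation.Nullary.Decidable using (_×-dec_; _⊎-dec_; ¬?)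
open import Relation.Unary as U using (Pred)

-- root a q denotes the non-negative real number a^(1/q).  This is an exact
-- representation: every quantity below is a finite product of such numbers.
-- As with unnormalised rationals, equality is _≈ᴿ_ rather than _≡_.
record Radical : Set where
  constructor root
  field
    radicand : ℕ
    index    : ℕ
    .{{index-nonZero}} : NonZero index

infix  4 _≤ᴿ_ _≈ᴿ_
infixl 7 _·_

-- Both relations compare the (p q)-th powers of a^(1/p) and b^(1/q).
_≤ᴿ_ : Radical → Radical → Set
root a p ≤ᴿ root b q = a ^ q ≤ b ^ p

_≈ᴿ_ : Radical → Radical → Set
root a p ≈ᴿ root b q = a ^ q ≡ b ^ p

_·_ : Radical → Radical → Radical
root a p · root b q = root (a ^ q * b ^ p) (p * q) {{m*n≢0 p q}}

⌜_⌝ : ℕ → Radical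
⌜ a ⌝ = root a 1

∏ : List Radical → Radical
∏ = foldr _·_ ⌜ 1 ⌝

-- a ^ p ÷ q denotes a^(p/q).  For q = 0 the value is 0; this is the convention
-- (0!)^(1/0) = 0 for vertices of degree 0.
infix 8 _^_÷_
_^_÷_ : ℕ → ℕ → ℕ → Radical
a ^ p ÷ zero      = ⌜ 0 ⌝
a ^ p ÷ q@(suc _) = root (a ^ p) q

⌊_/_⌋ ⌈_/_⌉ : (m n : ℕ) .{{_ : NonZero n}} → ℕ
⌊ m / n ⌋ = m / n
⌈ m / n ⌉ = (m + pred n) / n

-- The quantity ω(2n,m); the first argument is n, not 2n.
ω : (n m : ℕ) .{{_ : NonZero n}} → Radical
ω n m = (⌊ m / n ⌋ !) ^ (n ∸ α) ÷ ⌊ m / n ⌋ · (⌈ m / n ⌉ !) ^ α ÷ ⌈ m / n ⌉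
  where
  α : ℕ
  α = m ∸ n * ⌊ m / n ⌋

record Graph (V : Set) : Set₁ where
  field
    Adj    : Rel V 0ℓ
    symm   : Symmetric Adj
    irrefl : ∀ {v} → ¬ Adj v v
    adj?   : Decidable Adj

open Graph public

infix 4 _≅_
record _≅_ {V W : Set} (G : Graph V) (H : Graph W) : Set where
  field
    bijection : V ↔ W
    preserves : ∀ u v → Adj G u v ⇔ Adj H (Inverse.to bijection u) (Inverse.to bijection v)

infixr 6 _⊍_
_⊍_ : ∀ {V W} → Graph V → Graph W → Graph (V ⊎ W)
G ⊍ H = record
  { Adj    = ⊎.Pointwise (Adj G) (Adj H)
  ; symm   = ⊎-symmetric (symm G) (symm H)
  ; irrefl = λ { (inj₁ e) → irrefl G e ; (inj₂ e) → irrefl H e }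
  ; adj?   = ⊎-decidable (adj? G) (adj? H)
  }

infix 7 _copies_
_copies_ : ∀ {V} (ℓ : ℕ) → Graph V → Graph (Fin ℓ × V)
ℓ copies G = record
  { Adj    = ×.Pointwise _≡_ (Adj G)
  ; symm   = λ { (i≡j , e) → sym i≡j , symm G e }
  ; irrefl = irrefl G ∘ proj₂
  ; adj?   = ×-decidable Fin._≟_ (adj? G)
  }

K : (r s : ℕ) → Graph (Fin r ⊎ Fin s)
K r s = record
  { Adj    = _~_
  ; symm   = λ {u} {v} → ~-sym u v
  ; irrefl = λ {v} → ~-irrefl v
  ; adj?   = _~?_
  }
  where
  _~_ : Rel (Fin r ⊎ Fin s) 0ℓ
  inj₁ _ ~ inj₁ _ = ⊥
  inj₁ _ ~ inj₂ _ = ⊤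
  inj₂ _ ~ inj₁ _ = ⊤
  inj₂ _ ~ inj₂ _ = ⊥

  ~-sym : ∀ u v → u ~ v → v ~ u
  ~-sym (inj₁ _) (inj₂ _) _ = tt
  ~-sym (inj₂ _) (inj₁ _) _ = tt

  ~-irrefl : ∀ v → ¬ (v ~ v)
  ~-irrefl (inj₁ _) ()
  ~-irrefl (inj₂ _) ()

  _~?_ : Decidable _~_
  inj₁ _ ~? inj₁ _ = no λ ()
  inj₁ _ ~? inj₂ _ = yes tt
  inj₂ _ ~? inj₁ _ = yes tt
  inj₂ _ ~? inj₂ _ = no λ ()

-- An edge {i,j} is represented by the pair (i , j) with i < j.
Edge : ℕ → Set
Edge N = Fin N × Fin N

pairs : ∀ N → List (Edge N)
pairs N = filter (λ (i , j) → i Fin.<? j) (cartesianProduct (allFin N) (allFin N))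

edges : ∀ {N} → Graph (Fin N) → List (Edge N)
edges {N} G = filter (λ (i , j) → adj? G i j) (pairs N)

deg : ∀ {N} → Graph (Fin N) → Fin N → ℕ
deg {N} G v = length (filter (adj? G v) (allFin N))

AlmostRegular : ∀ {N} → Graph (Fin N) → Set
AlmostRegular G = ∀ u v → ∣ deg G u - deg G v ∣ ≤ 1

𝒢 : (N m : ℕ) → Pred (Graph (Fin N)) 0ℓ
𝒢 N m G = length (edges G) ≡ m

𝒢? : ∀ N m → U.Decidable (𝒢 N m)
𝒢? N m G = length (edges G) ℕ.≟ m

-- All sublists, one for each set of positions; applied only to lists without
-- repetitions, where these are exactly the subsets.
subsets : ∀ {A : Set} → List A → List (List A)
subsets []       = [] ∷ []
subsets (x ∷ xs) = map (x ∷_) (subsets xs) ++ subsets xs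

Incident : ∀ {N} → Fin N → Pred (Edge N) 0ℓ
Incident v (i , j) = v ≡ i ⊎ v ≡ j

incident? : ∀ {N} (v : Fin N) → U.Decidable (Incident v)
incident? v (i , j) = v Fin.≟ i ⊎-dec v Fin.≟ j

Perfect : ∀ {N} → Pred (List (Edge N)) 0ℓ
Perfect M = ∀ v → length (filter (incident? v) M) ≡ 1

perfect? : ∀ {N} → U.Decidable (Perfect {N})
perfect? M = all? λ v → length (filter (incident? v) M) ℕ.≟ 1

perfmat : ∀ {N} → Graph (Fin N) → ℕ
perfmat G = length (filter perfect? (subsets (edges G)))

fromEdges : ∀ {N} → List (Edge N) → Graph (Fin N)
fromEdges {N} es = record
  { Adj    = λ i j → i ≢ j × ((i , j) ∈ es ⊎ (j , i) ∈ es)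
  ; symm   = λ (i≢j , e) → i≢j ∘ sym , swap e
  ; irrefl = λ (v≢v , _) → v≢v refl
  ; adj?   = λ i j → ¬? (i Fin.≟ j) ×-dec ((i , j) ∈? es ⊎-dec (j , i) ∈? es)
  }
  where
  open import Data.List.Membership.DecPropositional (≡-dec (Fin._≟_ {N}) (Fin._≟_ {N})) using (_∈?_)

graphs : ∀ N → List (Graph (Fin N))
graphs N = map fromEdges (subsets (pairs N))

-- The base value 0 of max is harmless whenever 𝒢 N m is inhabited.
μ : (N m : ℕ) → ℕ
μ N m = max 0 (map perfmat (filter (𝒢? N m) (graphs N)))

filter∈subsets : ∀ {A : Set} {P : Pred A 0ℓ} (P? : U.Decidable P) xs → filter P? xs ∈ subsets xs
filter∈subsets P? []       = here refl
filter∈subsets P? (x ∷ xs) with P? x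
... | yes _ = ∈-++⁺ˡ (∈-map⁺ (x ∷_) (filter∈subsets P? xs))
... | no  _ = ∈-++⁺ʳ (map (x ∷_) (subsets xs)) (filter∈subsets P? xs)

-- The enumeration is exhaustive, so μ is a maximum over all graphs.
graphs-complete : ∀ {N} (G : Graph (Fin N)) →
  ∃[ H ] H ∈ graphs N × (∀ i j → Adj G i j ⇔ Adj H i j)
graphs-complete {N} G =
  fromEdges (edges G) ,
  ∈-map⁺ fromEdges (filter∈subsets edge? (pairs N)) ,
  λ i j → mk⇔ (to i j) from
  where
  edge? : U.Decidable (λ (i , j) → Adj G i j)
  edge? (i , j) = adj? G i j

  ordered? : U.Decidable (λ ((i , j) : Edge N) → i < j)
  ordered? (i , j) = i Fin.<? j

  ∈-edges : ∀ {i j} → i < j → Adj G i j → (i , j) ∈ edges G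
  ∈-edges {i} {j} i<j e =
    ∈-filter⁺ edge? (∈-filter⁺ ordered? (∈-cartesianProduct⁺ (∈-allFin i) (∈-allFin j)) i<j) e

  sound : ∀ {i j} → (i , j) ∈ edges G → Adj G i j
  sound = proj₂ ∘ ∈-filter⁻ edge? {xs = pairs N}

  to : ∀ i j → Adj G i j → Adj (fromEdges (edges G)) i j
  to i j e with Fin.<-cmp i j
  ... | tri< i<j i≢j _ = i≢j , inj₁ (∈-edges i<j e)
  ... | tri> _ i≢j j<i = i≢j , inj₂ (∈-edges j<i (symm G e))
  ... | tri≈ _ refl _  = contradiction e (irrefl G)

  from : ∀ {i j} → Adj (fromEdges (edges G)) i j → Adj G i j
  from (_ , e) = [ sound , symm G ∘ sound ]′ e

BalancedUnion : (n₁ ℓ₁ ℓ₂ : ℕ) →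
  Graph ((Fin ℓ₁ × (Fin n₁ ⊎ Fin n₁)) ⊎ (Fin ℓ₂ × (Fin (suc n₁) ⊎ Fin (suc n₁))))
BalancedUnion n₁ ℓ₁ ℓ₂ = ℓ₁ copies K n₁ n₁ ⊍ ℓ₂ copies K (suc n₁) (suc n₁)

{-# OPTIONS --safe #-}
-- Write L = 2M with M divisible by all degrees in sight, and w d = (d !) ^ (M / d).
--
-- If A is the adjacency matrix of G, then perfmat G ^ 2 ≤ perm A: expanding both sides at a
-- vertex reduces the inequality to perfect matchings of smaller vertex sets.  Brègman's theorem
-- bounds perm A ^ M by the product of w (deg v), and Schrijver's proof of it (expand perm A
-- along every row and apply the log-sum inequality) also decides equality: all edges ic of A
-- then satisfy d i * perm (A - i - c) = perm A (d i the row sum), and the minors are again extremal.  Deleting two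
-- disjoint edges ic and jc′ in both orders yields d i (d j - A j c) = d j (d i - A i c′), so
-- neighbourhoods that meet coincide, and G is a disjoint union of graphs K d d.
--
-- The sequence w is strictly log-concave, because (d !) ^ (1 / d) is, so its tangent at
-- k = ⌊ m / n ⌋ bounds the product of w (deg v) by ω ^ L, with equality exactly when all degrees
-- are k or k + 1.
module Submission where

open import Defs
open import Data.Bool.Base using (Bool; true; false; _∧_; _∨_; not; if_then_else_; T)
import Data.Bool.Properties as Bool
open import Data.Empty using (⊥; ⊥-elim)
open import Data.Fin.Base as Fin using (Fin; zero; suc)
import Data.Fin.Properties as Fin
open import Data.List.Base using (List; []; _∷_; _++_; map; filter; length; allFin; tabulate; cartesianProduct)
import Data.List.Properties as List
import Data.List.Membership.Propositional.Properties as List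
import Data.List.Relation.Unary.All as All
open import Data.List.Extrema.Nat using (argmax-sel; xs≤max)
open import Data.Nat.Base
open import Data.Nat.Combinatorics using (_C_)
open import Data.Nat.Properties
open import Data.Nat.DivMod using (_/_; _%_; m≡m%n+[m/n]*n; m%n<n; m/n*n≡m; m*n/n≡m; +-distrib-/-∣ˡ; m<n⇒m/n≡0; m≥n⇒m/n>0)
open import Data.Nat.Divisibility using (∣-trans; m∣m*n; n∣m*n; m≤n⇒m!∣n!)
open import Data.Nat.Tactic.RingSolver using (solve-∀)
open import Data.Product.Base using (_×_; _,_; proj₁; proj₂; ∃-syntax; Σ-syntax)
open import Data.Sum.Base using (_⊎_; inj₁; inj₂; [_,_]′)
import Data.Fin.Permutation as Perm
open import Data.Product.Function.NonDependent.Propositional using (_×-↔_)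
open import Data.Sum.Function.Propositional using (_⊎-↔_)
open import Function.Properties.Inverse using (↔-refl; ↔-sym; ↔-trans)
import Data.Sum.Properties as Sum
import Data.Sum.Relation.Binary.Pointwise as ⊎
open import Data.Unit.Base using (tt)
open import Function.Base using (_∘_; id)
open import Function.Bundles using (_⇔_; _↔_; Inverse; Equivalence; mk⇔; mk↔ₛ′)
open import Relation.Binary.Definitions using (DecidableEquality; tri<; tri≈; tri>)
open import Relation.Binary.PropositionalEquality
open import Relation.Nullary using (¬_; Dec; yes; no; does; contradiction)
open import Relation.Nullary.Decidable using (T?; does-⇔; dec-true; dec-false)
open import Relation.Unary using (_∈_)
open import Algebra.Properties.Semiring.Sum +-*-semiring
  using (sum; sum-cong-≗; ∑-distrib-+; ∑-comm; sum-permute; *-distribˡ-sum; *-distribʳ-sum)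
import Algebra.Properties.CommutativeMonoid.Sum *-1-commutativeMonoid as Prod
open Prod using () renaming (sum to prod)

-- Two matchings of a set S superpose to doubled edges and alternating even cycles, while `perm S S`
-- counts covers of S by directed cycles of any length, a doubled edge being a 2-cycle. Peeling a
-- cycle edge by edge leaves a path between two vertices a and b, whose end edges lie in the same
-- matching or in different ones; hence the two companion inequalities for `perm (S ⊖ a) (S ⊖ b)`.
-- All numbers are natural: logarithms become powers such as `y ^ y`, where `0 ^ 0 = 1` plays the
-- role of 0 log 0 = 0, and quotients are cross-multiplied. The main equality cases arise from a
-- chain of inequalities squeezed between equal ends. That unions of graphs K d d attain the bound
-- is not shown by a product over components. Removing the ends of one edge preserves the property
-- that neighbourhoods which meet coincide, so one induction over vertex sets suffices. The value 0
-- at degree 0 fits in: an isolated vertex makes both the number of matchings and the bound zero,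
-- and log-concavity stays strict.

-- Arithmetic of natural numbers: cancellation, powers and tight products

≡0⊎>0 : ∀ n → n ≡ 0 ⊎ 0 < n
≡0⊎>0 zero    = inj₁ refl
≡0⊎>0 (suc n) = inj₂ z<s

*->0 : ∀ {m n} → 0 < m → 0 < n → 0 < m * n
*->0 {suc m} {suc n} _ _ = z<s

^->0 : ∀ {m} n → 0 < m → 0 < m ^ n
^->0 {m} n 0<m = m^n>0 m {{>-nonZero 0<m}} n

0^>0 : ∀ {n} → 0 < n → 0 ^ n ≡ 0
0^>0 {suc n} _ = refl

*-cancelˡ-≤′ : ∀ {m n} o → 0 < o → o * m ≤ o * n → m ≤ n
*-cancelˡ-≤′ o 0<o = *-cancelˡ-≤ o {{>-nonZero 0<o}}

*-cancelˡ-≡′ : ∀ {m n} o → 0 < o → o * m ≡ o * n → m ≡ n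
*-cancelˡ-≡′ {m} {n} o 0<o = *-cancelˡ-≡ m n o {{>-nonZero 0<o}}

*-cancelʳ-≡′ : ∀ {m n} o → 0 < o → m * o ≡ n * o → m ≡ n
*-cancelʳ-≡′ {m} {n} o 0<o = *-cancelʳ-≡ m n o {{>-nonZero 0<o}}

*-monoʳ-<′ : ∀ {m n} o → 0 < o → m < n → o * m < o * n
*-monoʳ-<′ o 0<o = *-monoʳ-< o {{>-nonZero 0<o}}

^-distribʳ-* : ∀ m n k → (m * n) ^ k ≡ m ^ k * n ^ k
^-distribʳ-* m n zero    = refl
^-distribʳ-* m n (suc k) = trans (cong (m * n *_) (^-distribʳ-* m n k)) (shuffle m n (m ^ k) (n ^ k))
  where
  shuffle : ∀ a b c d → a * b * (c * d) ≡ a * c * (b * d)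
  shuffle = solve-∀

^-comm : ∀ m n o → (m ^ n) ^ o ≡ (m ^ o) ^ n
^-comm m n o = trans (^-*-assoc m n o) (trans (cong (m ^_) (*-comm n o)) (sym (^-*-assoc m o n)))

^-cancelʳ-≤ : ∀ {m n} k → 0 < k → m ^ k ≤ n ^ k → m ≤ n
^-cancelʳ-≤ {m} {n} k 0<k mk≤nk with m ≤? n
... | yes m≤n = m≤n
... | no  m≰n = contradiction mk≤nk (<⇒≱ (^-monoˡ-< k {{>-nonZero 0<k}} (≰⇒> m≰n)))

^-cancelʳ-≡ : ∀ {m n} k → 0 < k → m ^ k ≡ n ^ k → m ≡ n
^-cancelʳ-≡ k 0<k eq = ≤-antisym (^-cancelʳ-≤ k 0<k (≤-reflexive eq)) (^-cancelʳ-≤ k 0<k (≤-reflexive (sym eq)))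

-- If a < b, then a x < b x ≤ b y, where x is positive because the product is. In a zero product one
-- factor would say nothing about the other. Iterated in `prod-squeeze`, this carries tightness of a
-- product over to its factors.
*-squeezeˡ : ∀ {a b x y} → a ≤ b → x ≤ y → 0 < b * y → a * x ≡ b * y → a ≡ b
*-squeezeˡ {a} {b} {x} {y} a≤b x≤y 0<by eq with m≤n⇒m<n∨m≡n a≤b
... | inj₂ a≡b = a≡b
... | inj₁ a<b = contradiction eq (<⇒≢ (<-≤-trans (*-monoˡ-< x {{>-nonZero 0<x}} a<b) (*-monoʳ-≤ b x≤y)))
  where
  0<x : 0 < x
  0<x with ≡0⊎>0 x
  ... | inj₂ 0<x  = 0<x
  ... | inj₁ refl = contradiction (trans (sym (*-zeroʳ a)) eq) (<⇒≢ 0<by)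

*-squeezeʳ : ∀ {a b x y} → a ≤ b → x ≤ y → 0 < b * y → a * x ≡ b * y → x ≡ y
*-squeezeʳ {a} {b} {x} {y} a≤b x≤y 0<by eq =
  *-squeezeˡ x≤y a≤b (subst (0 <_) (*-comm b y) 0<by) (trans (*-comm x a) (trans eq (*-comm b y)))

-- Weighted AM-GM

2uv<u²+v² : ∀ u v → u ≢ v → 2 * (u * v) < u * u + v * v
2uv<u²+v² u v u≢v with <-cmp u v
... | tri≈ _ u≡v _ = contradiction u≡v u≢v
... | tri< u<v _ _ with m≤n⇒∃[o]m+o≡n u<v
...   | d , refl = subst (2 * (u * suc (u + d)) <_) (square u d) (m<m+n _ z<s)
  where
  square : ∀ u d → 2 * (u * suc (u + d)) + suc d * suc d ≡ u * u + suc (u + d) * suc (u + d)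
  square = solve-∀
2uv<u²+v² u v u≢v | tri> _ _ v<u with m≤n⇒∃[o]m+o≡n v<u
...   | d , refl = subst (2 * (suc (v + d) * v) <_) (square v d) (m<m+n _ z<s)
  where
  square : ∀ v d → 2 * (suc (v + d) * v) + suc d * suc d ≡ suc (v + d) * suc (v + d) + v * v
  square = solve-∀

2uv≤u²+v² : ∀ u v → 2 * (u * v) ≤ u * u + v * v
2uv≤u²+v² u v with u ≟ v
... | no  u≢v  = <⇒≤ (2uv<u²+v² u v u≢v)
... | yes refl = ≤-reflexive (cong (u * u +_) (+-identityʳ _))

-- Bernoulli's inequality for u / v, with denominators cleared.
bernoulli : ∀ k u v → suc k * (u * v ^ k) ≤ u ^ suc k + k * v ^ suc k

-- The induction step of `bernoulli`, with `u * u + v * v` in place of `2 * (u * v)`: the square of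
-- u yields u times the previous instance. The surplus `k * (u * v ^ suc k)` occurs on both sides
-- and is cancelled afterwards. Strictness then comes from `2uv<u²+v²` alone.
bernoulli-step : ∀ k u v →
  suc k * v ^ k * (u * u + v * v) ≤ u ^ suc (suc k) + suc k * v ^ suc (suc k) + k * (u * v ^ suc k)
bernoulli-step k u v = begin
  suc k * v ^ k * (u * u + v * v)
    ≡⟨ split k u v (v ^ k) ⟩
  u * (suc k * (u * v ^ k)) + suc k * v ^ suc (suc k)
    ≤⟨ +-monoˡ-≤ _ (*-monoʳ-≤ u (bernoulli k u v)) ⟩
  u * (u ^ suc k + k * v ^ suc k) + suc k * v ^ suc (suc k)
    ≡⟨ merge k u v (u ^ k) (v ^ k) ⟩
  u ^ suc (suc k) + suc k * v ^ suc (suc k) + k * (u * v ^ suc k) ∎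
  where
  open ≤-Reasoning
  split : ∀ k u v p → suc k * p * (u * u + v * v) ≡ u * (suc k * (u * p)) + suc k * (v * (v * p))
  split = solve-∀
  merge : ∀ k u v q p → u * (u * q + k * (v * p)) + suc k * (v * (v * p))
                      ≡ u * (u * q) + suc k * (v * (v * p)) + k * (u * (v * p))
  merge = solve-∀

bernoulli-double : ∀ k u v → suc k * v ^ k * (2 * (u * v)) ≡ suc (suc k) * (u * v ^ suc k) + k * (u * v ^ suc k)
bernoulli-double k u v = identity k u v (v ^ k)
  where
  identity : ∀ k u v p → suc k * p * (2 * (u * v)) ≡ suc (suc k) * (u * (v * p)) + k * (u * (v * p))
  identity = solve-∀

bernoulli zero    u v = ≤-reflexive (identity u)
  where
  identity : ∀ u → 1 * (u * 1) ≡ u * 1 + 0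
  identity = solve-∀
bernoulli (suc k) u v = +-cancelʳ-≤ (k * (u * v ^ suc k)) _ _ (begin
  suc (suc k) * (u * v ^ suc k) + k * (u * v ^ suc k) ≡⟨ bernoulli-double k u v ⟨
  suc k * v ^ k * (2 * (u * v))                       ≤⟨ *-monoʳ-≤ (suc k * v ^ k) (2uv≤u²+v² u v) ⟩
  suc k * v ^ k * (u * u + v * v)                     ≤⟨ bernoulli-step k u v ⟩
  u ^ suc (suc k) + suc k * v ^ suc (suc k) + k * (u * v ^ suc k) ∎)
  where open ≤-Reasoning

bernoulli-< : ∀ k u v → 0 < k → u ≢ v → suc k * (u * v ^ k) < u ^ suc k + k * v ^ suc k
bernoulli-< (suc k) zero    zero    _ u≢v = contradiction refl u≢v
-- For v = 0 the coefficient `v ^ k` can vanish and would destroy strictness; here the left side is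
-- 0 and the right side is a positive power.
bernoulli-< (suc k) (suc u) zero    _ u≢v =
  subst (_< suc u ^ suc (suc k) + suc k * 0 ^ suc (suc k)) (sym (trans (cong (suc (suc k) *_) (*-zeroʳ (suc u))) (*-zeroʳ k)))
    (m≤n⇒m≤n+o _ (^->0 {suc u} (suc (suc k)) z<s))
bernoulli-< (suc k) u v@(suc _) _ u≢v = +-cancelʳ-< (k * (u * v ^ suc k)) _ _ (begin-strict
  suc (suc k) * (u * v ^ suc k) + k * (u * v ^ suc k) ≡⟨ bernoulli-double k u v ⟨
  suc k * v ^ k * (2 * (u * v))                       <⟨ *-monoʳ-<′ (suc k * v ^ k) (*->0 {suc k} z<s (^->0 k z<s)) (2uv<u²+v² u v u≢v) ⟩
  suc k * v ^ k * (u * u + v * v)                     ≤⟨ bernoulli-step k u v ⟩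
  u ^ suc (suc k) + suc k * v ^ suc (suc k) + k * (u * v ^ suc k) ∎)
  where open ≤-Reasoning

-- Bernoulli at u = n (b + y), v = (n + 1) y: both sides of the AM-GM step, scaled by n
-- and shifted by the same summand.
module _ (n b y : ℕ) where
  private
    u = n * (b + y)
    v = suc n * y
    shift = n * v ^ suc n

  am-gm-lhs : n * (suc n ^ suc n * (b * y ^ n)) + shift ≡ suc n * (u * v ^ n)
  am-gm-lhs = trans
    (cong (λ p → n * (suc n ^ suc n * (b * y ^ n)) + n * (suc n * y * p)) (^-distribʳ-* (suc n) y n))
    (trans (identity n b y (suc n ^ n) (y ^ n))
      (cong (λ p → suc n * (n * (b + y) * p)) (sym (^-distribʳ-* (suc n) y n))))
    where
    identity : ∀ n b y p q → n * (suc n * p * (b * q)) + n * (suc n * y * (p * q))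
                           ≡ suc n * (n * (b + y) * (p * q))
    identity = solve-∀

  am-gm-rhs : n * (n ^ n * (b + y) ^ suc n) + shift ≡ u ^ suc n + n * v ^ suc n
  am-gm-rhs = cong (_+ shift) (trans (sym (*-assoc n (n ^ n) _)) (sym (^-distribʳ-* n (b + y) (suc n))))

-- AM-GM for `b` and `n` copies of y / n, with denominators cleared; hence equality means
-- `n * b ≡ y`.
am-gm-step : ∀ n b y → suc n ^ suc n * (b * y ^ n) ≤ n ^ n * (b + y) ^ suc n
am-gm-step zero      b y = ≤-trans (≤-reflexive (identity b)) (≤-trans (m≤m+n b y) (≤-reflexive (sym (identity′ (b + y)))))
  where
  identity : ∀ b → 1 * (b * 1) ≡ b
  identity = solve-∀
  identity′ : ∀ x → 1 * (x * 1) ≡ x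
  identity′ = solve-∀
am-gm-step n@(suc _) b y = *-cancelˡ-≤ n (+-cancelʳ-≤ (n * (suc n * y) ^ suc n) _ _
  (subst₂ _≤_ (sym (am-gm-lhs n b y)) (sym (am-gm-rhs n b y)) (bernoulli n (n * (b + y)) (suc n * y))))

am-gm-step-≡ : ∀ n b y → 0 < n → suc n ^ suc n * (b * y ^ n) ≡ n ^ n * (b + y) ^ suc n → n * b ≡ y
am-gm-step-≡ n b y 0<n eq with n * (b + y) ≟ suc n * y
... | yes u≡v = +-cancelʳ-≡ (n * y) _ _ (trans (sym (*-distribˡ-+ n b y)) u≡v)
... | no  u≢v = contradiction
  (trans (sym (am-gm-lhs n b y)) (trans (cong (λ x → n * x + n * (suc n * y) ^ suc n) eq) (am-gm-rhs n b y)))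
  (<⇒≢ (bernoulli-< n (n * (b + y)) (suc n * y) 0<n u≢v))

n^n>0 : ∀ n → 0 < n ^ n
n^n>0 zero    = z<s
n^n>0 (suc n) = ^->0 (suc n) z<s

-- Induction on `t` adds one copy of `b` at a time; `am-gm-step` weighs the new copy against the sum
-- of the `t + s` terms already present.
weighted-am-gm : ∀ s t a b → a ^ s * b ^ t * (t + s) ^ (t + s) ≤ (t * b + s * a) ^ (t + s)

weighted-am-gm-chain : ∀ s t a b →
  a ^ s * b ^ suc t * suc (t + s) ^ suc (t + s) * (t + s) ^ (t + s)
    ≤ suc (t + s) ^ suc (t + s) * (b * (t * b + s * a) ^ (t + s))
weighted-am-gm-chain s t a b = begin
  a ^ s * b ^ suc t * suc n ^ suc n * n ^ n
    ≡⟨ shuffle (a ^ s) b (b ^ t) (suc n ^ suc n) (n ^ n) ⟩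
  suc n ^ suc n * (b * (a ^ s * b ^ t * n ^ n))
    ≤⟨ *-monoʳ-≤ (suc n ^ suc n) (*-monoʳ-≤ b (weighted-am-gm s t a b)) ⟩
  suc n ^ suc n * (b * (t * b + s * a) ^ n) ∎
  where
  open ≤-Reasoning
  n = t + s
  shuffle : ∀ p b q r x → p * (b * q) * r * x ≡ r * (b * (p * q * x))
  shuffle = solve-∀

weighted-am-gm s zero    a b = ≤-reflexive (trans (cong (_* s ^ s) (*-identityʳ (a ^ s)))
  (trans (*-comm (a ^ s) (s ^ s)) (sym (^-distribʳ-* s a s))))
weighted-am-gm s (suc t) a b = *-cancelˡ-≤′ (n ^ n) (n^n>0 n) (begin
  n ^ n * (a ^ s * b ^ suc t * suc n ^ suc n)  ≡⟨ *-comm (n ^ n) _ ⟩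
  a ^ s * b ^ suc t * suc n ^ suc n * n ^ n    ≤⟨ weighted-am-gm-chain s t a b ⟩
  suc n ^ suc n * (b * (t * b + s * a) ^ n)    ≤⟨ am-gm-step n b (t * b + s * a) ⟩
  n ^ n * (b + (t * b + s * a)) ^ suc n        ≡⟨ cong (λ x → n ^ n * x ^ suc n) (+-assoc b (t * b) (s * a)) ⟨
  n ^ n * (suc t * b + s * a) ^ suc n          ∎)
  where
  open ≤-Reasoning
  n = t + s

-- The last added copy of `b` decides: equality there says that (t + s) b = t b + s a, and s can be
-- cancelled.
weighted-am-gm-≡ : ∀ s t a b → 0 < s → 0 < t →
  a ^ s * b ^ t * (t + s) ^ (t + s) ≡ (t * b + s * a) ^ (t + s) → a ≡ b
weighted-am-gm-≡ s (suc t) a b 0<s _ eq =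
  sym (*-cancelˡ-≡′ s 0<s (+-cancelˡ-≡ (t * b) _ _ (trans (sym (*-distribʳ-+ b t s))
    (am-gm-step-≡ n b y (≤-trans 0<s (m≤n+m s t)) (≤-antisym (am-gm-step n b y) (begin
      n ^ n * (b + y) ^ suc n                    ≡⟨ cong (λ x → n ^ n * x ^ suc n) (+-assoc b (t * b) (s * a)) ⟨
      n ^ n * (suc t * b + s * a) ^ suc n        ≡⟨ cong (n ^ n *_) eq ⟨
      n ^ n * (a ^ s * b ^ suc t * suc n ^ suc n) ≡⟨ *-comm (n ^ n) _ ⟩
      a ^ s * b ^ suc t * suc n ^ suc n * n ^ n  ≤⟨ weighted-am-gm-chain s t a b ⟩
      suc n ^ suc n * (b * y ^ n)                ∎))))))
  where
  open ≤-Reasoning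
  n = t + s
  y = t * b + s * a

-- Finite sums and products

χ : Bool → ℕ
χ true  = 1
χ false = 0

sum-≤ : ∀ {n} {f g : Fin n → ℕ} → (∀ i → f i ≤ g i) → sum f ≤ sum g
sum-≤ {zero}  f≤g = z≤n
sum-≤ {suc n} f≤g = +-mono-≤ (f≤g zero) (sum-≤ (f≤g ∘ suc))

sum-const : ∀ n k → sum {n} (λ _ → k) ≡ n * k
sum-const zero    k = refl
sum-const (suc n) k = cong (k +_) (sum-const n k)

sum-zero : ∀ n → sum {n} (λ _ → 0) ≡ 0
sum-zero n = trans (sum-const n 0) (*-zeroʳ n)

term≤sum : ∀ {n} (f : Fin n → ℕ) i → f i ≤ sum f
term≤sum f zero    = m≤m+n _ _
term≤sum f (suc i) = ≤-trans (term≤sum (f ∘ suc) i) (m≤n+m _ (f zero))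

sum>0⇒∃ : ∀ {n} (f : Fin n → ℕ) → 0 < sum f → ∃[ i ] 0 < f i
sum>0⇒∃ {suc n} f 0<s with ≡0⊎>0 (f zero)
... | inj₂ 0<f = zero , 0<f
... | inj₁ f≡0 with sum>0⇒∃ (f ∘ suc) (subst (λ x → 0 < x + sum (f ∘ suc)) f≡0 0<s)
...   | i , 0<fi = suc i , 0<fi

prod-≤ : ∀ {n} {f g : Fin n → ℕ} → (∀ i → f i ≤ g i) → prod f ≤ prod g
prod-≤ {zero}  f≤g = ≤-refl
prod-≤ {suc n} f≤g = *-mono-≤ (f≤g zero) (prod-≤ (f≤g ∘ suc))

prod-zero : ∀ {n} (f : Fin n → ℕ) i → f i ≡ 0 → prod f ≡ 0
prod-zero f zero    f≡0 = cong (_* prod (f ∘ suc)) f≡0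
prod-zero f (suc i) f≡0 = trans (cong (f zero *_) (prod-zero (f ∘ suc) i f≡0)) (*-zeroʳ (f zero))

prod-one : ∀ n → prod {n} (λ _ → 1) ≡ 1
prod-one zero    = refl
prod-one (suc n) = trans (+-identityʳ _) (prod-one n)

prod-cong : ∀ {n} {f g : Fin n → ℕ} → (∀ i → f i ≡ g i) → prod f ≡ prod g
prod-cong = Prod.sum-cong-≗

prod-* : ∀ {n} (f g : Fin n → ℕ) → prod (λ i → f i * g i) ≡ prod f * prod g
prod-* = Prod.∑-distrib-+

prod-^ : ∀ {n} (f : Fin n → ℕ) k → prod (λ i → f i ^ k) ≡ prod f ^ k
prod-^ {zero}  f k = sym (^-zeroˡ k)
prod-^ {suc n} f k = trans (cong (f zero ^ k *_) (prod-^ (f ∘ suc) k)) (sym (^-distribʳ-* (f zero) _ k))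

^-sum : ∀ {n} x (f : Fin n → ℕ) → prod (λ i → x ^ f i) ≡ x ^ sum f
^-sum {zero}  x f = refl
^-sum {suc n} x f = trans (cong (x ^ f zero *_) (^-sum x (f ∘ suc))) (sym (^-distribˡ-+-* x (f zero) _))

m*n>0⇒m>0 : ∀ m {n} → 0 < m * n → 0 < m
m*n>0⇒m>0 (suc m) _ = z<s

m*n>0⇒n>0 : ∀ m {n} → 0 < m * n → 0 < n
m*n>0⇒n>0 m {n} 0<mn = m*n>0⇒m>0 n (subst (0 <_) (*-comm m n) 0<mn)

prod-squeeze : ∀ {n} {f g : Fin n → ℕ} → (∀ i → f i ≤ g i) → 0 < prod g → prod f ≡ prod g → ∀ i → f i ≡ g i
prod-squeeze {suc n} {f} {g} f≤g 0<g eq zero    = *-squeezeˡ (f≤g zero) (prod-≤ (f≤g ∘ suc)) 0<g eq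
prod-squeeze {suc n} {f} {g} f≤g 0<g eq (suc i) =
  prod-squeeze (f≤g ∘ suc) (m*n>0⇒n>0 (g zero) 0<g) (*-squeezeʳ (f≤g zero) (prod-≤ (f≤g ∘ suc)) 0<g eq) i

-- The log-sum inequality

module _ (r s t : ℕ) where
  private
    c = t ^ s * s ^ t

  log-sum₂-lhs : c * ((t + s) ^ (t + s) * r ^ s) ≡ (r * t) ^ s * s ^ t * (t + s) ^ (t + s)
  log-sum₂-lhs = trans (identity (t ^ s) (s ^ t) ((t + s) ^ (t + s)) (r ^ s))
    (cong (λ x → x * s ^ t * (t + s) ^ (t + s)) (sym (^-distribʳ-* r t s)))
    where
    identity : ∀ a b p q → a * b * (p * q) ≡ q * a * b * p
    identity = solve-∀

  log-sum₂-rhs : c * (suc r ^ (t + s) * (t ^ t * s ^ s)) ≡ (t * s + s * (r * t)) ^ (t + s)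
  log-sum₂-rhs = trans (identity (t ^ s) (s ^ t) (suc r ^ (t + s)) (t ^ t) (s ^ s))
    (trans (cong₂ (λ x y → suc r ^ (t + s) * (x * y)) (sym (^-distribˡ-+-* t t s)) (sym (^-distribˡ-+-* s t s)))
    (trans (cong (suc r ^ (t + s) *_) (sym (^-distribʳ-* t s (t + s))))
    (trans (sym (^-distribʳ-* (suc r) (t * s) (t + s)))
      (cong (_^ (t + s)) (identity′ r t s)))))
    where
    identity : ∀ a b p x y → a * b * (p * (x * y)) ≡ p * (x * a * (b * y))
    identity = solve-∀
    identity′ : ∀ r t s → suc r * (t * s) ≡ t * s + s * (r * t)
    identity′ = solve-∀

-- The log-sum inequality for one cell of value t and r cells of value s / r. It is weighted AM-GM
-- for the values r t and s with weights s and t, divided by `t ^ s * s ^ t`; this factor can vanish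
-- when s or t is 0, so those cases are separate.
log-sum₂ : ∀ r s t → (t + s) ^ (t + s) * r ^ s ≤ suc r ^ (t + s) * (t ^ t * s ^ s)
log-sum₂ r zero      t = ≤-trans (≤-reflexive (identity ((t + 0) ^ (t + 0))))
  (*-mono-≤ {1} (^->0 (t + 0) z<s) (≤-reflexive (trans (cong (λ x → x ^ x) (+-identityʳ t)) (sym (*-identityʳ (t ^ t))))))
  where
  identity : ∀ x → x * 1 ≡ 1 * x
  identity = solve-∀
log-sum₂ r s@(suc _) zero    = ≤-trans (*-monoʳ-≤ (s ^ s) (^-monoˡ-≤ s (n≤1+n r)))
  (≤-reflexive (trans (*-comm (s ^ s) (suc r ^ s)) (cong (suc r ^ s *_) (sym (+-identityʳ (s ^ s))))))
log-sum₂ r s@(suc _) t@(suc _) = *-cancelˡ-≤′ (t ^ s * s ^ t) (*->0 (^->0 s z<s) (^->0 t z<s))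
  (subst₂ _≤_ (sym (log-sum₂-lhs r s t)) (sym (log-sum₂-rhs r s t)) (weighted-am-gm s t (r * t) s))

log-sum₂-≡ : ∀ r s t → (t + s) ^ (t + s) * r ^ s ≡ suc r ^ (t + s) * (t ^ t * s ^ s) → r * t ≡ s
log-sum₂-≡ r zero      zero      eq = *-zeroʳ r
log-sum₂-≡ zero zero   (suc t)   eq = refl
log-sum₂-≡ r@(suc _) zero t@(suc _) eq = contradiction
  (*-cancelʳ-≡′ {suc r ^ t} {1} (t ^ t) (n^n>0 t) (trans (cong₂ _*_ (cong (suc r ^_) (sym (+-identityʳ t))) (sym (*-identityʳ (t ^ t))))
    (trans (sym eq) (trans (cong (λ x → x ^ x * 1) (+-identityʳ t)) (identity (t ^ t))))))
  (≢-sym (<⇒≢ (subst (_< suc r ^ t) (^-zeroˡ t) (^-monoˡ-< t {1} {suc r} (s<s z<s)))))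
  where
  identity : ∀ x → x * 1 ≡ 1 * x
  identity = solve-∀
log-sum₂-≡ r s@(suc _) zero      eq = contradiction
  (*-cancelˡ-≡′ (s ^ s) (n^n>0 s) (trans eq (trans (cong (suc r ^ s *_) (+-identityʳ (s ^ s))) (*-comm (suc r ^ s) (s ^ s)))))
  (<⇒≢ (^-monoˡ-< s (n<1+n r)))
log-sum₂-≡ r s@(suc _) t@(suc _) eq = weighted-am-gm-≡ s t (r * t) s z<s z<s
  (trans (sym (log-sum₂-lhs r s t)) (trans (cong (t ^ s * s ^ t *_) eq) (log-sum₂-rhs r s t)))

count : ∀ {n} → (Fin n → Bool) → ℕ
count e = sum (χ ∘ e)

module _ {n} (e : Fin n → Bool) (y : Fin n → ℕ) where

  -- The exponential form of S log S ≤ S log c + Σ y log y, where S is the sum of `y` and c the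
  -- number of cells marked by `e`.
  log-sum-lhs log-sum-rhs : ℕ
  log-sum-lhs = sum y ^ sum y
  log-sum-rhs = count e ^ sum y * prod (λ i → y i ^ y i)

count^sum>0 : ∀ {n} (e : Fin n → Bool) (y : Fin n → ℕ) → (∀ i → e i ≡ false → y i ≡ 0) → 0 < count e ^ sum y
count^sum>0 {n} e y supp with ≡0⊎>0 (sum y)
... | inj₁ s≡0 = subst (λ x → 0 < count e ^ x) (sym s≡0) z<s
... | inj₂ 0<s with sum>0⇒∃ y 0<s
...   | i , 0<yi with e i in ei
...     | false = contradiction (sym (supp i ei)) (<⇒≢ 0<yi)
...     | true  = ^->0 (sum y) (≤-trans (≤-reflexive (cong χ (sym ei))) (term≤sum (χ ∘ e) i))

-- The first marked cell is split off: `log-sum₂` treats the total of the other cells as if it were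
-- spread evenly over them, and the induction hypothesis accounts for the actual spread. The common
-- factor `r ^ s` is positive, so it cancels.
log-sum : ∀ {n} (e : Fin n → Bool) (y : Fin n → ℕ) → (∀ i → e i ≡ false → y i ≡ 0) →
  log-sum-lhs e y ≤ log-sum-rhs e y

module LogSumStep {n} (e : Fin (suc n) → Bool) (y : Fin (suc n) → ℕ)
  (supp : ∀ i → e i ≡ false → y i ≡ 0) (e₀ : e zero ≡ true) where
  r s t p : ℕ
  r = count (e ∘ suc)
  s = sum (y ∘ suc)
  t = y zero
  p = prod (λ i → y (suc i) ^ y (suc i))

  r^s>0 : 0 < r ^ s
  r^s>0 = count^sum>0 (e ∘ suc) (y ∘ suc) (supp ∘ suc)

  middle : ℕ
  middle = suc r ^ (t + s) * (t ^ t * s ^ s)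

  lhs≤middle : r ^ s * log-sum-lhs e y ≤ middle
  lhs≤middle = subst (_≤ middle) (*-comm ((t + s) ^ (t + s)) (r ^ s)) (log-sum₂ r s t)

  middle≤rhs : middle ≤ suc r ^ (t + s) * (t ^ t * (r ^ s * p))
  middle≤rhs = *-monoʳ-≤ (suc r ^ (t + s)) (*-monoʳ-≤ (t ^ t) (log-sum (e ∘ suc) (y ∘ suc) (supp ∘ suc)))

  rhs-≡ : suc r ^ (t + s) * (t ^ t * (r ^ s * p)) ≡ r ^ s * log-sum-rhs e y
  rhs-≡ = trans (identity (suc r ^ (t + s)) (t ^ t) (r ^ s) p)
    (cong (λ x → r ^ s * ((x + r) ^ (t + s) * (t ^ t * p))) (cong χ (sym e₀)))
    where
    identity : ∀ a b c p → a * (b * (c * p)) ≡ c * (a * (b * p))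
    identity = solve-∀

log-sum {zero}  e y supp = ≤-refl
log-sum {suc n} e y supp with e zero in e₀
... | true  = *-cancelˡ-≤′ (r ^ s) r^s>0 (≤-trans lhs≤middle (≤-trans middle≤rhs (≤-reflexive
                (trans rhs-≡ (cong (λ x → r ^ s * ((χ x + r) ^ (t + s) * (t ^ t * p))) e₀)))))
  where open LogSumStep e y supp e₀
... | false rewrite supp zero e₀ = subst (λ x → sum (y ∘ suc) ^ sum (y ∘ suc) ≤ count (e ∘ suc) ^ sum (y ∘ suc) * x)
                (sym (+-identityʳ _)) (log-sum (e ∘ suc) (y ∘ suc) (supp ∘ suc))

log-sum-≡ : ∀ {n} (e : Fin n → Bool) (y : Fin n → ℕ) → (∀ i → e i ≡ false → y i ≡ 0) →
  log-sum-lhs e y ≡ log-sum-rhs e y → ∀ i → e i ≡ true → count e * y i ≡ sum y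
log-sum-≡ {suc n} e y supp eq i ei with e zero in e₀
log-sum-≡ {suc n} e y supp eq i ei | false rewrite supp zero e₀ = tail i ei
  where
  tail : ∀ i → e i ≡ true → count (e ∘ suc) * y i ≡ sum (y ∘ suc)
  tail zero    ei = contradiction (trans (sym ei) e₀) λ ()
  tail (suc i) ei = log-sum-≡ (e ∘ suc) (y ∘ suc) (supp ∘ suc) (trans eq (cong (count (e ∘ suc) ^ sum (y ∘ suc) *_) (+-identityʳ _))) i ei
log-sum-≡ {suc n} e y supp eq i ei | true = result i ei
  where
  open LogSumStep e y supp e₀
  ends : r ^ s * log-sum-lhs e y ≡ suc r ^ (t + s) * (t ^ t * (r ^ s * p))
  ends = trans (cong (r ^ s *_) (trans eq (cong (λ x → (χ x + r) ^ (t + s) * (t ^ t * p)) (sym e₀)))) (sym rhs-≡)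
  rt≡s : r * t ≡ s
  rt≡s = log-sum₂-≡ r s t (trans (*-comm _ (r ^ s))
    (≤-antisym lhs≤middle (≤-trans middle≤rhs (≤-reflexive (sym ends)))))
  tail-≡ : log-sum-lhs (e ∘ suc) (y ∘ suc) ≡ log-sum-rhs (e ∘ suc) (y ∘ suc)
  tail-≡ = *-cancelˡ-≡′ (t ^ t) (n^n>0 t) (*-cancelˡ-≡′ (suc r ^ (t + s)) (^->0 (t + s) z<s)
    (≤-antisym middle≤rhs (≤-trans (≤-reflexive (sym ends)) lhs≤middle)))
  result : ∀ i → e i ≡ true → suc r * y i ≡ t + s
  result zero    _  = cong (t +_) rt≡s
  result (suc i) ei = cong₂ _+_ yi≡t ryi≡s
    where
    ryi≡s : r * y (suc i) ≡ s
    ryi≡s = log-sum-≡ (e ∘ suc) (y ∘ suc) (supp ∘ suc) tail-≡ i ei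
    yi≡t : y (suc i) ≡ t
    yi≡t = *-cancelˡ-≡′ r (≤-trans (≤-reflexive (cong χ (sym ei))) (term≤sum (χ ∘ e ∘ suc) i)) (trans ryi≡s (sym rt≡s))

-- Matchings covering a prescribed vertex set

χ-∧ : ∀ a b → χ (a ∧ b) ≡ χ a * χ b
χ-∧ true  b = sym (+-identityʳ (χ b))
χ-∧ false b = refl

χ≤1 : ∀ b → χ b ≤ 1
χ≤1 true  = ≤-refl
χ≤1 false = z≤n

listSum : ∀ {A : Set} → (A → ℕ) → List A → ℕ
listSum f []       = 0
listSum f (x ∷ xs) = f x + listSum f xs

listSum-cong : ∀ {A : Set} {f g : A → ℕ} xs → (∀ x → f x ≡ g x) → listSum f xs ≡ listSum g xs
listSum-cong []       eq = refl
listSum-cong (x ∷ xs) eq = cong₂ _+_ (eq x) (listSum-cong xs eq)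

listSum-+ : ∀ {A : Set} (f g : A → ℕ) xs → listSum (λ x → f x + g x) xs ≡ listSum f xs + listSum g xs
listSum-+ f g []       = refl
listSum-+ f g (x ∷ xs) = trans (cong (f x + g x +_) (listSum-+ f g xs)) (shuffle (f x) (g x) _ _)
  where
  shuffle : ∀ a b c d → a + b + (c + d) ≡ a + c + (b + d)
  shuffle = solve-∀

listSum-* : ∀ {A : Set} k (f : A → ℕ) xs → listSum (λ x → k * f x) xs ≡ k * listSum f xs
listSum-* k f []       = sym (*-zeroʳ k)
listSum-* k f (x ∷ xs) = trans (cong (k * f x +_) (listSum-* k f xs)) (sym (*-distribˡ-+ k (f x) _))

listSum-zero : ∀ {A : Set} {f : A → ℕ} xs → (∀ x → f x ≡ 0) → listSum f xs ≡ 0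
listSum-zero []       eq = refl
listSum-zero (x ∷ xs) eq = cong₂ _+_ (eq x) (listSum-zero xs eq)

listSum-++ : ∀ {A : Set} (f : A → ℕ) xs ys → listSum f (xs ++ ys) ≡ listSum f xs + listSum f ys
listSum-++ f []       ys = refl
listSum-++ f (x ∷ xs) ys = trans (cong (f x +_) (listSum-++ f xs ys)) (sym (+-assoc (f x) _ _))

listSum-map : ∀ {A B : Set} (f : B → ℕ) (g : A → B) xs → listSum f (map g xs) ≡ listSum (f ∘ g) xs
listSum-map f g []       = refl
listSum-map f g (x ∷ xs) = cong (f (g x) +_) (listSum-map f g xs)

listSum-filter : ∀ {A : Set} {P : A → Set} (P? : ∀ x → Dec (P x)) (f : A → ℕ) xs →
  listSum f (filter P? xs) ≡ listSum (λ x → χ (does (P? x)) * f x) xs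
listSum-filter P? f []       = refl
listSum-filter P? f (x ∷ xs) with does (P? x)
... | true  = cong₂ _+_ (sym (+-identityʳ (f x))) (listSum-filter P? f xs)
... | false = listSum-filter P? f xs

listSum-tabulate : ∀ {A : Set} {n} (f : A → ℕ) (g : Fin n → A) → listSum f (tabulate g) ≡ sum (f ∘ g)
listSum-tabulate {n = zero}  f g = refl
listSum-tabulate {n = suc n} f g = cong (f (g zero) +_) (listSum-tabulate f (g ∘ suc))

listSum-cartesianProduct : ∀ {A B : Set} (f : A × B → ℕ) xs ys →
  listSum f (cartesianProduct xs ys) ≡ listSum (λ x → listSum (λ y → f (x , y)) ys) xs
listSum-cartesianProduct f []       ys = refl
listSum-cartesianProduct f (x ∷ xs) ys = trans (listSum-++ f (map (x ,_) ys) _)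
  (cong₂ _+_ (listSum-map f (x ,_) ys) (listSum-cartesianProduct f xs ys))

listSum-pairs : ∀ {n} (f : Fin n × Fin n → ℕ) →
  listSum f (cartesianProduct (allFin n) (allFin n)) ≡ sum (λ i → sum (λ j → f (i , j)))
listSum-pairs {n} f = trans (listSum-cartesianProduct f (allFin n) (allFin n))
  (trans (listSum-tabulate row id) (sum-cong-≗ {n} λ i → listSum-tabulate (λ j → f (i , j)) id))
  where
  row : Fin n → ℕ
  row i = listSum (λ j → f (i , j)) (allFin n)

length≡listSum : ∀ {A : Set} (xs : List A) → length xs ≡ listSum (λ _ → 1) xs
length≡listSum []       = refl
length≡listSum (x ∷ xs) = cong suc (length≡listSum xs)

sum-δ : ∀ {n} (a : Fin n) (f : Fin n → ℕ) → sum (λ i → χ (does (a Fin.≟ i)) * f i) ≡ f a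
sum-δ {suc n} zero    f = trans (cong₂ _+_ (+-identityʳ (f zero)) (sum-zero n)) (+-identityʳ (f zero))
sum-δ {suc n} (suc a) f = sum-δ a (f ∘ suc)

-- In pm E S, none decides emptiness of S; it is a parameter so that S may range over
-- predicates on any type of vertices.
module Matching {V : Set} (_≟ⱽ_ : DecidableEquality V) (none : (V → Bool) → ℕ)
  (none-cong : ∀ {S T} → (∀ v → S v ≡ T v) → none S ≡ none T)
  (none-∋ : ∀ {S} a → S a ≡ true → none S ≡ 0) where

  _==_ : V → V → Bool
  u == v = does (u ≟ⱽ v)

  ==-refl : ∀ v → (v == v) ≡ true
  ==-refl v with v ≟ⱽ v
  ... | yes _  = refl
  ... | no v≢v = contradiction refl v≢v

  ==-sym : ∀ u v → (u == v) ≡ (v == u)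
  ==-sym u v with u ≟ⱽ v | v ≟ⱽ u
  ... | yes _    | yes _    = refl
  ... | no _     | no _     = refl
  ... | yes refl | no v≢v   = contradiction refl v≢v
  ... | no v≢v   | yes refl = contradiction refl v≢v

  infixl 6 _⊖_
  _⊖_ : (V → Bool) → V → (V → Bool)
  (S ⊖ a) v = S v ∧ not (v == a)

  ⊖-cong : ∀ {S T} → (∀ v → S v ≡ T v) → ∀ a v → (S ⊖ a) v ≡ (T ⊖ a) v
  ⊖-cong eq a v = cong (_∧ not (v == a)) (eq v)

  ⊖-comm : ∀ S a b v → (S ⊖ a ⊖ b) v ≡ (S ⊖ b ⊖ a) v
  ⊖-comm S a b v = trans (Bool.∧-assoc (S v) _ _)
    (trans (cong (S v ∧_) (Bool.∧-comm (not (v == a)) _)) (sym (Bool.∧-assoc (S v) _ _)))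

  fit : (V → Bool) → V × V → ℕ
  fit S (u , v) = χ (S u) * χ (S v)

  infixl 6 _⊖ᴱ_
  _⊖ᴱ_ : (V → Bool) → V × V → (V → Bool)
  S ⊖ᴱ (u , v) = S ⊖ u ⊖ v

  -- Counts the sublists of `E` that cover every vertex of `S` once and no other vertex, according
  -- to whether the first edge is skipped or used.
  pm : List (V × V) → (V → Bool) → ℕ
  pm []      S = none S
  pm (e ∷ E) S = pm E S + fit S e * pm E (S ⊖ᴱ e)

  pm-cong : ∀ E {S T} → (∀ v → S v ≡ T v) → pm E S ≡ pm E T
  pm-cong []            eq = none-cong eq
  pm-cong ((u , v) ∷ E) eq = cong₂ _+_ (pm-cong E eq)
    (cong₂ _*_ (cong₂ (λ x y → χ x * χ y) (eq u) (eq v)) (pm-cong E (⊖-cong (⊖-cong eq u) v)))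

  pm-∅ : ∀ E {S} → (∀ v → S v ≡ false) → pm E S ≡ none S
  pm-∅ []            eq = refl
  pm-∅ ((u , v) ∷ E) {S} eq = trans (cong₂ _+_ (pm-∅ E eq) (cong (λ x → χ x * χ (S v) * pm E (S ⊖ u ⊖ v)) (eq u)))
    (+-identityʳ _)

  incident : V → V × V → Bool
  incident a (u , v) = (a == u) ∨ (a == v)

  ⊖ᴱ-incident : ∀ S {a} e → incident a e ≡ true → (S ⊖ᴱ e) a ≡ false
  ⊖ᴱ-incident S {a} (u , v) a∈e with a == u | a == v
  ... | true  | _    = cong (_∧ _) (Bool.∧-zeroʳ (S a))
  ... | false | true = Bool.∧-zeroʳ (S a ∧ true)

  ⊖ᴱ-not-incident : ∀ S {a} e → incident a e ≡ false → (S ⊖ᴱ e) a ≡ S a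
  ⊖ᴱ-not-incident S {a} (u , v) a∉e with a == u | a == v
  ... | false | false = trans (Bool.∧-identityʳ (S a ∧ true)) (Bool.∧-identityʳ (S a))

  fit-zero : ∀ S {a} e → incident a e ≡ true → S a ≡ false → fit S e ≡ 0
  fit-zero S {a} (u , v) a∈e Sa with a ≟ⱽ u | a ≟ⱽ v
  ... | yes refl | _        rewrite Sa = refl
  ... | no _     | yes refl rewrite Sa = *-zeroʳ (χ (S u))

  fit-⊖ᴱ-self : ∀ S e → fit (S ⊖ᴱ e) e ≡ 0
  fit-⊖ᴱ-self S e@(u , v) = fit-zero (S ⊖ᴱ e) e u∈e (⊖ᴱ-incident S e u∈e)
    where
    u∈e : incident u e ≡ true
    u∈e rewrite ==-refl u = refl

  ⊖ᴱ-comm : ∀ S e f x → (S ⊖ᴱ e ⊖ᴱ f) x ≡ (S ⊖ᴱ f ⊖ᴱ e) x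
  ⊖ᴱ-comm S (u , v) (w , z) x =
    trans (⊖-cong (⊖-comm (S ⊖ u) v w) z x)
    (trans (⊖-comm (S ⊖ u ⊖ w) v z x)
    (trans (⊖-cong (⊖-cong (⊖-comm S u w) z) v x)
      (⊖-cong (⊖-comm (S ⊖ w) u z) v x)))

  χ-⊖ : ∀ S a b v → χ ((S ⊖ a ⊖ b) v) ≡ χ (S v) * χ (not (v == a)) * χ (not (v == b))
  χ-⊖ S a b v = trans (χ-∧ ((S ⊖ a) v) (not (v == b))) (cong (_* χ (not (v == b))) (χ-∧ (S v) (not (v == a))))

  -- Both sides say that e and f are disjoint edges inside S.
  fit-swap : ∀ S e f → fit S f * fit (S ⊖ᴱ f) e ≡ fit S e * fit (S ⊖ᴱ e) f
  fit-swap S (u , v) (w , z)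
    rewrite χ-⊖ S w z u | χ-⊖ S w z v | χ-⊖ S u v w | χ-⊖ S u v z
          | ==-sym w u | ==-sym w v | ==-sym z u | ==-sym z v =
    identity (χ (S u)) (χ (S v)) (χ (S w)) (χ (S z)) _ _ _ _
    where
    identity : ∀ u v w z a b c d → w * z * (u * a * b * (v * c * d)) ≡ u * v * (w * a * c * (z * b * d))
    identity = solve-∀

  expand-at : (V → Bool) → V → List (V × V) → V × V → ℕ
  expand-at S a E e = χ (incident a e) * fit S e * pm E (S ⊖ᴱ e)

  -- Exactly one chosen edge covers `a`. When `e` joins the list, each term f gains `disjoint f`,
  -- the matchings that use both f and `e`. These vanish if `e` also meets `a`; otherwise `fit-swap`
  -- exchanges the two deletions and the induction hypothesis at `S ⊖ᴱ e` adds them up. The chosen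
  -- edge may stay in the list, since it no longer fits once its ends are deleted.
  pm-expand : ∀ E S a → S a ≡ true → pm E S ≡ listSum (expand-at S a E) E
  pm-expand []      S a Sa = none-∋ a Sa
  pm-expand (e ∷ E) S a Sa = sym (begin
    expand-at S a (e ∷ E) e + listSum (expand-at S a (e ∷ E)) E
      ≡⟨ cong₂ _+_ head-term (trans (listSum-cong E tail-term) (listSum-+ _ _ E)) ⟩
    χ (incident a e) * fit S e * pm E (S ⊖ᴱ e) + (listSum (expand-at S a E) E + listSum disjoint E)
      ≡⟨ cong (λ x → χ (incident a e) * fit S e * pm E (S ⊖ᴱ e) + (x + listSum disjoint E)) (pm-expand E S a Sa) ⟨
    χ (incident a e) * fit S e * pm E (S ⊖ᴱ e) + (pm E S + listSum disjoint E)
      ≡⟨ shuffle (χ (incident a e) * fit S e * pm E (S ⊖ᴱ e)) (pm E S) _ ⟩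
    pm E S + (χ (incident a e) * fit S e * pm E (S ⊖ᴱ e) + listSum disjoint E)
      ≡⟨ cong (pm E S +_) new ⟩
    pm E S + fit S e * pm E (S ⊖ᴱ e) ∎)
    where
    open ≡-Reasoning
    shuffle : ∀ a b c → a + (b + c) ≡ b + (a + c)
    shuffle = solve-∀
    disjoint : V × V → ℕ
    disjoint f = χ (incident a f) * (fit S f * fit (S ⊖ᴱ f) e) * pm E (S ⊖ᴱ f ⊖ᴱ e)
    head-term : expand-at S a (e ∷ E) e ≡ χ (incident a e) * fit S e * pm E (S ⊖ᴱ e)
    head-term = cong (χ (incident a e) * fit S e *_)
      (trans (cong (λ x → pm E (S ⊖ᴱ e) + x * pm E (S ⊖ᴱ e ⊖ᴱ e)) (fit-⊖ᴱ-self S e)) (+-identityʳ _))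
    tail-term : ∀ f → expand-at S a (e ∷ E) f ≡ expand-at S a E f + disjoint f
    tail-term f = identity (χ (incident a f)) (fit S f) (pm E (S ⊖ᴱ f)) (fit (S ⊖ᴱ f) e) (pm E (S ⊖ᴱ f ⊖ᴱ e))
      where
      identity : ∀ i f p g q → i * f * (p + g * q) ≡ i * f * p + i * (f * g) * q
      identity = solve-∀
    new : χ (incident a e) * fit S e * pm E (S ⊖ᴱ e) + listSum disjoint E ≡ fit S e * pm E (S ⊖ᴱ e)
    new with incident a e in a∈e
    ... | true  = trans (cong₂ _+_ (cong (_* pm E (S ⊖ᴱ e)) (+-identityʳ (fit S e))) (listSum-zero E vanish)) (+-identityʳ _)
      where
      vanish : ∀ f → disjoint f ≡ 0
      vanish f with incident a f in a∈f
      ... | false = refl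
      ... | true  rewrite fit-zero (S ⊖ᴱ f) e a∈e (⊖ᴱ-incident S f a∈f) | *-zeroʳ (fit S f) = refl
    ... | false = trans (listSum-cong E swap)
      (trans (listSum-* (fit S e) _ E) (cong (fit S e *_) (sym (pm-expand E (S ⊖ᴱ e) a (trans (⊖ᴱ-not-incident S e a∈e) Sa)))))
      where
      swap : ∀ f → disjoint f ≡ fit S e * expand-at (S ⊖ᴱ e) a E f
      swap f = trans (cong₂ (λ x y → χ (incident a f) * x * y) (fit-swap S e f) (pm-cong E (⊖ᴱ-comm S f e)))
        (identity (χ (incident a f)) (fit S e) (fit (S ⊖ᴱ e) f) _)
        where
        identity : ∀ i e g q → i * (e * g) * q ≡ e * (i * g * q)
        identity = solve-∀

none : ∀ {N} → (Fin N → Bool) → ℕ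
none S = prod (χ ∘ not ∘ S)

none-cong : ∀ {N} {S T : Fin N → Bool} → (∀ v → S v ≡ T v) → none S ≡ none T
none-cong eq = prod-cong (cong (χ ∘ not) ∘ eq)

none-∋ : ∀ {N} {S : Fin N → Bool} a → S a ≡ true → none S ≡ 0
none-∋ {S = S} a Sa = prod-zero (χ ∘ not ∘ S) a (cong (χ ∘ not) Sa)

none-∅ : ∀ {N} {S : Fin N → Bool} → (∀ v → S v ≡ false) → none S ≡ 1
none-∅ {N} S∅ = trans (prod-cong (cong (χ ∘ not) ∘ S∅)) (prod-one N)

module FinMatching {N : ℕ} = Matching (Fin._≟_ {N}) none none-cong none-∋
open FinMatching

count≡0⇒∅ : ∀ {N} (S : Fin N → Bool) → count S ≡ 0 → ∀ v → S v ≡ false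
count≡0⇒∅ S c≡0 v with S v in Sv
... | false = refl
... | true  = contradiction (≤-trans (≤-reflexive (cong χ (sym Sv))) (≤-trans (term≤sum (χ ∘ S) v) (≤-reflexive c≡0))) λ ()

χ>0⇒true : ∀ {b} → 0 < χ b → b ≡ true
χ>0⇒true {true} _ = refl

∅⊎∋ : ∀ {N} (S : Fin N → Bool) → (∀ v → S v ≡ false) ⊎ (∃[ a ] S a ≡ true)
∅⊎∋ S with ≡0⊎>0 (count S)
... | inj₁ c≡0 = inj₁ (count≡0⇒∅ S c≡0)
... | inj₂ 0<c with sum>0⇒∃ (χ ∘ S) 0<c
...   | a , 0<χSa = inj₂ (a , χ>0⇒true 0<χSa)

≢⇒== : ∀ {N} {u v : Fin N} → u ≢ v → (u == v) ≡ false
≢⇒== {u = u} {v} u≢v = dec-false (u Fin.≟ v) u≢v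

⊖-true : ∀ {N} (S : Fin N → Bool) a {v} → S v ≡ true → v ≢ a → (S ⊖ a) v ≡ true
⊖-true S a Sv v≢a rewrite Sv | ≢⇒== v≢a = refl

⊖-true⁻ : ∀ {N} (S : Fin N → Bool) a {v} → (S ⊖ a) v ≡ true → S v ≡ true × v ≢ a
⊖-true⁻ S a {v} eq with S v | v Fin.≟ a
... | true | no v≢a = refl , v≢a

count-⊖ : ∀ {N} (S : Fin N → Bool) a → S a ≡ true → suc (count (S ⊖ a)) ≡ count S
count-⊖ S a Sa = sym (begin
  count S                                                  ≡⟨ sum-cong-≗ split ⟩
  sum (λ v → χ (a == v) * 1 + χ ((S ⊖ a) v))               ≡⟨ ∑-distrib-+ (λ v → χ (a == v) * 1) _ ⟩
  sum (λ v → χ (a == v) * 1) + count (S ⊖ a)               ≡⟨ cong (_+ count (S ⊖ a)) (sum-δ a (λ _ → 1)) ⟩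
  suc (count (S ⊖ a))                                      ∎)
  where
  open ≡-Reasoning
  split : ∀ v → χ (S v) ≡ χ (a == v) * 1 + χ ((S ⊖ a) v)
  split v rewrite ==-sym v a with a Fin.≟ v
  ... | yes refl rewrite Sa = refl
  ... | no _     rewrite Bool.∧-identityʳ (S v) = refl

-- The permanent counts perfect matchings of the bipartite double cover

none₂ : ∀ {N} → (Fin N ⊎ Fin N → Bool) → ℕ
none₂ S = none (S ∘ inj₁) * none (S ∘ inj₂)

none₂-cong : ∀ {N} {S T : Fin N ⊎ Fin N → Bool} → (∀ v → S v ≡ T v) → none₂ S ≡ none₂ T
none₂-cong eq = cong₂ _*_ (none-cong (eq ∘ inj₁)) (none-cong (eq ∘ inj₂))

none₂-∋ : ∀ {N} {S : Fin N ⊎ Fin N → Bool} a → S a ≡ true → none₂ S ≡ 0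
none₂-∋ {S = S} (inj₁ a) Sa = cong (_* none (S ∘ inj₂)) (none-∋ {S = S ∘ inj₁} a Sa)
none₂-∋ {S = S} (inj₂ a) Sa = trans (cong (none (S ∘ inj₁) *_) (none-∋ {S = S ∘ inj₂} a Sa)) (*-zeroʳ (none (S ∘ inj₁)))

module DoubleCover {N : ℕ} = Matching (Sum.≡-dec (Fin._≟_ {N}) (Fin._≟_ {N})) none₂ none₂-cong none₂-∋

module Permanent {N : ℕ} (A : Fin N → Fin N → Bool) where
  private module D = DoubleCover {N}

  entry : Fin N × Fin N → (Fin N ⊎ Fin N) × (Fin N ⊎ Fin N)
  entry (i , c) = inj₁ i , inj₂ c

  entry? : (e : Fin N × Fin N) → Dec (T (A (proj₁ e) (proj₂ e)))
  entry? (i , c) = T? (A i c)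

  entries : List ((Fin N ⊎ Fin N) × (Fin N ⊎ Fin N))
  entries = map entry (filter entry? (cartesianProduct (allFin N) (allFin N)))

  -- The permanent of the submatrix with rows R and columns S. As a count of matchings it expands
  -- along a row and along a column by the same lemma, `pm-expand`, at a left or a right vertex of
  -- the double cover.
  perm : (R S : Fin N → Bool) → ℕ
  perm R S = D.pm entries [ R , S ]′

  perm-cong : ∀ {R R′ S S′} → (∀ v → R v ≡ R′ v) → (∀ v → S v ≡ S′ v) → perm R S ≡ perm R′ S′
  perm-cong R≗ S≗ = D.pm-cong entries λ { (inj₁ v) → R≗ v ; (inj₂ v) → S≗ v }

  perm-∅ : ∀ {R S} → (∀ v → R v ≡ false) → (∀ v → S v ≡ false) → perm R S ≡ 1
  perm-∅ R∅ S∅ = trans (D.pm-∅ entries λ { (inj₁ v) → R∅ v ; (inj₂ v) → S∅ v })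
    (cong₂ _*_ (none-∅ R∅) (none-∅ S∅))

  delete : ∀ R S i c → D.pm entries ([ R , S ]′ D.⊖ inj₁ i D.⊖ inj₂ c) ≡ perm (R ⊖ i) (S ⊖ c)
  delete R S i c = D.pm-cong entries λ
    { (inj₁ v) → Bool.∧-identityʳ ((R ⊖ i) v)
    ; (inj₂ v) → cong (_∧ not (v == c)) (Bool.∧-identityʳ (S v)) }

  listSum-entries : ∀ f → listSum f entries ≡ sum (λ i → sum (λ c → χ (A i c) * f (inj₁ i , inj₂ c)))
  listSum-entries f = trans (listSum-map f entry (filter entry? (cartesianProduct (allFin N) (allFin N))))
    (trans (listSum-filter entry? (f ∘ entry) (cartesianProduct (allFin N) (allFin N)))
      (listSum-pairs (λ (i , c) → χ (A i c) * f (entry (i , c)))))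

  perm-row : ∀ R S a → R a ≡ true →
    perm R S ≡ sum (λ c → χ (A a c) * χ (S c) * perm (R ⊖ a) (S ⊖ c))
  perm-row R S a Ra = begin
    perm R S
      ≡⟨ D.pm-expand entries [ R , S ]′ (inj₁ a) Ra ⟩
    listSum (D.expand-at [ R , S ]′ (inj₁ a) entries) entries
      ≡⟨ listSum-entries _ ⟩
    sum (λ i → sum (λ c → χ (A i c) * D.expand-at [ R , S ]′ (inj₁ a) entries (inj₁ i , inj₂ c)))
      ≡⟨ (sum-cong-≗ λ i → trans (sum-cong-≗ λ c → factor i c) (sym (*-distribˡ-sum (χ (a == i)) (row i)))) ⟩
    sum (λ i → χ (a == i) * sum (row i))
      ≡⟨ sum-δ a (sum ∘ row) ⟩
    sum (row a)
      ≡⟨ (sum-cong-≗ λ c → cong (λ r → χ (A a c) * (χ r * χ (S c)) * perm (R ⊖ a) (S ⊖ c)) Ra) ⟩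
    sum (λ c → χ (A a c) * (1 * χ (S c)) * perm (R ⊖ a) (S ⊖ c))
      ≡⟨ (sum-cong-≗ λ c → cong (λ r → χ (A a c) * r * perm (R ⊖ a) (S ⊖ c)) (+-identityʳ (χ (S c)))) ⟩
    sum (λ c → χ (A a c) * χ (S c) * perm (R ⊖ a) (S ⊖ c)) ∎
    where
    open ≡-Reasoning
    row : Fin N → Fin N → ℕ
    row i c = χ (A i c) * (χ (R i) * χ (S c)) * perm (R ⊖ i) (S ⊖ c)
    factor : ∀ i c → χ (A i c) * D.expand-at [ R , S ]′ (inj₁ a) entries (inj₁ i , inj₂ c) ≡ χ (a == i) * row i c
    factor i c rewrite delete R S i c | Bool.∨-identityʳ (a == i) =
      identity (χ (A i c)) (χ (a == i)) (χ (R i)) (χ (S c)) _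
      where
      identity : ∀ x d r c p → x * (d * (r * c) * p) ≡ d * (x * (r * c) * p)
      identity = solve-∀

  perm-col : ∀ R S b → S b ≡ true →
    perm R S ≡ sum (λ i → χ (A i b) * χ (R i) * perm (R ⊖ i) (S ⊖ b))
  perm-col R S b Sb = begin
    perm R S
      ≡⟨ D.pm-expand entries [ R , S ]′ (inj₂ b) Sb ⟩
    listSum (D.expand-at [ R , S ]′ (inj₂ b) entries) entries
      ≡⟨ listSum-entries _ ⟩
    sum (λ i → sum (λ c → χ (A i c) * D.expand-at [ R , S ]′ (inj₂ b) entries (inj₁ i , inj₂ c)))
      ≡⟨ (sum-cong-≗ λ i → trans (sum-cong-≗ λ c → factor i c) (sum-δ b (row i))) ⟩
    sum (λ i → row i b)
      ≡⟨ (sum-cong-≗ λ i → cong (λ r → χ (A i b) * (χ (R i) * χ r) * perm (R ⊖ i) (S ⊖ b)) Sb) ⟩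
    sum (λ i → χ (A i b) * (χ (R i) * 1) * perm (R ⊖ i) (S ⊖ b))
      ≡⟨ (sum-cong-≗ λ i → cong (λ r → χ (A i b) * r * perm (R ⊖ i) (S ⊖ b)) (*-identityʳ (χ (R i)))) ⟩
    sum (λ i → χ (A i b) * χ (R i) * perm (R ⊖ i) (S ⊖ b)) ∎
    where
    open ≡-Reasoning
    row : Fin N → Fin N → ℕ
    row i c = χ (A i c) * (χ (R i) * χ (S c)) * perm (R ⊖ i) (S ⊖ c)
    factor : ∀ i c → χ (A i c) * D.expand-at [ R , S ]′ (inj₂ b) entries (inj₁ i , inj₂ c) ≡ χ (b == c) * row i c
    factor i c rewrite delete R S i c =
      identity (χ (A i c)) (χ (b == c)) (χ (R i)) (χ (S c)) _
      where
      identity : ∀ x d r c p → x * (d * (r * c) * p) ≡ d * (x * (r * c) * p)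
      identity = solve-∀

-- The hafnian and the inequality haf² ≤ perm

adj : ∀ {N} → Graph (Fin N) → Fin N → Fin N → Bool
adj G u v = does (adj? G u v)

adj⇒Adj : ∀ {N} (G : Graph (Fin N)) {u v} → adj G u v ≡ true → Adj G u v
adj⇒Adj G {u} {v} eq with adj? G u v
... | yes e = e

Adj⇒adj : ∀ {N} (G : Graph (Fin N)) {u v} → Adj G u v → adj G u v ≡ true
Adj⇒adj G {u} {v} e = dec-true (adj? G u v) e

adj-sym : ∀ {N} (G : Graph (Fin N)) u v → adj G u v ≡ adj G v u
adj-sym G u v = does-⇔ (mk⇔ (symm G) (symm G)) (adj? G u v) (adj? G v u)

adj-irrefl : ∀ {N} (G : Graph (Fin N)) v → adj G v v ≡ false
adj-irrefl G v = dec-false (adj? G v v) (irrefl G)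

lt : ∀ {N} → Fin N → Fin N → Bool
lt i j = does (i Fin.<? j)

lt-trichotomy : ∀ {N} {a b : Fin N} → a ≢ b → χ (lt a b) + χ (lt b a) ≡ 1
lt-trichotomy {a = a} {b} a≢b with Fin.<-cmp a b
... | tri< a<b _ b≮a rewrite dec-true (a Fin.<? b) a<b | dec-false (b Fin.<? a) b≮a = refl
... | tri≈ _ a≡b _   = contradiction a≡b a≢b
... | tri> a≮b _ b<a rewrite dec-false (a Fin.<? b) a≮b | dec-true (b Fin.<? a) b<a = refl

listSum-edges : ∀ {N} (G : Graph (Fin N)) (f : Edge N → ℕ) →
  listSum f (edges G) ≡ sum (λ i → sum (λ j → χ (lt i j) * (χ (adj G i j) * f (i , j))))
listSum-edges {N} G f =
  trans (listSum-filter (λ (i , j) → adj? G i j) f (pairs N))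
  (trans (listSum-filter (λ (i , j) → i Fin.<? j) (λ (i , j) → χ (adj G i j) * f (i , j)) (cartesianProduct (allFin N) (allFin N)))
    (listSum-pairs (λ (i , j) → χ (lt i j) * (χ (adj G i j) * f (i , j)))))

module Hafnian {N : ℕ} (G : Graph (Fin N)) where

  haf : (Fin N → Bool) → ℕ
  haf = pm (edges G)

  haf-cong : ∀ {S T} → (∀ v → S v ≡ T v) → haf S ≡ haf T
  haf-cong = pm-cong (edges G)

  haf-∅ : ∀ {S} → (∀ v → S v ≡ false) → haf S ≡ 1
  haf-∅ S∅ = trans (pm-∅ (edges G) S∅) (none-∅ S∅)

  -- An edge at `a` is listed as (a , b) or as (b , a), depending on the order of its ends. The sums
  -- over `up a b` and over `up b a` cover the two cases, and trichotomy makes each neighbour count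
  -- once.
  haf-expand : ∀ S a → S a ≡ true → haf S ≡ sum (λ b → χ (adj G a b) * χ (S b) * haf (S ⊖ a ⊖ b))
  haf-expand S a Sa = begin
    haf S
      ≡⟨ pm-expand (edges G) S a Sa ⟩
    listSum (expand-at S a (edges G)) (edges G)
      ≡⟨ listSum-edges G (expand-at S a (edges G)) ⟩
    sum (λ i → sum (λ j → χ (lt i j) * (χ (adj G i j) * expand-at S a (edges G) (i , j))))
      ≡⟨ (sum-cong-≗ λ i → trans (sum-cong-≗ λ j → split i j) (∑-distrib-+ (λ j → χ (a == i) * up i j) (λ j → χ (a == j) * up i j))) ⟩
    sum (λ i → sum (λ j → χ (a == i) * up i j) + sum (λ j → χ (a == j) * up i j))
      ≡⟨ (sum-cong-≗ λ i → cong₂ _+_ (sym (*-distribˡ-sum (χ (a == i)) (up i))) (sum-δ a (up i))) ⟩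
    sum (λ i → χ (a == i) * sum (up i) + up i a)
      ≡⟨ ∑-distrib-+ (λ i → χ (a == i) * sum (up i)) (λ i → up i a) ⟩
    sum (λ i → χ (a == i) * sum (up i)) + sum (λ i → up i a)
      ≡⟨ cong (_+ sum (λ i → up i a)) (sum-δ a (sum ∘ up)) ⟩
    sum (up a) + sum (λ b → up b a)
      ≡⟨ ∑-distrib-+ (up a) (λ b → up b a) ⟨
    sum (λ b → up a b + up b a)
      ≡⟨ sum-cong-≗ merge ⟩
    sum (λ b → χ (adj G a b) * χ (S b) * haf (S ⊖ a ⊖ b)) ∎
    where
    open ≡-Reasoning
    F : Fin N → Fin N → ℕ
    F i j = χ (S i) * χ (S j) * haf (S ⊖ i ⊖ j)
    up : Fin N → Fin N → ℕ
    up i j = χ (lt i j) * (χ (adj G i j) * F i j)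
    F-sym : ∀ i j → F i j ≡ F j i
    F-sym i j = cong₂ _*_ (*-comm (χ (S i)) (χ (S j))) (haf-cong (⊖-comm S i j))
    split : ∀ i j → χ (lt i j) * (χ (adj G i j) * expand-at S a (edges G) (i , j)) ≡ χ (a == i) * up i j + χ (a == j) * up i j
    split i j with Fin.toℕ i <ᵇ Fin.toℕ j in i<ᵇj
    ... | false = sym (cong₂ _+_ (*-zeroʳ (χ (a == i))) (*-zeroʳ (χ (a == j))))
    ... | true with a Fin.≟ i | a Fin.≟ j
    ...   | yes refl | yes refl = contradiction (<ᵇ⇒< (Fin.toℕ i) _ (subst T (sym i<ᵇj) tt)) (<-irrefl refl)
    ...   | yes _    | no _     = identity (χ (adj G i j)) (χ (S i) * χ (S j)) _
      where
      identity : ∀ x y z → 1 * (x * (1 * y * z)) ≡ 1 * (1 * (x * (y * z))) + 0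
      identity = solve-∀
    ...   | no _     | yes _    = identity (χ (adj G i j)) (χ (S i) * χ (S j)) _
      where
      identity : ∀ x y z → 1 * (x * (1 * y * z)) ≡ 1 * (1 * (x * (y * z)))
      identity = solve-∀
    ...   | no _     | no _     = cong (1 *_) (*-zeroʳ (χ (adj G i j)))
    merge : ∀ b → up a b + up b a ≡ χ (adj G a b) * χ (S b) * haf (S ⊖ a ⊖ b)
    merge b rewrite adj-sym G b a | F-sym b a with adj G a b in ab
    ... | false = cong₂ _+_ (*-zeroʳ (χ (lt a b))) (*-zeroʳ (χ (lt b a)))
    ... | true  rewrite Sa = trans (identity (χ (lt a b)) (χ (lt b a)) (χ (S b)) (haf (S ⊖ a ⊖ b)))
      (trans (cong (_* (1 * χ (S b) * haf (S ⊖ a ⊖ b))) (lt-trichotomy {a = a} {b} a≢b)) (+-identityʳ _))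
      where
      a≢b : a ≢ b
      a≢b refl = contradiction (trans (sym ab) (adj-irrefl G a)) λ ()
      identity : ∀ x y s h → x * (1 * (1 * s * h)) + y * (1 * (1 * s * h)) ≡ (x + y) * (1 * s * h)
      identity = solve-∀

  open Permanent (adj G)

  adj⇒≢ : ∀ {b c} → adj G b c ≡ true → c ≢ b
  adj⇒≢ {b} bc refl = contradiction (trans (sym bc) (adj-irrefl G b)) λ ()

  -- The three inequalities are expanded at the same vertex, in haf and as a row of perm, and
  -- are reduced to one another on a smaller set.
  haf²≤perm : ∀ k S → count S ≤ k → haf S * haf S ≤ perm S S
  haf-⊖⊖*haf≤perm : ∀ k S a b → count S ≤ k → S a ≡ true → S b ≡ true → b ≢ a →
    haf (S ⊖ a ⊖ b) * haf S ≤ perm (S ⊖ a) (S ⊖ b)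
  haf-⊖*haf-⊖≤perm : ∀ k S a b → count S ≤ k → S a ≡ true → S b ≡ true → b ≢ a →
    haf (S ⊖ a) * haf (S ⊖ b) ≤ perm (S ⊖ a) (S ⊖ b)

  haf²≤perm k S S≤k with ∅⊎∋ S
  ... | inj₁ S∅ = ≤-reflexive (trans (cong (λ x → x * x) (haf-∅ S∅)) (sym (perm-∅ S∅ S∅)))
  ... | inj₂ (a , Sa) = begin
    haf S * haf S
      ≡⟨ cong (_* haf S) (haf-expand S a Sa) ⟩
    sum (λ b → χ (adj G a b) * χ (S b) * haf (S ⊖ a ⊖ b)) * haf S
      ≡⟨ *-distribʳ-sum (haf S) (λ b → χ (adj G a b) * χ (S b) * haf (S ⊖ a ⊖ b)) ⟩
    sum (λ b → χ (adj G a b) * χ (S b) * haf (S ⊖ a ⊖ b) * haf S)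
      ≤⟨ sum-≤ term ⟩
    sum (λ b → χ (adj G a b) * χ (S b) * perm (S ⊖ a) (S ⊖ b))
      ≡⟨ perm-row S S a Sa ⟨
    perm S S ∎
    where
    open ≤-Reasoning
    term : ∀ b → χ (adj G a b) * χ (S b) * haf (S ⊖ a ⊖ b) * haf S ≤ χ (adj G a b) * χ (S b) * perm (S ⊖ a) (S ⊖ b)
    term b with adj G a b in ab | S b in Sb
    ... | false | _     = z≤n
    ... | true  | false = z≤n
    ... | true  | true  = ≤-trans (≤-reflexive (cong (_* haf S) (+-identityʳ (haf (S ⊖ a ⊖ b)))))
      (≤-trans (haf-⊖⊖*haf≤perm k S a b S≤k Sa Sb (adj⇒≢ ab)) (≤-reflexive (sym (+-identityʳ _))))

  haf-⊖⊖*haf≤perm zero S a b S≤0 Sa _ _ = contradiction (trans (sym Sa) (count≡0⇒∅ S (n≤0⇒n≡0 S≤0) a)) λ ()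
  haf-⊖⊖*haf≤perm (suc k) S a b S≤k Sa Sb b≢a = begin
    haf (S ⊖ a ⊖ b) * haf S
      ≡⟨ cong (haf (S ⊖ a ⊖ b) *_) (haf-expand S b Sb) ⟩
    haf (S ⊖ a ⊖ b) * sum (λ c → χ (adj G b c) * χ (S c) * haf (S ⊖ b ⊖ c))
      ≡⟨ *-distribˡ-sum (haf (S ⊖ a ⊖ b)) (λ c → χ (adj G b c) * χ (S c) * haf (S ⊖ b ⊖ c)) ⟩
    sum (λ c → haf (S ⊖ a ⊖ b) * (χ (adj G b c) * χ (S c) * haf (S ⊖ b ⊖ c)))
      ≤⟨ sum-≤ term ⟩
    sum (λ c → χ (adj G b c) * χ ((S ⊖ b) c) * perm (S ⊖ a ⊖ b) (S ⊖ b ⊖ c))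
      ≡⟨ perm-row (S ⊖ a) (S ⊖ b) b (⊖-true S a Sb b≢a) ⟨
    perm (S ⊖ a) (S ⊖ b) ∎
    where
    open ≤-Reasoning
    U≤k : count (S ⊖ b) ≤ k
    U≤k = s≤s⁻¹ (subst (_≤ suc k) (sym (count-⊖ S b Sb)) S≤k)
    Ua : (S ⊖ b) a ≡ true
    Ua = ⊖-true S b Sa (b≢a ∘ sym)
    core : ∀ c → adj G b c ≡ true → S c ≡ true → haf (S ⊖ a ⊖ b) * haf (S ⊖ b ⊖ c) ≤ perm (S ⊖ a ⊖ b) (S ⊖ b ⊖ c)
    core c bc Sc rewrite haf-cong (⊖-comm S a b) | perm-cong {S = S ⊖ b ⊖ c} (⊖-comm S a b) (λ _ → refl) with c Fin.≟ a
    -- Only b has left the columns, so c = a is possible. The path from b then reaches its end a,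
    -- and both hafnians belong to the same set.
    ... | yes refl = haf²≤perm k (S ⊖ b ⊖ a) (≤-trans (n≤1+n _) (subst (_≤ k) (sym (count-⊖ (S ⊖ b) a Ua)) U≤k))
    ... | no c≢a   = haf-⊖*haf-⊖≤perm k (S ⊖ b) a c U≤k Ua (⊖-true S b Sc (adj⇒≢ bc)) c≢a
    term : ∀ c → haf (S ⊖ a ⊖ b) * (χ (adj G b c) * χ (S c) * haf (S ⊖ b ⊖ c)) ≤ χ (adj G b c) * χ ((S ⊖ b) c) * perm (S ⊖ a ⊖ b) (S ⊖ b ⊖ c)
    term c with adj G b c in bc
    ... | false = ≤-reflexive (*-zeroʳ (haf (S ⊖ a ⊖ b)))
    ... | true  with S c in Sc
    ...   | false = ≤-reflexive (*-zeroʳ (haf (S ⊖ a ⊖ b)))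
    ...   | true  rewrite ≢⇒== (adj⇒≢ bc) | +-identityʳ (haf (S ⊖ b ⊖ c)) | +-identityʳ (perm (S ⊖ a ⊖ b) (S ⊖ b ⊖ c)) = core c bc Sc

  haf-⊖*haf-⊖≤perm zero S a b S≤0 Sa _ _ = contradiction (trans (sym Sa) (count≡0⇒∅ S (n≤0⇒n≡0 S≤0) a)) λ ()
  haf-⊖*haf-⊖≤perm (suc k) S a b S≤k Sa Sb b≢a = begin
    haf (S ⊖ a) * haf (S ⊖ b)
      ≡⟨ cong (_* haf (S ⊖ b)) (haf-expand (S ⊖ a) b (⊖-true S a Sb b≢a)) ⟩
    sum (λ d → χ (adj G b d) * χ ((S ⊖ a) d) * haf (S ⊖ a ⊖ b ⊖ d)) * haf (S ⊖ b)
      ≡⟨ *-distribʳ-sum (haf (S ⊖ b)) (λ d → χ (adj G b d) * χ ((S ⊖ a) d) * haf (S ⊖ a ⊖ b ⊖ d)) ⟩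
    sum (λ d → χ (adj G b d) * χ ((S ⊖ a) d) * haf (S ⊖ a ⊖ b ⊖ d) * haf (S ⊖ b))
      -- The permanent may still use column a, which the hafnian of `S ⊖ a` cannot; its term is
      -- dropped here.
      ≤⟨ sum-≤ term ⟩
    sum (λ d → χ (adj G b d) * χ ((S ⊖ b) d) * perm (S ⊖ a ⊖ b) (S ⊖ b ⊖ d))
      ≡⟨ perm-row (S ⊖ a) (S ⊖ b) b (⊖-true S a Sb b≢a) ⟨
    perm (S ⊖ a) (S ⊖ b) ∎
    where
    open ≤-Reasoning
    U≤k : count (S ⊖ b) ≤ k
    U≤k = s≤s⁻¹ (subst (_≤ suc k) (sym (count-⊖ S b Sb)) S≤k)
    Ua : (S ⊖ b) a ≡ true
    Ua = ⊖-true S b Sa (b≢a ∘ sym)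
    core : ∀ d → adj G b d ≡ true → (S ⊖ a) d ≡ true → haf (S ⊖ a ⊖ b ⊖ d) * haf (S ⊖ b) ≤ perm (S ⊖ a ⊖ b) (S ⊖ b ⊖ d)
    core d bd Sd rewrite haf-cong (⊖-cong (⊖-comm S a b) d) | perm-cong {S = S ⊖ b ⊖ d} (⊖-comm S a b) (λ _ → refl) =
      haf-⊖⊖*haf≤perm k (S ⊖ b) a d U≤k Ua (⊖-true S b (proj₁ (⊖-true⁻ S a Sd)) (adj⇒≢ bd)) (proj₂ (⊖-true⁻ S a Sd))
    term : ∀ d → χ (adj G b d) * χ ((S ⊖ a) d) * haf (S ⊖ a ⊖ b ⊖ d) * haf (S ⊖ b) ≤ χ (adj G b d) * χ ((S ⊖ b) d) * perm (S ⊖ a ⊖ b) (S ⊖ b ⊖ d)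
    term d with adj G b d in bd
    ... | false = z≤n
    ... | true  with (S ⊖ a) d in Sd
    ...   | false = z≤n
    ...   | true  rewrite ⊖-true S b (proj₁ (⊖-true⁻ S a Sd)) (adj⇒≢ bd)
            | +-identityʳ (haf (S ⊖ a ⊖ b ⊖ d)) | +-identityʳ (perm (S ⊖ a ⊖ b) (S ⊖ b ⊖ d)) = core d bd Sd

-- Perfect matchings, degrees and the handshake lemma

Covers : ∀ {N} → (Fin N → Bool) → List (Edge N) → Set
Covers S M = ∀ v → length (filter (incident? v) M) ≡ χ (S v)

covers? : ∀ {N} (S : Fin N → Bool) M → Dec (Covers S M)
covers? S M = Fin.all? λ v → length (filter (incident? v) M) ≟ χ (S v)

coversᵇ : ∀ {N} → (Fin N → Bool) → List (Edge N) → Bool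
coversᵇ S M = does (covers? S M)

length-filter-∷ : ∀ {N} (v : Fin N) e M →
  length (filter (incident? v) (e ∷ M)) ≡ χ (incident v e) + length (filter (incident? v) M)
length-filter-∷ v (i , j) M with v Fin.≟ i | v Fin.≟ j
... | yes _ | _     = refl
... | no _  | yes _ = refl
... | no _  | no _  = refl

χ-⊖ᴱ : ∀ {N} (S : Fin N → Bool) i j → S i ≡ true → S j ≡ true → ∀ v →
  χ (S v) ≡ χ (incident v (i , j)) + χ ((S ⊖ᴱ (i , j)) v)
χ-⊖ᴱ S i j Si Sj v with v Fin.≟ i | v Fin.≟ j
... | yes refl | yes refl rewrite Si = refl
... | yes refl | no _     rewrite Si = refl
... | no _     | yes refl rewrite Sj = refl
... | no _     | no _     rewrite Bool.∧-identityʳ (S v) | Bool.∧-identityʳ (S v) = refl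

¬covers : ∀ {N} (S : Fin N → Bool) v e M → incident v e ≡ true → S v ≡ false → coversᵇ S (e ∷ M) ≡ false
¬covers S v e M v∈e Sv = dec-false (covers? S (e ∷ M)) λ cov →
  contradiction (trans (sym (cov v)) (trans (length-filter-∷ v e M) (cong (λ b → χ b + length (filter (incident? v) M)) v∈e)))
    (subst (λ b → χ b ≢ suc (length (filter (incident? v) M))) (sym Sv) λ ())

covers-∷ : ∀ {N} (S : Fin N → Bool) e M → χ (coversᵇ S (e ∷ M)) ≡ fit S e * χ (coversᵇ (S ⊖ᴱ e) M)
covers-∷ S e@(i , j) M with S i in Si | S j in Sj
... | false | _     = cong χ (¬covers S i e M (cong (_∨ (i == j)) (==-refl i)) Si)
... | true  | false = cong χ (¬covers S j e M (trans (cong ((j == i) ∨_) (==-refl j)) (Bool.∨-zeroʳ (j == i))) Sj)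
... | true  | true  = trans
  (cong χ (does-⇔ (mk⇔ to from) (covers? S (e ∷ M)) (covers? (S ⊖ᴱ e) M))) (sym (+-identityʳ _))
  where
  to : Covers S (e ∷ M) → Covers (S ⊖ᴱ e) M
  to cov v = +-cancelˡ-≡ (χ (incident v e)) _ _
    (trans (sym (length-filter-∷ v e M)) (trans (cov v) (χ-⊖ᴱ S i j Si Sj v)))
  from : Covers (S ⊖ᴱ e) M → Covers S (e ∷ M)
  from cov v = trans (length-filter-∷ v e M) (trans (cong (χ (incident v e) +_) (cov v)) (sym (χ-⊖ᴱ S i j Si Sj v)))

-- `subsets` and `pm` branch alike on the first edge. The vertex set has to be arbitrary, because
-- using an edge replaces `S` by `S ⊖ᴱ e`.
coverings≡pm : ∀ {N} (E : List (Edge N)) S → listSum (χ ∘ coversᵇ S) (subsets E) ≡ pm E S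
coverings≡pm [] S with ∅⊎∋ S
... | inj₁ S∅       rewrite dec-true (covers? S []) (sym ∘ cong χ ∘ S∅) = sym (none-∅ S∅)
... | inj₂ (a , Sa) rewrite dec-false (covers? S []) (λ cov → contradiction (trans (cov a) (cong χ Sa)) λ ()) = sym (none-∋ {S = S} a Sa)
coverings≡pm (e ∷ E) S = begin
  listSum (χ ∘ coversᵇ S) (map (e ∷_) (subsets E) ++ subsets E)
    ≡⟨ listSum-++ (χ ∘ coversᵇ S) (map (e ∷_) (subsets E)) (subsets E) ⟩
  listSum (χ ∘ coversᵇ S) (map (e ∷_) (subsets E)) + listSum (χ ∘ coversᵇ S) (subsets E)
    ≡⟨ cong₂ _+_ (listSum-map (χ ∘ coversᵇ S) (e ∷_) (subsets E)) (coverings≡pm E S) ⟩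
  listSum (λ M → χ (coversᵇ S (e ∷ M))) (subsets E) + pm E S
    ≡⟨ cong (_+ pm E S) (listSum-cong (subsets E) (covers-∷ S e)) ⟩
  listSum (λ M → fit S e * χ (coversᵇ (S ⊖ᴱ e) M)) (subsets E) + pm E S
    ≡⟨ cong (_+ pm E S) (trans (listSum-* (fit S e) _ (subsets E)) (cong (fit S e *_) (coverings≡pm E (S ⊖ᴱ e)))) ⟩
  fit S e * pm E (S ⊖ᴱ e) + pm E S
    ≡⟨ +-comm _ (pm E S) ⟩
  pm E S + fit S e * pm E (S ⊖ᴱ e) ∎
  where open ≡-Reasoning

all : ∀ {N} → Fin N → Bool
all _ = true

length-filter : ∀ {A : Set} {P : A → Set} (P? : ∀ x → Dec (P x)) xs →
  length (filter P? xs) ≡ listSum (χ ∘ does ∘ P?) xs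
length-filter P? xs = trans (length≡listSum (filter P? xs))
  (trans (listSum-filter P? (λ _ → 1) xs) (listSum-cong xs (λ x → *-identityʳ _)))

perfmat≡haf : ∀ {N} (G : Graph (Fin N)) → perfmat G ≡ Hafnian.haf G all
-- `Perfect` is `Covers all` by computation, as `χ (all v)` reduces to 1.
perfmat≡haf G = trans (length-filter perfect? (subsets (edges G))) (coverings≡pm (edges G) all)

degIn : ∀ {N} → (Fin N → Fin N → Bool) → (Fin N → Bool) → Fin N → ℕ
degIn A S v = sum (λ u → χ (A v u) * χ (S u))

degIn-⊖ : ∀ {N} (A : Fin N → Fin N → Bool) S c → S c ≡ true → ∀ v → degIn A S v ≡ χ (A v c) + degIn A (S ⊖ c) v
degIn-⊖ A S c Sc v = trans (sum-cong-≗ split)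
  (trans (∑-distrib-+ (λ u → χ (c == u) * χ (A v u)) _) (cong (_+ degIn A (S ⊖ c) v) (sum-δ c (χ ∘ A v))))
  where
  split : ∀ u → χ (A v u) * χ (S u) ≡ χ (c == u) * χ (A v u) + χ (A v u) * χ ((S ⊖ c) u)
  split u rewrite ==-sym u c with c Fin.≟ u
  ... | yes refl rewrite Sc = identity (χ (A v u))
    where
    identity : ∀ x → x * 1 ≡ 1 * x + x * 0
    identity = solve-∀
  ... | no _     rewrite Bool.∧-identityʳ (S u) = refl

deg≡degIn : ∀ {N} (G : Graph (Fin N)) v → deg G v ≡ degIn (adj G) all v
deg≡degIn {N} G v = trans (length-filter (adj? G v) (allFin N))
  (trans (listSum-tabulate (χ ∘ adj G v) id) (sum-cong-≗ λ u → sym (*-identityʳ (χ (adj G v u)))))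

handshake : ∀ {N} (G : Graph (Fin N)) → sum (deg G) ≡ 2 * length (edges G)
handshake {N} G = begin
  sum (deg G)
    ≡⟨ (sum-cong-≗ λ i → trans (deg≡degIn G i) (sum-cong-≗ λ j → trans (*-identityʳ (χ (adj G i j))) (split i j))) ⟩
  sum (λ i → sum (λ j → up i j + up j i))
    ≡⟨ (sum-cong-≗ λ i → ∑-distrib-+ (up i) (λ j → up j i)) ⟩
  sum (λ i → sum (up i) + sum (λ j → up j i))
    ≡⟨ ∑-distrib-+ (λ i → sum (up i)) (λ i → sum (λ j → up j i)) ⟩
  sum (λ i → sum (up i)) + sum (λ i → sum (λ j → up j i))
    ≡⟨ cong (sum (λ i → sum (up i)) +_) (∑-comm (λ i j → up j i)) ⟩
  sum (λ i → sum (up i)) + sum (λ i → sum (up i))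
    ≡⟨ cong (sum (λ i → sum (up i)) +_) (+-identityʳ _) ⟨
  2 * sum (λ i → sum (up i))
    ≡⟨ cong (2 *_) (trans (length≡listSum (edges G)) (listSum-edges G (λ _ → 1))) ⟨
  2 * length (edges G) ∎
  where
  open ≡-Reasoning
  up : Fin N → Fin N → ℕ
  up i j = χ (lt i j) * (χ (adj G i j) * 1)
  split : ∀ i j → χ (adj G i j) ≡ up i j + up j i
  split i j rewrite adj-sym G j i with adj G i j in ij
  ... | false = sym (cong₂ _+_ (*-zeroʳ (χ (lt i j))) (*-zeroʳ (χ (lt j i))))
  ... | true  = sym (trans (identity (χ (lt i j)) (χ (lt j i))) (lt-trichotomy {a = i} {j} i≢j))
    where
    i≢j : i ≢ j
    i≢j refl = contradiction (trans (sym ij) (adj-irrefl G i)) λ ()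
    identity : ∀ x y → x * (1 * 1) + y * (1 * 1) ≡ x + y
    identity = solve-∀

-- Brègman's theorem, following Schrijver

-- w d stands for (d !) ^ (exponent / d), which is 0 for d = 0.
record Weight (bound : ℕ) : Set where
  field
    exponent   : ℕ
    exponent>0 : 0 < exponent
    w          : ℕ → ℕ
    w-zero     : w 0 ≡ 0
    w-^        : ∀ d → d ≤ bound → w d ^ d ≡ (d !) ^ exponent

if-≤ : ∀ b {x y : ℕ} → (b ≡ true → x ≤ y) → (if b then x else 1) ≤ (if b then y else 1)
if-≤ true  x≤y = x≤y refl
if-≤ false _   = ≤-refl

prod-if : ∀ {n} (e : Fin n → Bool) x → prod (λ i → if e i then x else 1) ≡ x ^ count e
prod-if {zero}  e x = refl
prod-if {suc n} e x with e zero
... | true  = cong (x *_) (prod-if (e ∘ suc) x)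
... | false = trans (+-identityʳ _) (prod-if (e ∘ suc) x)

degIn≤ : ∀ {N} (A : Fin N → Fin N → Bool) S v → degIn A S v ≤ N
degIn≤ {N} A S v = ≤-trans (sum-≤ λ u → *-mono-≤ (χ≤1 (A v u)) (χ≤1 (S u)))
  (≤-reflexive (trans (sum-const N 1) (*-identityʳ N)))

module Bregman {N : ℕ} (A : Fin N → Fin N → Bool) (weight : Weight N) where
  open Weight weight
  open Permanent A

  factor : (R S : Fin N → Bool) → Fin N → ℕ
  factor R S i = if R i then w (degIn A S i) else 1

  W : (R S : Fin N → Bool) → ℕ
  W R S = prod (factor R S)

  module Step (R S : Fin N → Bool) (0<p : 0 < perm R S)
    (ih : ∀ i c → R i ≡ true → S c ≡ true → perm (R ⊖ i) (S ⊖ c) ^ exponent ≤ W (R ⊖ i) (S ⊖ c)) where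

    p : ℕ
    p = perm R S

    d : Fin N → ℕ
    d = degIn A S

    -- The number of terms of `perm R S` through the entry (i , c). Each term meets every row of R
    -- and every column of S once, which gives the row and column sums below.
    q : Fin N → Fin N → ℕ
    q i c = χ (A i c) * (χ (R i) * χ (S c)) * perm (R ⊖ i) (S ⊖ c)

    row-sum : ∀ i → R i ≡ true → sum (q i) ≡ p
    row-sum i Ri = trans (sum-cong-≗ term) (sym (perm-row R S i Ri))
      where
      term : ∀ c → q i c ≡ χ (A i c) * χ (S c) * perm (R ⊖ i) (S ⊖ c)
      term c rewrite Ri | +-identityʳ (χ (S c)) = refl

    col-sum : ∀ c → sum (λ i → q i c) ≡ χ (S c) * p
    col-sum c with S c in Sc
    ... | true  = trans (sum-cong-≗ term) (trans (sym (perm-col R S c Sc)) (sym (+-identityʳ p)))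
      where
      term : ∀ i → χ (A i c) * (χ (R i) * 1) * perm (R ⊖ i) (S ⊖ c) ≡ χ (A i c) * χ (R i) * perm (R ⊖ i) (S ⊖ c)
      term i rewrite *-identityʳ (χ (R i)) = refl
    ... | false = trans (sum-cong-≗ term) (sum-zero N)
      where
      term : ∀ i → χ (A i c) * (χ (R i) * 0) * perm (R ⊖ i) (S ⊖ c) ≡ 0
      term i rewrite *-zeroʳ (χ (R i)) | *-zeroʳ (χ (A i c)) = refl

    edge : Fin N → Fin N → Bool
    edge i c = A i c ∧ S c

    count-edge : ∀ i → count (edge i) ≡ d i
    count-edge i = sum-cong-≗ λ c → χ-∧ (A i c) (S c)

    q-support : ∀ i c → edge i c ≡ false → q i c ≡ 0
    q-support i c eq = cong (_* perm (R ⊖ i) (S ⊖ c)) (trans (identity (χ (A i c)) (χ (R i)) (χ (S c)))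
      (trans (cong (_* χ (R i)) (sym (χ-∧ (A i c) (S c)))) (cong (λ b → χ b * χ (R i)) eq)))
      where
      identity : ∀ a r s → a * (r * s) ≡ a * s * r
      identity = solve-∀

    q-cases : ∀ i c → q i c ≡ 0 ⊎ (A i c ≡ true × R i ≡ true × S c ≡ true × q i c ≡ perm (R ⊖ i) (S ⊖ c))
    q-cases i c with A i c | R i | S c
    ... | false | _     | _     = inj₁ refl
    ... | true  | false | _     = inj₁ refl
    ... | true  | true  | false = inj₁ refl
    ... | true  | true  | true  = inj₂ (refl , refl , refl , +-identityʳ _)

    -- For a row in R, `Y` bounds `X` by the log-sum inequality for the `q i c` of that row, and `Z`
    -- bounds `Y` by the induction hypothesis for its minors. Over all rows, `X` multiplies to a
    -- power of `p ^ exponent`, and `Z` to the power `p * count S` of `W R S`; a root of that order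
    -- gives the theorem.
    X Y Z : Fin N → ℕ
    X i = if R i then p ^ (p * exponent) else 1
    Y i = if R i then d i ^ (p * exponent) * prod (λ c → (q i c ^ q i c) ^ exponent) else 1
    Z i = if R i then d i ^ (p * exponent) * prod (λ c → W (R ⊖ i) (S ⊖ c) ^ q i c) else 1

    log-sum-row : ∀ i → R i ≡ true → p ^ p ≤ d i ^ p * prod (λ c → q i c ^ q i c)
    log-sum-row i Ri = subst₂ (λ s c → s ^ s ≤ c ^ s * prod (λ c → q i c ^ q i c)) (row-sum i Ri) (count-edge i)
      (log-sum (edge i) (q i) (q-support i))

    Y-≡ : ∀ i → (d i ^ p * prod (λ c → q i c ^ q i c)) ^ exponent
              ≡ d i ^ (p * exponent) * prod (λ c → (q i c ^ q i c) ^ exponent)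
    Y-≡ i = trans (^-distribʳ-* (d i ^ p) _ exponent)
      (cong₂ _*_ (^-*-assoc (d i) p exponent) (sym (prod-^ (λ c → q i c ^ q i c) exponent)))

    X≤Y : ∀ i → X i ≤ Y i
    X≤Y i = if-≤ (R i) λ Ri → subst₂ _≤_ (^-*-assoc p p exponent) (Y-≡ i) (^-monoˡ-≤ exponent (log-sum-row i Ri))

    q^q≤W^q : ∀ i c → (q i c ^ q i c) ^ exponent ≤ W (R ⊖ i) (S ⊖ c) ^ q i c
    q^q≤W^q i c with q-cases i c
    ... | inj₁ q≡0 rewrite q≡0 = ≤-reflexive (^-zeroˡ exponent)
    ... | inj₂ (_ , Ri , Sc , q≡perm) = ≤-trans (≤-reflexive (^-comm (q i c) (q i c) exponent))
      (^-monoˡ-≤ (q i c) (subst (λ x → x ^ exponent ≤ W (R ⊖ i) (S ⊖ c)) (sym q≡perm) (ih i c Ri Sc)))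

    Y≤Z : ∀ i → Y i ≤ Z i
    Y≤Z i = if-≤ (R i) λ _ → *-monoʳ-≤ (d i ^ (p * exponent)) (prod-≤ (q^q≤W^q i))

    prod-X : prod X ≡ (p ^ exponent) ^ (p * count R)
    prod-X = trans (prod-if R (p ^ (p * exponent)))
      (trans (^-*-assoc p (p * exponent) (count R))
        (trans (cong (p ^_) (identity p exponent (count R))) (sym (^-*-assoc p exponent (p * count R)))))
      where
      identity : ∀ p m k → p * m * k ≡ m * (p * k)
      identity = solve-∀

    module Column (j : Fin N) (Rj : R j ≡ true) where
      -- Row j after the deletion of row i and column c, weighted by `q i c`: `kept` if it survives
      -- with degree `d j`, `lost` if it survives with degree `d j` - 1. For i = j the row
      -- disappears and both are 0.
      kept lost : Fin N → Fin N → ℕ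
      kept i c = q i c * (χ (not (j == i)) * χ (not (A j c)))
      lost i c = q i c * (χ (not (j == i)) * χ (A j c))

      kept-+ : ∀ i c → kept i c + q i c * χ (A j c) ≡ q i c
      kept-+ i c with j Fin.≟ i
      ... | yes refl with A i c
      ...   | true  = identity (χ (R i) * χ (S c)) _
        where
        identity : ∀ x y → 1 * x * y * (0 * 0) + 1 * x * y * 1 ≡ 1 * x * y
        identity = solve-∀
      ...   | false = refl
      kept-+ i c | no _ with A j c
      ... | true  = cong₂ _+_ (*-zeroʳ (q i c)) (*-identityʳ (q i c))
      ... | false = trans (cong₂ _+_ (*-identityʳ (q i c)) (*-zeroʳ (q i c))) (+-identityʳ (q i c))

      lost-+ : ∀ i c → lost i c + χ (j == i) * q i c ≡ q i c * χ (A j c)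
      lost-+ i c with j Fin.≟ i
      ... | yes refl with A i c
      ...   | true  = identity (χ (R i) * χ (S c)) _
        where
        identity : ∀ x y → 1 * x * y * (0 * 1) + 1 * (1 * x * y) ≡ 1 * x * y * 1
        identity = solve-∀
      ...   | false = refl
      lost-+ i c | no _ = trans (+-identityʳ _) (cong (q i c *_) (+-identityʳ (χ (A j c))))

      -- Each of the `d j` columns of S in which row j has an entry is met exactly once by every one
      -- of the `p` terms. In each term row j itself occupies one of these columns; this explains
      -- the summand `p` in `lost-total`.
      adjacent-total : sum (λ i → sum (λ c → q i c * χ (A j c))) ≡ d j * p
      adjacent-total = begin
        sum (λ i → sum (λ c → q i c * χ (A j c)))
          ≡⟨ ∑-comm (λ i c → q i c * χ (A j c)) ⟩
        sum (λ c → sum (λ i → q i c * χ (A j c)))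
          ≡⟨ (sum-cong-≗ λ c → trans (sym (*-distribʳ-sum (χ (A j c)) (λ i → q i c))) (cong (_* χ (A j c)) (col-sum c))) ⟩
        sum (λ c → χ (S c) * p * χ (A j c))
          ≡⟨ (sum-cong-≗ λ c → identity (χ (S c)) p (χ (A j c))) ⟩
        sum (λ c → χ (A j c) * χ (S c) * p)
          ≡⟨ *-distribʳ-sum p (λ c → χ (A j c) * χ (S c)) ⟨
        d j * p ∎
        where
        open ≡-Reasoning
        identity : ∀ s p a → s * p * a ≡ a * s * p
        identity = solve-∀

      total : sum (λ i → sum (q i)) ≡ count S * p
      total = trans (∑-comm q) (trans (sum-cong-≗ col-sum) (sym (*-distribʳ-sum p (χ ∘ S))))

      kept-total : sum (λ i → sum (kept i)) + d j * p ≡ count S * p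
      kept-total = begin
        sum (λ i → sum (kept i)) + d j * p
          ≡⟨ cong (sum (λ i → sum (kept i)) +_) adjacent-total ⟨
        sum (λ i → sum (kept i)) + sum (λ i → sum (λ c → q i c * χ (A j c)))
          ≡⟨ ∑-distrib-+ (λ i → sum (kept i)) (λ i → sum (λ c → q i c * χ (A j c))) ⟨
        sum (λ i → sum (kept i) + sum (λ c → q i c * χ (A j c)))
          ≡⟨ (sum-cong-≗ λ i → trans (sym (∑-distrib-+ (kept i) (λ c → q i c * χ (A j c)))) (sum-cong-≗ (kept-+ i))) ⟩
        sum (λ i → sum (q i))
          ≡⟨ total ⟩
        count S * p ∎
        where open ≡-Reasoning

      lost-total : sum (λ i → sum (lost i)) + p ≡ d j * p
      lost-total = begin
        sum (λ i → sum (lost i)) + p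
          ≡⟨ cong (sum (λ i → sum (lost i)) +_) (trans (sum-δ j (sum ∘ q)) (row-sum j Rj)) ⟨
        sum (λ i → sum (lost i)) + sum (λ i → χ (j == i) * sum (q i))
          ≡⟨ ∑-distrib-+ (λ i → sum (lost i)) (λ i → χ (j == i) * sum (q i)) ⟨
        sum (λ i → sum (lost i) + χ (j == i) * sum (q i))
          ≡⟨ (sum-cong-≗ λ i → trans (cong (sum (lost i) +_) (*-distribˡ-sum (χ (j == i)) (q i)))
               (trans (sym (∑-distrib-+ (lost i) (λ c → χ (j == i) * q i c))) (sum-cong-≗ (lost-+ i)))) ⟩
        sum (λ i → sum (λ c → q i c * χ (A j c)))
          ≡⟨ adjacent-total ⟩
        d j * p ∎
        where open ≡-Reasoning

      factor-^ : ∀ i c → factor (R ⊖ i) (S ⊖ c) j ^ q i c ≡ w (d j) ^ kept i c * w (pred (d j)) ^ lost i c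
      factor-^ i c with q-cases i c
      ... | inj₁ q≡0 rewrite q≡0 = refl
      ... | inj₂ (_ , _ , Sc , _) rewrite Rj | degIn-⊖ A S c Sc j with j Fin.≟ i
      ...   | yes _ rewrite *-zeroʳ (q i c) = ^-zeroˡ (q i c)
      ...   | no _ with A j c
      ...     | true  rewrite *-zeroʳ (q i c) | *-identityʳ (q i c) = sym (+-identityʳ _)
      ...     | false rewrite *-zeroʳ (q i c) | *-identityʳ (q i c) = sym (*-identityʳ _)

      prod-factor-^ : prod (λ i → prod (λ c → factor (R ⊖ i) (S ⊖ c) j ^ q i c))
                    ≡ w (d j) ^ sum (λ i → sum (kept i)) * w (pred (d j)) ^ sum (λ i → sum (lost i))
      prod-factor-^ = begin
        prod (λ i → prod (λ c → factor (R ⊖ i) (S ⊖ c) j ^ q i c))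
          ≡⟨ (prod-cong λ i → trans (prod-cong (factor-^ i))
               (trans (prod-* (λ c → w (d j) ^ kept i c) (λ c → w (pred (d j)) ^ lost i c))
                 (cong₂ _*_ (^-sum (w (d j)) (kept i)) (^-sum (w (pred (d j))) (lost i))))) ⟩
        prod (λ i → w (d j) ^ sum (kept i) * w (pred (d j)) ^ sum (lost i))
          ≡⟨ prod-* (λ i → w (d j) ^ sum (kept i)) (λ i → w (pred (d j)) ^ sum (lost i)) ⟩
        prod (λ i → w (d j) ^ sum (kept i)) * prod (λ i → w (pred (d j)) ^ sum (lost i))
          ≡⟨ cong₂ _*_ (^-sum (w (d j)) (λ i → sum (kept i))) (^-sum (w (pred (d j))) (λ i → sum (lost i))) ⟩
        w (d j) ^ sum (λ i → sum (kept i)) * w (pred (d j)) ^ sum (λ i → sum (lost i)) ∎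
        where open ≡-Reasoning

      -- Here the factorials come in: b is (δ - 1) p, so w (δ - 1) ^ b is a power of (δ - 1) !, and
      -- the log-sum factor `δ ^ (p * exponent)` completes it to the same power of δ !, which is w δ
      -- ^ (δ p). Since a + δ p = p * count S, the exponents add up.
      combine : ∀ δ a b → δ ≤ N → b + p ≡ δ * p → a + δ * p ≡ count S * p →
        δ ^ (p * exponent) * (w δ ^ a * w (pred δ) ^ b) ≡ w δ ^ (p * count S)
      combine zero    a b _ b+p≡0 _ = contradiction (sym (m+n≡0⇒n≡0 b b+p≡0)) (<⇒≢ 0<p)
      combine (suc δ) a b δ<N b+p≡ a+≡ = begin
        suc δ ^ (p * exponent) * (w (suc δ) ^ a * w δ ^ b)
          ≡⟨ cong (λ x → suc δ ^ (p * exponent) * (w (suc δ) ^ a * x)) (trans (cong (w δ ^_) b≡) (trans (sym (^-*-assoc (w δ) δ p)) (trans (cong (_^ p) (w-^ δ (<⇒≤ δ<N))) (trans (^-*-assoc (δ !) exponent p) (cong ((δ !) ^_) (*-comm exponent p)))))) ⟩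
        suc δ ^ (p * exponent) * (w (suc δ) ^ a * (δ !) ^ (p * exponent))
          ≡⟨ identity (suc δ ^ (p * exponent)) (w (suc δ) ^ a) ((δ !) ^ (p * exponent)) ⟩
        w (suc δ) ^ a * (suc δ ^ (p * exponent) * (δ !) ^ (p * exponent))
          ≡⟨ cong (w (suc δ) ^ a *_) (^-distribʳ-* (suc δ) (δ !) (p * exponent)) ⟨
        w (suc δ) ^ a * (suc δ !) ^ (p * exponent)
          ≡⟨ cong (w (suc δ) ^ a *_) (trans (cong ((suc δ !) ^_) (*-comm p exponent)) (trans (sym (^-*-assoc (suc δ !) exponent p)) (trans (cong (_^ p) (sym (w-^ (suc δ) δ<N))) (^-*-assoc (w (suc δ)) (suc δ) p)))) ⟩
        w (suc δ) ^ a * w (suc δ) ^ (suc δ * p)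
          ≡⟨ ^-distribˡ-+-* (w (suc δ)) a (suc δ * p) ⟨
        w (suc δ) ^ (a + suc δ * p)
          ≡⟨ cong (w (suc δ) ^_) (trans a+≡ (*-comm (count S) p)) ⟩
        w (suc δ) ^ (p * count S) ∎
        where
        open ≡-Reasoning
        b≡ : b ≡ δ * p
        b≡ = +-cancelʳ-≡ p b (δ * p) (trans b+p≡ (+-comm p (δ * p)))
        identity : ∀ x y z → x * (y * z) ≡ y * (x * z)
        identity = solve-∀

    scale : Fin N → ℕ
    scale i = if R i then d i ^ (p * exponent) else 1

    Z-split : ∀ i → Z i ≡ scale i * prod (λ c → W (R ⊖ i) (S ⊖ c) ^ q i c)
    Z-split i with R i
    ... | true  = refl
    ... | false = sym (trans (+-identityʳ _) (trans (prod-cong term) (prod-one N)))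
      where
      term : ∀ c → W (R ⊖ i) (S ⊖ c) ^ (χ (A i c) * 0 * perm (R ⊖ i) (S ⊖ c)) ≡ 1
      term c rewrite *-zeroʳ (χ (A i c)) = refl

    column : ∀ j → scale j * prod (λ i → prod (λ c → factor (R ⊖ i) (S ⊖ c) j ^ q i c)) ≡ factor R S j ^ (p * count S)
    column j = helper (R j) refl
      where
      helper : ∀ b → R j ≡ b → scale j * prod (λ i → prod (λ c → factor (R ⊖ i) (S ⊖ c) j ^ q i c)) ≡ factor R S j ^ (p * count S)
      helper true Rj = begin
        scale j * prod (λ i → prod (λ c → factor (R ⊖ i) (S ⊖ c) j ^ q i c))
          ≡⟨ cong₂ _*_ (cong (λ b → if b then d j ^ (p * exponent) else 1) Rj) prod-factor-^ ⟩
        d j ^ (p * exponent) * (w (d j) ^ sum (λ i → sum (kept i)) * w (pred (d j)) ^ sum (λ i → sum (lost i)))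
          ≡⟨ combine (d j) _ _ (degIn≤ A S j) lost-total kept-total ⟩
        w (d j) ^ (p * count S)
          ≡⟨ cong (λ b → (if b then w (d j) else 1) ^ (p * count S)) Rj ⟨
        factor R S j ^ (p * count S) ∎
        where
        open ≡-Reasoning
        open Column j Rj
      helper false Rj = trans (cong₂ _*_ (cong (λ b → if b then d j ^ (p * exponent) else 1) Rj)
          (trans (prod-cong λ i → trans (prod-cong λ c → trans (cong (_^ q i c) (outside i c)) (^-zeroˡ (q i c))) (prod-one N)) (prod-one N)))
        (sym (trans (cong (λ b → (if b then w (d j) else 1) ^ (p * count S)) Rj) (^-zeroˡ (p * count S))))
        where
        outside : ∀ i c → factor (R ⊖ i) (S ⊖ c) j ≡ 1
        outside i c rewrite Rj = refl

    prod-Z : prod Z ≡ W R S ^ (p * count S)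
    prod-Z = begin
      prod Z
        ≡⟨ prod-cong Z-split ⟩
      prod (λ i → scale i * prod (λ c → W (R ⊖ i) (S ⊖ c) ^ q i c))
        ≡⟨ prod-* scale _ ⟩
      prod scale * prod (λ i → prod (λ c → W (R ⊖ i) (S ⊖ c) ^ q i c))
        -- The factors are regrouped by the surviving row j instead of the deleted entry (i , c).
        ≡⟨ cong (prod scale *_) (prod-cong λ i → trans (prod-cong λ c → sym (prod-^ (factor (R ⊖ i) (S ⊖ c)) (q i c)))
             (Prod.∑-comm (λ c j → factor (R ⊖ i) (S ⊖ c) j ^ q i c))) ⟩
      prod scale * prod (λ i → prod (λ j → prod (λ c → factor (R ⊖ i) (S ⊖ c) j ^ q i c)))
        ≡⟨ cong (prod scale *_) (Prod.∑-comm (λ i j → prod (λ c → factor (R ⊖ i) (S ⊖ c) j ^ q i c))) ⟩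
      prod scale * prod (λ j → prod (λ i → prod (λ c → factor (R ⊖ i) (S ⊖ c) j ^ q i c)))
        ≡⟨ prod-* scale _ ⟨
      prod (λ j → scale j * prod (λ i → prod (λ c → factor (R ⊖ i) (S ⊖ c) j ^ q i c)))
        ≡⟨ prod-cong column ⟩
      prod (λ j → factor R S j ^ (p * count S))
        ≡⟨ prod-^ (factor R S) (p * count S) ⟩
      W R S ^ (p * count S) ∎
      where open ≡-Reasoning

    module Balanced (R≡S : count R ≡ count S) where

      prod-X′ : prod X ≡ (p ^ exponent) ^ (p * count S)
      prod-X′ = trans prod-X (cong (λ k → (p ^ exponent) ^ (p * k)) R≡S)

      bound : 0 < count S → p ^ exponent ≤ W R S
      bound 0<k = ^-cancelʳ-≤ (p * count S) (*->0 0<p 0<k)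
        (subst₂ _≤_ prod-X′ prod-Z (prod-≤ λ i → ≤-trans (X≤Y i) (Y≤Z i)))

      module Tight (tight : p ^ exponent ≡ W R S) (i : Fin N) (Ri : R i ≡ true) where

        X>0 : 0 < prod X
        X>0 = subst (0 <_) (sym prod-X′) (^->0 (p * count S) (^->0 exponent 0<p))

        X≡Z : X i ≡ Z i
        X≡Z = prod-squeeze (λ i → ≤-trans (X≤Y i) (Y≤Z i)) (subst (0 <_) eq X>0) eq i
          where
          eq : prod X ≡ prod Z
          eq = trans prod-X′ (trans (cong (_^ (p * count S)) tight) (sym prod-Z))

        X≡Y : X i ≡ Y i
        X≡Y = ≤-antisym (X≤Y i) (≤-trans (Y≤Z i) (≤-reflexive (sym X≡Z)))

        if-true : ∀ {x y : ℕ} → (if R i then x else 1) ≡ (if R i then y else 1) → x ≡ y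
        if-true rewrite Ri = id

        log-sum-tight : p ^ p ≡ d i ^ p * prod (λ c → q i c ^ q i c)
        log-sum-tight = ^-cancelʳ-≡ exponent exponent>0
          (trans (^-*-assoc p p exponent) (trans (if-true X≡Y) (sym (Y-≡ i))))

        q-uniform : ∀ c → edge i c ≡ true → d i * q i c ≡ p
        q-uniform c ic = subst₂ (λ k s → k * q i c ≡ s) (count-edge i) (row-sum i Ri)
          (log-sum-≡ (edge i) (q i) (q-support i)
            (subst₂ (λ s k → s ^ s ≡ k ^ s * prod (λ c → q i c ^ q i c)) (sym (row-sum i Ri)) (sym (count-edge i)) log-sum-tight) c ic)

        -- The second link of the chain, the induction hypothesis for the minors, is tight as well.
        -- Where `q i c` is 0 this reads 1 = 1 and carries no information.
        q^q≡W^q : ∀ c → (q i c ^ q i c) ^ exponent ≡ W (R ⊖ i) (S ⊖ c) ^ q i c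
        q^q≡W^q = prod-squeeze (q^q≤W^q i) (m*n>0⇒n>0 (d i ^ (p * exponent)) (subst (0 <_) pX≡Z pX>0))
          (*-cancelˡ-≡′ (d i ^ (p * exponent)) (m*n>0⇒m>0 _ (subst (0 <_) pX≡Z pX>0))
            (trans (sym (if-true X≡Y)) pX≡Z))
          where
          pX>0 : 0 < p ^ (p * exponent)
          pX>0 = ^->0 (p * exponent) 0<p
          pX≡Z : p ^ (p * exponent) ≡ d i ^ (p * exponent) * prod (λ c → W (R ⊖ i) (S ⊖ c) ^ q i c)
          pX≡Z = if-true X≡Z

        tight-edge : ∀ c → S c ≡ true → A i c ≡ true →
          d i * perm (R ⊖ i) (S ⊖ c) ≡ p × perm (R ⊖ i) (S ⊖ c) ^ exponent ≡ W (R ⊖ i) (S ⊖ c)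
        -- `d i * π` is `p`, so π is positive and can be cancelled as an exponent.
        tight-edge c Sc ic = uniform , ^-cancelʳ-≡ π π>0
          (trans (^-comm π exponent π) (subst (λ x → (x ^ x) ^ exponent ≡ W (R ⊖ i) (S ⊖ c) ^ x) q≡ (q^q≡W^q c)))
          where
          π : ℕ
          π = perm (R ⊖ i) (S ⊖ c)
          q≡ : q i c ≡ π
          q≡ rewrite ic | Ri | Sc = +-identityʳ π
          uniform : d i * π ≡ p
          uniform = subst (λ x → d i * x ≡ p) q≡ (q-uniform c (cong₂ _∧_ ic Sc))
          π>0 : 0 < π
          π>0 = m*n>0⇒n>0 (d i) (subst (0 <_) (sym uniform) 0<p)

  bregman : ∀ k R S → count R ≡ k → count S ≡ k → perm R S ^ exponent ≤ W R S
  bregman zero    R S R≡0 S≡0 = ≤-reflexive (trans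
    (trans (cong (_^ exponent) (perm-∅ (count≡0⇒∅ R R≡0) (count≡0⇒∅ S S≡0))) (^-zeroˡ exponent))
    (sym (trans (prod-cong λ i → cong (λ b → if b then w (degIn A S i) else 1) (count≡0⇒∅ R R≡0 i)) (prod-one N))))
  bregman (suc k) R S R≡ S≡ with ≡0⊎>0 (perm R S)
  -- A zero permanent needs its own case, because the step takes a root whose order is a multiple of
  -- the permanent.
  ... | inj₁ p≡0 = ≤-trans (≤-reflexive (trans (cong (_^ exponent) p≡0) (0^>0 exponent>0))) z≤n
  ... | inj₂ 0<p = Step.Balanced.bound R S 0<p
    (λ i c Ri Sc → bregman k (R ⊖ i) (S ⊖ c) (suc-injective (trans (count-⊖ R i Ri) R≡)) (suc-injective (trans (count-⊖ S c Sc) S≡)))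
    (trans R≡ (sym S≡)) (subst (0 <_) (sym S≡) z<s)

  -- The equality case

  count-⊖-≡ : ∀ (R S : Fin N → Bool) {i c} → count R ≡ count S → R i ≡ true → S c ≡ true → count (R ⊖ i) ≡ count (S ⊖ c)
  count-⊖-≡ R S {i} {c} eq Ri Sc = suc-injective (trans (count-⊖ R i Ri) (trans eq (sym (count-⊖ S c Sc))))

  bregman-tight : ∀ R S → count R ≡ count S → 0 < perm R S → perm R S ^ exponent ≡ W R S →
    ∀ i c → R i ≡ true → S c ≡ true → A i c ≡ true →
    degIn A S i * perm (R ⊖ i) (S ⊖ c) ≡ perm R S × perm (R ⊖ i) (S ⊖ c) ^ exponent ≡ W (R ⊖ i) (S ⊖ c)
  bregman-tight R S R≡S 0<p tight i c Ri Sc ic = Step.Balanced.Tight.tight-edge R S 0<p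
    (λ i c Ri Sc → bregman _ (R ⊖ i) (S ⊖ c) (count-⊖-≡ R S R≡S Ri Sc) refl)
    R≡S tight i Ri c Sc ic

  module TightSquare (0<p : 0 < perm all all) (tight : perm all all ^ exponent ≡ W all all) where

    private
      d : Fin N → ℕ
      d = degIn A all
      p : ℕ
      p = perm all all

    edge-uniform : ∀ i c → A i c ≡ true → d i * perm (all ⊖ i) (all ⊖ c) ≡ p
    edge-uniform i c ic = proj₁ (bregman-tight all all refl 0<p tight i c refl refl ic)

    perm₂ : Fin N → Fin N → Fin N → Fin N → ℕ
    perm₂ i c j c′ = perm (all ⊖ i ⊖ j) (all ⊖ c ⊖ c′)

    two-edges-uniform : ∀ i c j c′ → A i c ≡ true → A j c′ ≡ true → j ≢ i → c′ ≢ c →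
      d i * (degIn A (all ⊖ c) j * perm₂ i c j c′) ≡ p
    two-edges-uniform i c j c′ ic jc′ j≢i c′≢c = trans
      (cong (d i *_) (proj₁ (bregman-tight (all ⊖ i) (all ⊖ c) (count-⊖-≡ all all {i} {c} refl refl refl)
        (m*n>0⇒n>0 (d i) (subst (0 <_) (sym (edge-uniform i c ic)) 0<p))
        (proj₂ (bregman-tight all all refl 0<p tight i c refl refl ic)) j c′ (⊖-true all i refl j≢i) (⊖-true all c refl c′≢c) jc′)))
      (edge-uniform i c ic)

    -- Deleting two disjoint edges in either order gives d i (d j - A j c) = d j (d i - A i c′).
    exchange : ∀ i c j c′ → A i c ≡ true → A j c ≡ true → A j c′ ≡ true → A i c′ ≡ true
    exchange i c j c′ ic jc jc′ with j Fin.≟ i | c′ Fin.≟ c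
    ... | yes refl | _        = jc′
    ... | no _     | yes refl = ic
    ... | no j≢i   | no c′≢c  = conclude (A i c′) refl
      where
      x y : ℕ
      x = degIn A (all ⊖ c) j
      y = degIn A (all ⊖ c′) i
      first : d i * (x * perm₂ i c j c′) ≡ p
      first = two-edges-uniform i c j c′ ic jc′ j≢i c′≢c
      second : d j * (y * perm₂ j c′ i c) ≡ p
      second = two-edges-uniform j c′ i c jc′ ic (j≢i ∘ sym) (c′≢c ∘ sym)
      0<perm₂ : 0 < perm₂ i c j c′
      0<perm₂ = m*n>0⇒n>0 x (m*n>0⇒n>0 (d i) (subst (0 <_) (sym first) 0<p))
      dx≡dy : d i * x ≡ d j * y
      dx≡dy = *-cancelʳ-≡′ (perm₂ i c j c′) 0<perm₂
        (trans (*-assoc (d i) x _) (trans first (trans (sym second)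
          (trans (cong (λ z → d j * (y * z)) (perm-cong (⊖-comm all j i) (⊖-comm all c′ c))) (sym (*-assoc (d j) y _))))))
      dj≡ : d j ≡ suc x
      dj≡ = trans (degIn-⊖ A all c refl j) (cong (λ b → χ b + x) jc)
      di≡ : d i ≡ χ (A i c′) + y
      di≡ = degIn-⊖ A all c′ refl i
      0<di : 0 < d i
      0<di = m*n>0⇒m>0 (d i) (subst (0 <_) (sym first) 0<p)
      conclude : ∀ b → A i c′ ≡ b → A i c′ ≡ true
      conclude true  ic′ = ic′
      -- Without the entry at (i , c′), y is d i and the exchanged equation becomes d i * x = suc x
      -- * d i, impossible for positive d i.
      conclude false ic′ = contradiction
        (trans dx≡dy (trans (cong (d j *_) (sym (trans di≡ (cong (λ b → χ b + y) ic′)))) (trans (cong (_* d i) dj≡) (*-comm (suc x) (d i)))))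
        (<⇒≢ (*-monoʳ-<′ (d i) 0<di (n<1+n x)))

    -- Every entry of column c carries the share p / δ of the permanent, and the shares along a
    -- column add up to p.
    column-degree : ∀ c δ → (∀ i → A i c ≡ true → d i ≡ δ) → sum (λ i → χ (A i c)) ≡ δ
    column-degree c δ uniform = *-cancelʳ-≡′ p 0<p (begin
      sum (λ i → χ (A i c)) * p
        ≡⟨ *-distribʳ-sum p (λ i → χ (A i c)) ⟩
      sum (λ i → χ (A i c) * p)
        ≡⟨ sum-cong-≗ term ⟩
      sum (λ i → δ * (χ (A i c) * 1 * perm (all ⊖ i) (all ⊖ c)))
        ≡⟨ *-distribˡ-sum δ (λ i → χ (A i c) * 1 * perm (all ⊖ i) (all ⊖ c)) ⟨
      δ * sum (λ i → χ (A i c) * 1 * perm (all ⊖ i) (all ⊖ c))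
        ≡⟨ cong (δ *_) (perm-col all all c refl) ⟨
      δ * p ∎)
      where
      open ≡-Reasoning
      term : ∀ i → χ (A i c) * p ≡ δ * (χ (A i c) * 1 * perm (all ⊖ i) (all ⊖ c))
      term i with A i c in ic
      ... | false = sym (*-zeroʳ δ)
      ... | true  rewrite sym (uniform i ic) = trans (cong (1 *_) (sym (edge-uniform i c ic))) (identity (d i) _)
        where
        identity : ∀ x y → 1 * (x * y) ≡ x * (1 * 1 * y)
        identity = solve-∀

-- The Kahn–Lovász bound and its equality case

-- Together with symmetry and the absence of loops, `exchange` makes every component with an edge
-- complete bipartite; `regular` makes its two sides equally large.
record Balanced {N} (G : Graph (Fin N)) : Set where
  field
    exchange : ∀ i c j c′ → adj G i c ≡ true → adj G j c ≡ true → adj G j c′ ≡ true → adj G i c′ ≡ true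
    regular  : ∀ u v → adj G u v ≡ true → deg G u ≡ deg G v

≡true-ext : ∀ {a b} → (a ≡ true → b ≡ true) → (b ≡ true → a ≡ true) → a ≡ b
≡true-ext {true}  {true}  f g = refl
≡true-ext {true}  {false} f g = sym (f refl)
≡true-ext {false} {true}  f g = g refl
≡true-ext {false} {false} f g = refl

^-2* : ∀ x k → x ^ (2 * k) ≡ (x * x) ^ k
^-2* x k = trans (sym (^-*-assoc x 2 k)) (cong (λ y → (x * y) ^ k) (*-identityʳ x))

module KahnLovasz {N : ℕ} (G : Graph (Fin N)) (weight : Weight N) where
  open Weight weight
  open Hafnian G
  open Permanent (adj G)
  open Bregman (adj G) weight

  private
    A : Fin N → Fin N → Bool
    A = adj G

  W-deg : W all all ≡ prod (w ∘ deg G)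
  W-deg = prod-cong λ v → cong w (sym (deg≡degIn G v))

  perfmat-^ : perfmat G ^ (2 * exponent) ≡ (haf all * haf all) ^ exponent
  perfmat-^ = trans (cong (_^ (2 * exponent)) (perfmat≡haf G)) (^-2* (haf all) exponent)

  haf²^≤perm^ : (haf all * haf all) ^ exponent ≤ perm all all ^ exponent
  haf²^≤perm^ = ^-monoˡ-≤ exponent (haf²≤perm _ all ≤-refl)

  perm^≤W : perm all all ^ exponent ≤ W all all
  perm^≤W = bregman _ all all refl refl

  kahn-lovász : perfmat G ^ (2 * exponent) ≤ prod (w ∘ deg G)
  kahn-lovász = subst₂ _≤_ (sym perfmat-^) W-deg (≤-trans haf²^≤perm^ perm^≤W)

  -- The permanent lies between the squared hafnian and the degree product, so Brègman's bound is
  -- tight for the adjacency matrix and its equality case applies.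
  tight⇒balanced : 0 < perfmat G → perfmat G ^ (2 * exponent) ≡ prod (w ∘ deg G) → Balanced G
  tight⇒balanced 0<pm tight = record { exchange = exchange ; regular = regular }
    where
    0<haf : 0 < haf all
    0<haf = subst (0 <_) (perfmat≡haf G) 0<pm
    open TightSquare (≤-trans (*->0 0<haf 0<haf) (haf²≤perm _ all ≤-refl))
      (≤-antisym perm^≤W (≤-trans (≤-reflexive (trans W-deg (trans (sym tight) perfmat-^))) haf²^≤perm^))
    regular : ∀ u v → adj G u v ≡ true → deg G u ≡ deg G v
    regular u v uv = begin
      deg G u                  ≡⟨ deg≡degIn G u ⟩
      degIn A all u            ≡⟨ column-degree v (degIn A all u) same-row ⟨
      sum (λ i → χ (A i v))    ≡⟨ (sum-cong-≗ λ i → trans (cong χ (adj-sym G i v)) (sym (*-identityʳ (χ (A v i))))) ⟩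
      degIn A all v            ≡⟨ deg≡degIn G v ⟨
      deg G v                  ∎
      where
      open ≡-Reasoning
      -- By `exchange` all neighbours of v have the neighbourhood of u, so `column-degree` computes
      -- the column sum at v as the degree of u; by symmetry it is also the degree of v.
      same-row : ∀ i → A i v ≡ true → degIn A all i ≡ degIn A all u
      same-row i iv = sum-cong-≗ λ c → cong (λ b → χ b * 1) (≡true-ext (exchange u v i c uv iv) (exchange i v u c iv uv))

  -- Unions of balanced complete bipartite graphs attain the bound

  module Attained (exchange : ∀ i c j c′ → A i c ≡ true → A j c ≡ true → A j c′ ≡ true → A i c′ ≡ true) where

    Regular : (Fin N → Bool) → Set
    Regular S = ∀ u v → S u ≡ true → S v ≡ true → A u v ≡ true → degIn A S u ≡ degIn A S v

    module RemoveEdge (S : Fin N → Bool) (regular : Regular S)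
      (a b : Fin N) (Sa : S a ≡ true) (Sb : S b ≡ true) (ab : A a b ≡ true) where

      S′ : Fin N → Bool
      S′ = S ⊖ a ⊖ b

      b≢a : b ≢ a
      b≢a = adj⇒≢ ab

      ba : A b a ≡ true
      ba = trans (adj-sym G b a) ab

      link : Fin N → ℕ
      link v = χ (A v a) + χ (A v b)

      degIn-S′ : ∀ v → degIn A S v ≡ link v + degIn A S′ v
      degIn-S′ v = trans (degIn-⊖ A S a Sa v)
        (trans (cong (χ (A v a) +_) (degIn-⊖ A (S ⊖ a) b (⊖-true S a Sb b≢a) v)) (sym (+-assoc (χ (A v a)) _ _)))

      S′⇒S : ∀ {v} → S′ v ≡ true → S v ≡ true
      S′⇒S S′v = proj₁ (⊖-true⁻ S a (proj₁ (⊖-true⁻ (S ⊖ a) b S′v)))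

      -- For adjacent u and v, `exchange` along the edge ab shows that u meets b exactly when v
      -- meets a, and u meets a exactly when v meets b. So both lose the same number of neighbours.
      regular′ : Regular S′
      regular′ u v S′u S′v uv = +-cancelˡ-≡ (link u) _ _ (begin
        link u + degIn A S′ u ≡⟨ degIn-S′ u ⟨
        degIn A S u           ≡⟨ regular u v (S′⇒S S′u) (S′⇒S S′v) uv ⟩
        degIn A S v           ≡⟨ degIn-S′ v ⟩
        link v + degIn A S′ v ≡⟨ cong (_+ degIn A S′ v) link≡ ⟨
        link u + degIn A S′ v ∎)
        where
        open ≡-Reasoning
        vu : A v u ≡ true
        vu = trans (adj-sym G v u) uv
        link≡ : link u ≡ link v
        link≡ = trans (+-comm (χ (A u a)) _) (cong₂ _+_
          (cong χ (≡true-ext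
            (λ ub → trans (adj-sym G v a) (exchange a b u v ab ub uv))
            (λ va → trans (adj-sym G u b) (exchange b a v u ba va vu))))
          (cong χ (≡true-ext
            (λ ua → trans (adj-sym G v b) (exchange b a u v ba ua uv))
            (λ vb → trans (adj-sym G u a) (exchange a b v u ab vb vu)))))

      not-both : ∀ v → A v a ≡ true → A v b ≡ true → ⊥
      not-both v va vb = contradiction (trans (sym (exchange a b v a ab vb va)) (adj-irrefl G a)) λ ()

      d : ℕ
      d = degIn A S a

      db≡d : degIn A S b ≡ d
      db≡d = regular b a Sb Sa ba

      -- The neighbours of a or b in S have degree d there. Those that survive drop to degree d - 1,
      -- while a and b lose their factor `w d` altogether; the powers of `w (pred d)` and `w d`
      -- balance the two sides without division.
      factor-link : ∀ v → factor S S v * w (pred d) ^ (χ (S′ v) * link v) ≡ factor S′ S′ v * w d ^ (χ (S v) * link v)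
      factor-link v with v Fin.≟ a | v Fin.≟ b
      ... | yes refl | yes refl = contradiction refl b≢a
      ... | yes refl | no _     rewrite Sa | adj-irrefl G a | ab = identity (w (degIn A S a))
        where
        identity : ∀ x → x * 1 ≡ 1 * (x * 1)
        identity = solve-∀
      ... | no _     | yes refl rewrite Sb | adj-irrefl G b | ba | db≡d = identity (w d)
        where
        identity : ∀ x → x * 1 ≡ 1 * (x * 1)
        identity = solve-∀
      ... | no v≢a   | no v≢b with S v in Sv
      ...   | false = refl
      ...   | true with A v a in va | A v b in vb
      ...     | true  | true  = ⊥-elim (not-both v va vb)
      ...     | false | false rewrite degIn-S′ v | va | vb = refl
      ...     | true  | false = trans
        (cong₂ (λ x y → w x * (y * 1)) dv≡d (trans (cong (w ∘ pred) (sym dv≡d)) (cong (w ∘ pred) dv≡)))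
        (swap (w d) (w (degIn A S′ v)))
        where
        dv≡d : degIn A S v ≡ d
        dv≡d = regular v a Sv Sa va
        dv≡ : degIn A S v ≡ suc (degIn A S′ v)
        dv≡ = trans (degIn-S′ v) (cong₂ (λ x y → χ x + χ y + degIn A S′ v) va vb)
        swap : ∀ x y → x * (y * 1) ≡ y * (x * 1)
        swap = solve-∀
      ...     | false | true  = trans
        (cong₂ (λ x y → w x * (y * 1)) dv≡d (trans (cong (w ∘ pred) (sym dv≡d)) (cong (w ∘ pred) dv≡)))
        (swap (w d) (w (degIn A S′ v)))
        where
        dv≡d : degIn A S v ≡ d
        dv≡d = trans (regular v b Sv Sb vb) db≡d
        dv≡ : degIn A S v ≡ suc (degIn A S′ v)
        dv≡ = trans (degIn-S′ v) (cong₂ (λ x y → χ x + χ y + degIn A S′ v) va vb)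
        swap : ∀ x y → x * (y * 1) ≡ y * (x * 1)
        swap = solve-∀

      sum-link : ∀ T → sum (λ v → χ (T v) * link v) ≡ degIn A T a + degIn A T b
      sum-link T = trans (sum-cong-≗ λ v → trans
          (cong₂ (λ x y → χ (T v) * (χ x + χ y)) (adj-sym G v a) (adj-sym G v b))
          (identity (χ (T v)) (χ (A a v)) (χ (A b v))))
        (∑-distrib-+ (λ v → χ (A a v) * χ (T v)) (λ v → χ (A b v) * χ (T v)))
        where
        identity : ∀ t x y → t * (x + y) ≡ x * t + y * t
        identity = solve-∀

      W-link : W S S * w (pred d) ^ (pred d + pred d) ≡ W S′ S′ * w d ^ (d + d)
      W-link = begin
        W S S * w (pred d) ^ (pred d + pred d)
          ≡⟨ cong (λ x → W S S * w (pred d) ^ x) (trans (sum-link S′) (cong₂ _+_ d′a≡ d′b≡)) ⟨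
        W S S * w (pred d) ^ sum (λ v → χ (S′ v) * link v)
          ≡⟨ cong (W S S *_) (^-sum (w (pred d)) (λ v → χ (S′ v) * link v)) ⟨
        W S S * prod (λ v → w (pred d) ^ (χ (S′ v) * link v))
          ≡⟨ prod-* (factor S S) _ ⟨
        prod (λ v → factor S S v * w (pred d) ^ (χ (S′ v) * link v))
          ≡⟨ prod-cong factor-link ⟩
        prod (λ v → factor S′ S′ v * w d ^ (χ (S v) * link v))
          ≡⟨ prod-* (factor S′ S′) _ ⟩
        W S′ S′ * prod (λ v → w d ^ (χ (S v) * link v))
          ≡⟨ cong (W S′ S′ *_) (^-sum (w d) (λ v → χ (S v) * link v)) ⟩
        W S′ S′ * w d ^ sum (λ v → χ (S v) * link v)
          ≡⟨ cong (λ x → W S′ S′ * w d ^ x) (trans (sum-link S) (cong (d +_) db≡d)) ⟩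
        W S′ S′ * w d ^ (d + d) ∎
        where
        open ≡-Reasoning
        d′a≡ : degIn A S′ a ≡ pred d
        d′a≡ = sym (cong pred (trans (degIn-S′ a) (cong₂ (λ x y → χ x + χ y + degIn A S′ a) (adj-irrefl G a) ab)))
        d′b≡ : degIn A S′ b ≡ pred d
        d′b≡ = sym (cong pred (trans (sym db≡d) (trans (degIn-S′ b) (cong₂ (λ x y → χ x + χ y + degIn A S′ b) ba (adj-irrefl G b)))))

      -- Deleting the ends of an edge turns K d d into the same graph of order d - 1, and d ! = d (d
      -- - 1) !. The factor matches that of a hafnian `d` times as large, raised to the power
      -- `2 * exponent`.
      W-step : 0 < d → W S S ≡ d ^ (2 * exponent) * W S′ S′
      W-step 0<d = cancel d 0<d (degIn≤ A S a) W-link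
        where
        w-^2 : ∀ δ → δ ≤ N → w δ ^ (δ + δ) ≡ (δ !) ^ (2 * exponent)
        w-^2 δ δ≤N = begin
          w δ ^ (δ + δ)                             ≡⟨ ^-distribˡ-+-* (w δ) δ δ ⟩
          w δ ^ δ * w δ ^ δ                         ≡⟨ cong₂ _*_ (w-^ δ δ≤N) (w-^ δ δ≤N) ⟩
          (δ !) ^ exponent * (δ !) ^ exponent       ≡⟨ ^-distribˡ-+-* (δ !) exponent exponent ⟨
          (δ !) ^ (exponent + exponent)             ≡⟨ cong (λ x → (δ !) ^ (exponent + x)) (+-identityʳ exponent) ⟨
          (δ !) ^ (2 * exponent)                    ∎
          where open ≡-Reasoning
        cancel : ∀ δ → 0 < δ → δ ≤ N → W S S * w (pred δ) ^ (pred δ + pred δ) ≡ W S′ S′ * w δ ^ (δ + δ) →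
          W S S ≡ δ ^ (2 * exponent) * W S′ S′
        cancel (suc δ) _ δ<N eq = *-cancelʳ-≡′ ((δ !) ^ (2 * exponent)) (^->0 (2 * exponent) (1≤n! δ)) (begin
          W S S * (δ !) ^ (2 * exponent)                                   ≡⟨ cong (W S S *_) (w-^2 δ (<⇒≤ δ<N)) ⟨
          W S S * w δ ^ (δ + δ)                                            ≡⟨ eq ⟩
          W S′ S′ * w (suc δ) ^ (suc δ + suc δ)                            ≡⟨ cong (W S′ S′ *_) (w-^2 (suc δ) δ<N) ⟩
          W S′ S′ * (suc δ * δ !) ^ (2 * exponent)                         ≡⟨ cong (W S′ S′ *_) (^-distribʳ-* (suc δ) (δ !) (2 * exponent)) ⟩
          W S′ S′ * (suc δ ^ (2 * exponent) * (δ !) ^ (2 * exponent))      ≡⟨ identity (W S′ S′) (suc δ ^ (2 * exponent)) ((δ !) ^ (2 * exponent)) ⟩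
          suc δ ^ (2 * exponent) * W S′ S′ * (δ !) ^ (2 * exponent)        ∎)
          where
          open ≡-Reasoning
          identity : ∀ x y z → x * (y * z) ≡ y * x * z
          identity = solve-∀

    0<2*exponent : 0 < 2 * exponent
    0<2*exponent = *->0 {2} z<s exponent>0

    -- Expand at a vertex a of degree d. For every neighbour b the induction hypothesis and `W-step`
    -- give d * haf (S ⊖ a ⊖ b) the same power `W S S`, so the d terms of the expansion are equal
    -- and `haf S` is that common value.
    haf-attains : ∀ k S → count S ≤ k → Regular S → haf S ^ (2 * exponent) ≡ W S S
    haf-attains k S S≤k regular with ∅⊎∋ S
    haf-attains k S S≤k regular | inj₁ S∅ = trans
      (trans (cong (_^ (2 * exponent)) (haf-∅ S∅)) (^-zeroˡ (2 * exponent)))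
      (sym (trans (prod-cong λ i → cong (λ b → if b then w (degIn A S i) else 1) (S∅ i)) (prod-one N)))
    haf-attains zero S S≤k regular | inj₂ (a , Sa) = contradiction (trans (sym Sa) (count≡0⇒∅ S (n≤0⇒n≡0 S≤k) a)) λ ()
    haf-attains (suc k) S S≤k regular | inj₂ (a , Sa) with ≡0⊎>0 (degIn A S a)
    -- A vertex without neighbours in S makes both sides 0: it cannot be matched, and `w 0` is 0.
    ... | inj₁ d≡0 = trans (cong (_^ (2 * exponent)) haf≡0) (trans (0^>0 0<2*exponent) (sym W≡0))
      where
      no-neighbour : ∀ b → χ (A a b) * χ (S b) ≡ 0
      no-neighbour b = n≤0⇒n≡0 (≤-trans (term≤sum (λ b → χ (A a b) * χ (S b)) b) (≤-reflexive d≡0))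
      haf≡0 : haf S ≡ 0
      haf≡0 = trans (haf-expand S a Sa) (trans (sum-cong-≗ λ b → cong (_* haf (S ⊖ a ⊖ b)) (no-neighbour b)) (sum-zero N))
      W≡0 : W S S ≡ 0
      W≡0 = prod-zero (factor S S) a (trans (cong (λ b → if b then w (degIn A S a) else 1) Sa) (trans (cong w d≡0) w-zero))
    ... | inj₂ 0<d with sum>0⇒∃ _ 0<d
    ...   | b₀ , 0<ab₀ = subst (λ x → x ^ (2 * exponent) ≡ W S S) (sym haf≡y) (attains b₀ ab₀ Sb₀)
      where
      d : ℕ
      d = degIn A S a
      ab₀ : A a b₀ ≡ true
      ab₀ = χ>0⇒true (m*n>0⇒m>0 (χ (A a b₀)) 0<ab₀)
      Sb₀ : S b₀ ≡ true
      Sb₀ = χ>0⇒true (m*n>0⇒n>0 (χ (A a b₀)) 0<ab₀)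
      attains : ∀ b → A a b ≡ true → S b ≡ true → (d * haf (S ⊖ a ⊖ b)) ^ (2 * exponent) ≡ W S S
      attains b ab Sb = trans (^-distribʳ-* d (haf S′) (2 * exponent))
        (trans (cong (d ^ (2 * exponent) *_) (haf-attains k S′ S′≤k regular′)) (sym (W-step 0<d)))
        where
        open RemoveEdge S regular a b Sa Sb ab hiding (d)
        S′≤k : count S′ ≤ k
        S′≤k = ≤-trans (n≤1+n _) (≤-trans (≤-reflexive (count-⊖ (S ⊖ a) b (⊖-true S a Sb b≢a)))
          (s≤s⁻¹ (≤-trans (≤-reflexive (count-⊖ S a Sa)) S≤k)))
      y : ℕ
      y = d * haf (S ⊖ a ⊖ b₀)
      term : ∀ b → d * (χ (A a b) * χ (S b) * haf (S ⊖ a ⊖ b)) ≡ χ (A a b) * χ (S b) * y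
      term b with A a b in ab | S b in Sb
      ... | false | _     = *-zeroʳ d
      ... | true  | false = *-zeroʳ d
      ... | true  | true  = trans (cong (d *_) (+-identityʳ _))
        (trans (^-cancelʳ-≡ (2 * exponent) 0<2*exponent (trans (attains b ab Sb) (sym (attains b₀ ab₀ Sb₀)))) (sym (+-identityʳ y)))
      haf≡y : haf S ≡ y
      haf≡y = *-cancelˡ-≡′ d 0<d (begin
        d * haf S                                                       ≡⟨ cong (d *_) (haf-expand S a Sa) ⟩
        d * sum (λ b → χ (A a b) * χ (S b) * haf (S ⊖ a ⊖ b))           ≡⟨ *-distribˡ-sum d (λ b → χ (A a b) * χ (S b) * haf (S ⊖ a ⊖ b)) ⟩
        sum (λ b → d * (χ (A a b) * χ (S b) * haf (S ⊖ a ⊖ b)))         ≡⟨ sum-cong-≗ term ⟩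
        sum (λ b → χ (A a b) * χ (S b) * y)                             ≡⟨ *-distribʳ-sum y (λ b → χ (A a b) * χ (S b)) ⟨
        d * y                                                           ∎)
        where open ≡-Reasoning

  balanced⇒tight : Balanced G → perfmat G ^ (2 * exponent) ≡ prod (w ∘ deg G)
  balanced⇒tight bal = trans (cong (_^ (2 * exponent)) (perfmat≡haf G))
    (trans (haf-attains _ all ≤-refl λ u v _ _ uv → trans (sym (deg≡degIn G u)) (trans (regular u v uv) (deg≡degIn G v))) W-deg)
    where
    open Balanced bal
    open Attained exchange

-- Strict log-concavity of d ↦ (d !) ^ (1 / d)

-- Log-concavity at e, e + 1, e + 2 raised to the power e (e + 1) (e + 2): after (e + 2) ! and (e +
-- 1) ! are expanded, all further powers of factorials cancel and this remains. At e = 0 both sides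
-- are 1, from e = 1 on the inequality is strict.
factorial-bound : ∀ e → (e ! * e !) * (2 + e) ^ (suc e * e) ≤ suc e ^ (e * (3 + e))
factorial-bound-< : ∀ e → (suc e ! * suc e !) * (3 + e) ^ ((2 + e) * suc e) < (2 + e) ^ (suc e * (4 + e))

factorial-bound zero    = ≤-refl
factorial-bound (suc e) = <⇒≤ (factorial-bound-< e)

-- Induction step: ((e + 1) (e + 3)) ^ ((e + 1) (e + 2)) < ((e + 2) ^ 2) ^ ((e + 1) (e + 2)).
factorial-bound-< e = *-cancelˡ-< (suc e ^ s) _ _ (begin-strict
  suc e ^ s * ((suc e ! * suc e !) * (3 + e) ^ s)
    ≡⟨ identity₁ (suc e ^ s) (suc e) (e !) ((3 + e) ^ s) ⟩
  (e ! * e !) * (suc e * suc e) * (suc e ^ s * (3 + e) ^ s)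
    ≡⟨ cong ((e ! * e !) * (suc e * suc e) *_) (^-distribʳ-* (suc e) (3 + e) s) ⟨
  (e ! * e !) * (suc e * suc e) * (suc e * (3 + e)) ^ s
    <⟨ *-monoʳ-<′ ((e ! * e !) * (suc e * suc e)) (*->0 (*->0 (1≤n! e) (1≤n! e)) (*->0 {suc e} {suc e} z<s z<s)) (^-monoˡ-< s square) ⟩
  (e ! * e !) * (suc e * suc e) * ((2 + e) * (2 + e)) ^ s
    ≡⟨ cong ((e ! * e !) * (suc e * suc e) *_) (trans (^-distribʳ-* (2 + e) (2 + e) s)
         (trans (sym (^-distribˡ-+-* (2 + e) s s)) (trans (cong ((2 + e) ^_) (identity₂ e)) (^-distribˡ-+-* (2 + e) (suc e * e) (suc e * (4 + e)))))) ⟩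
  (e ! * e !) * (suc e * suc e) * ((2 + e) ^ (suc e * e) * (2 + e) ^ (suc e * (4 + e)))
    ≡⟨ identity₃ (e ! * e !) (suc e) ((2 + e) ^ (suc e * e)) ((2 + e) ^ (suc e * (4 + e))) ⟩
  suc e ^ 2 * ((e ! * e !) * (2 + e) ^ (suc e * e)) * (2 + e) ^ (suc e * (4 + e))
    ≤⟨ *-monoˡ-≤ _ (*-monoʳ-≤ (suc e ^ 2) (factorial-bound e)) ⟩
  suc e ^ 2 * suc e ^ (e * (3 + e)) * (2 + e) ^ (suc e * (4 + e))
    ≡⟨ cong (_* (2 + e) ^ (suc e * (4 + e))) (trans (sym (^-distribˡ-+-* (suc e) 2 (e * (3 + e)))) (cong (suc e ^_) (identity₄ e))) ⟩
  suc e ^ s * (2 + e) ^ (suc e * (4 + e)) ∎)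
  where
  open ≤-Reasoning
  s : ℕ
  s = (2 + e) * suc e
  square : suc e * (3 + e) < (2 + e) * (2 + e)
  square = ≤-reflexive (identity e)
    where
    identity : ∀ e → suc (suc e * (3 + e)) ≡ (2 + e) * (2 + e)
    identity = solve-∀
  identity₁ : ∀ p a x q → p * (a * x * (a * x) * q) ≡ x * x * (a * a) * (p * q)
  identity₁ = solve-∀
  identity₂ : ∀ e → (2 + e) * suc e + (2 + e) * suc e ≡ suc e * e + suc e * (4 + e)
  identity₂ = solve-∀
  identity₃ : ∀ x a p q → x * (a * a) * (p * q) ≡ (a * (a * 1)) * (x * p) * q
  identity₃ = solve-∀
  identity₄ : ∀ e → 2 + e * (3 + e) ≡ (2 + e) * suc e
  identity₄ = solve-∀

module LogConcave {bound : ℕ} (weight : Weight bound) where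
  open Weight weight

  w>0 : ∀ d → 0 < d → d ≤ bound → 0 < w d
  w>0 d@(suc _) 0<d d≤b with ≡0⊎>0 (w d)
  ... | inj₂ 0<w = 0<w
  ... | inj₁ w≡0 = contradiction (trans (sym (w-^ d d≤b)) (cong (_^ d) w≡0)) (≢-sym (<⇒≢ (^->0 exponent (1≤n! d))))

  w-^-* : ∀ d k → d ≤ bound → w d ^ (d * k) ≡ ((d !) ^ k) ^ exponent
  w-^-* d k d≤b = trans (sym (^-*-assoc (w d) d k)) (trans (cong (_^ k) (w-^ d d≤b)) (^-comm (d !) exponent k))

  -- The inequality is raised to the power e (e + 1) (e + 2).
  log-concave : ∀ e → 2 + e ≤ bound → w e * w (2 + e) < w (suc e) * w (suc e)
  -- The value 0 at degree 0 reduces this case to the positivity of `w 1`.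
  log-concave zero      2≤b rewrite w-zero = *->0 (w>0 1 z<s (<⇒≤ 2≤b)) (w>0 1 z<s (<⇒≤ 2≤b))
  log-concave e@(suc e′) e+2≤b = ≰⇒> λ ≥ → <⇒≱ power-< (^-monoˡ-≤ P ≥)
    where
    P : ℕ
    P = e * (suc e * (2 + e))
    lhs rhs : ℕ
    lhs = (e !) ^ (suc e * (2 + e)) * ((2 + e) !) ^ (e * suc e)
    rhs = (suc e !) ^ (e * (2 + e)) * (suc e !) ^ (e * (2 + e))
    lhs-power : (w e * w (2 + e)) ^ P ≡ lhs ^ exponent
    lhs-power = trans (^-distribʳ-* (w e) (w (2 + e)) P)
      (trans (cong₂ _*_ (w-^-* e (suc e * (2 + e)) (≤-trans (m≤n+m e 2) e+2≤b))
          (trans (cong (w (2 + e) ^_) (identity e)) (w-^-* (2 + e) (e * suc e) e+2≤b)))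
        (sym (^-distribʳ-* ((e !) ^ (suc e * (2 + e))) _ exponent)))
      where
      identity : ∀ e → e * (suc e * (2 + e)) ≡ (2 + e) * (e * suc e)
      identity = solve-∀
    rhs-power : (w (suc e) * w (suc e)) ^ P ≡ rhs ^ exponent
    rhs-power = trans (^-distribʳ-* (w (suc e)) (w (suc e)) P)
      (trans (cong (λ x → x * x) (trans (cong (w (suc e) ^_) (identity e)) (w-^-* (suc e) (e * (2 + e)) (<⇒≤ e+2≤b))))
        (sym (^-distribʳ-* ((suc e !) ^ (e * (2 + e))) _ exponent)))
      where
      identity : ∀ e → e * (suc e * (2 + e)) ≡ suc e * (e * (2 + e))
      identity = solve-∀
    lhs<rhs : lhs < rhs
    lhs<rhs = begin-strict
      (e !) ^ (suc e * (2 + e)) * ((2 + e) * (suc e !)) ^ (e * suc e)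
        ≡⟨ cong₂ _*_ (trans (cong ((e !) ^_) (identity₁ e)) (^-distribˡ-+-* (e !) 2 (e * (3 + e)))) (^-distribʳ-* (2 + e) (suc e !) (e * suc e)) ⟩
      (e !) ^ 2 * (e !) ^ (e * (3 + e)) * ((2 + e) ^ (e * suc e) * (suc e !) ^ (e * suc e))
        ≡⟨ identity₂ (e !) ((e !) ^ (e * (3 + e))) ((2 + e) ^ (e * suc e)) _ ⟩
      (suc e !) ^ (e * suc e) * (e !) ^ (e * (3 + e)) * ((e ! * e !) * (2 + e) ^ (e * suc e))
        <⟨ *-monoʳ-<′ _ (*->0 (^->0 (e * suc e) (1≤n! (suc e))) (^->0 (e * (3 + e)) (1≤n! e)))
             (subst (_< suc e ^ (e * (3 + e))) (cong (λ x → (e ! * e !) * (2 + e) ^ x) (*-comm (suc e) e)) (factorial-bound-< e′)) ⟩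
      (suc e !) ^ (e * suc e) * (e !) ^ (e * (3 + e)) * suc e ^ (e * (3 + e))
        ≡⟨ trans (*-assoc ((suc e !) ^ (e * suc e)) _ _) (cong ((suc e !) ^ (e * suc e) *_)
             (trans (*-comm ((e !) ^ (e * (3 + e))) _) (sym (^-distribʳ-* (suc e) (e !) (e * (3 + e)))))) ⟩
      (suc e !) ^ (e * suc e) * (suc e !) ^ (e * (3 + e))
        ≡⟨ ^-distribˡ-+-* (suc e !) (e * suc e) (e * (3 + e)) ⟨
      (suc e !) ^ (e * suc e + e * (3 + e))
        ≡⟨ trans (cong ((suc e !) ^_) (identity₃ e)) (^-distribˡ-+-* (suc e !) (e * (2 + e)) (e * (2 + e))) ⟩
      rhs ∎
      where
      open ≤-Reasoning
      identity₁ : ∀ e → suc e * (2 + e) ≡ 2 + e * (3 + e)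
      identity₁ = solve-∀
      identity₂ : ∀ x p q r → x * (x * 1) * p * (q * r) ≡ r * p * (x * x * q)
      identity₂ = solve-∀
      identity₃ : ∀ e → e * suc e + e * (3 + e) ≡ e * (2 + e) + e * (2 + e)
      identity₃ = solve-∀
    power-< : (w e * w (2 + e)) ^ P < (w (suc e) * w (suc e)) ^ P
    power-< = subst₂ _<_ (sym lhs-power) (sym rhs-power) (^-monoˡ-< exponent {{>-nonZero exponent>0}} lhs<rhs)

  -- Log-concavity between neighbours, telescoped: the ratio w (d + 1) / w d decreases with d. It is
  -- cross-multiplied, since `w 0` is 0.
  ratio-decreasing : ∀ a b → a < b → suc b ≤ bound → w a * w (suc b) < w (suc a) * w b
  ratio-decreasing a (suc b) a<b b≤B with m<1+n⇒m<n∨m≡n a<b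
  ... | inj₂ refl = log-concave b b≤B
  ... | inj₁ a<b′ = *-cancelˡ-< (w b) _ _ (begin-strict
    w b * (w a * w (2 + b))             ≡⟨ identity₁ (w b) (w a) (w (2 + b)) ⟩
    w a * (w b * w (2 + b))             ≤⟨ *-monoʳ-≤ (w a) (<⇒≤ (log-concave b b≤B)) ⟩
    w a * (w (suc b) * w (suc b))       ≡⟨ *-assoc (w a) (w (suc b)) (w (suc b)) ⟨
    w a * w (suc b) * w (suc b)         <⟨ *-monoˡ-< (w (suc b)) {{>-nonZero (w>0 (suc b) z<s (<⇒≤ b≤B))}} (ratio-decreasing a b a<b′ (<⇒≤ b≤B)) ⟩
    w (suc a) * w b * w (suc b)         ≡⟨ identity₂ (w (suc a)) (w b) (w (suc b)) ⟩
    w b * (w (suc a) * w (suc b))       ∎)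
    where
    open ≤-Reasoning
    identity₁ : ∀ x y z → x * (y * z) ≡ y * (x * z)
    identity₁ = solve-∀
    identity₂ : ∀ x y z → x * y * z ≡ y * (x * z)
    identity₂ = solve-∀

  module Tangent (k : ℕ) (0<k : 0 < k) (k<B : suc k ≤ bound) where

    wk>0 : 0 < w k
    wk>0 = w>0 k 0<k (<⇒≤ k<B)

    wk+1>0 : 0 < w (suc k)
    wk+1>0 = w>0 (suc k) z<s k<B

    private
      shuffle : ∀ x y z → x * (y * z) ≡ x * y * z
      shuffle = solve-∀

    -- Upwards from k each step multiplies `w` by at most w (k + 1) / w k, and by strictly less from
    -- the second step on. Downwards, in `below`, each step loses more than this ratio. Hence
    -- exactly k and k + 1 give equality.
    above : ∀ j → k + j ≤ bound → w (k + j) * w k ^ j ≤ w k * w (suc k) ^ j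
    above-< : ∀ j → k + suc (suc j) ≤ bound → w (k + suc (suc j)) * w k ^ suc (suc j) < w k * w (suc k) ^ suc (suc j)
    above-step : ∀ j → k + suc (suc j) ≤ bound → w (k + suc j) * w k ^ suc j ≤ w k * w (suc k) ^ suc j →
      w (k + suc (suc j)) * w k ^ suc (suc j) < w k * w (suc k) ^ suc (suc j)
    above-step j k+j≤B above-j = begin-strict
      w (k + suc (suc j)) * w k ^ suc (suc j)        ≡⟨ cong (λ x → w x * w k ^ suc (suc j)) (+-suc k (suc j)) ⟩
      w (suc (k + suc j)) * (w k * w k ^ suc j)      ≡⟨ identity₁ (w (suc (k + suc j))) (w k) _ ⟩
      w k * w (suc (k + suc j)) * w k ^ suc j        <⟨ *-monoˡ-< (w k ^ suc j) {{>-nonZero (^->0 (suc j) wk>0)}}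
                                                          (ratio-decreasing k (k + suc j) (m<m+n k z<s) (subst (_≤ bound) (+-suc k (suc j)) k+j≤B)) ⟩
      w (suc k) * w (k + suc j) * w k ^ suc j        ≡⟨ *-assoc (w (suc k)) _ _ ⟩
      w (suc k) * (w (k + suc j) * w k ^ suc j)      ≤⟨ *-monoʳ-≤ (w (suc k)) above-j ⟩
      w (suc k) * (w k * w (suc k) ^ suc j)          ≡⟨ identity₂ (w (suc k)) (w k) _ ⟩
      w k * w (suc k) ^ suc (suc j)                  ∎
      where
      open ≤-Reasoning
      identity₁ : ∀ x y z → x * (y * z) ≡ y * x * z
      identity₁ = solve-∀
      identity₂ : ∀ x y z → x * (y * z) ≡ y * (x * z)
      identity₂ = solve-∀
    above zero          _     = ≤-reflexive (cong (λ x → w x * 1) (+-identityʳ k))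
    above (suc zero)    k+1≤B = ≤-reflexive (trans (cong (λ x → w x * w k ^ 1) (+-comm k 1)) (identity (w (suc k)) (w k)))
      where
      identity : ∀ x y → x * (y * 1) ≡ y * (x * 1)
      identity = solve-∀
    above (suc (suc j)) k+j≤B = <⇒≤ (above-step j k+j≤B (above (suc j) (≤-trans (+-monoʳ-≤ k (n≤1+n (suc j))) k+j≤B)))
    above-< j k+j≤B = above-step j k+j≤B (above (suc j) (≤-trans (+-monoʳ-≤ k (n≤1+n (suc j))) k+j≤B))

    below : ∀ j i → i + j ≡ k → w i * w (suc k) ^ j ≤ w k ^ suc j
    below-< : ∀ j i → i + suc j ≡ k → w i * w (suc k) ^ suc j < w k ^ suc (suc j)
    below zero    i i≡k = ≤-reflexive (cong (λ x → w x * 1) (trans (sym (+-identityʳ i)) i≡k))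
    below (suc j) i i+≡k = <⇒≤ (below-< j i i+≡k)
    below-< j i i+≡k = begin-strict
      w i * (w (suc k) * w (suc k) ^ j)      ≡⟨ shuffle (w i) (w (suc k)) _ ⟩
      w i * w (suc k) * w (suc k) ^ j        <⟨ *-monoˡ-< (w (suc k) ^ j) {{>-nonZero (^->0 j wk+1>0)}}
                                                  (ratio-decreasing i k (subst (i <_) i+≡k (m<m+n i z<s)) k<B) ⟩
      w (suc i) * w k * w (suc k) ^ j        ≡⟨ identity (w (suc i)) (w k) _ ⟩
      w k * (w (suc i) * w (suc k) ^ j)      ≤⟨ *-monoʳ-≤ (w k) (below j (suc i) (trans (sym (+-suc i j)) i+≡k)) ⟩
      w k * w k ^ suc j                      ∎
      where
      open ≤-Reasoning
      identity : ∀ x y z → x * y * z ≡ y * (x * z)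
      identity = solve-∀

    Near : ℕ → Set
    Near d = d ≡ k ⊎ d ≡ suc k

    -- The two sides of w d ≤ w k (w (k + 1) / w k) ^ (d - k), cleared of quotients and negative
    -- exponents. In logarithms the right side is the line through the points at k and k + 1 of a
    -- concave sequence.
    tangentˡ tangentʳ : ℕ → ℕ
    tangentˡ d = w d * (w k ^ d * w (suc k) ^ k)
    tangentʳ d = w k ^ suc k * w (suc k) ^ d

    private
      common : ℕ → ℕ
      common d = w k ^ d * w (suc k) ^ d

      common>0 : ∀ d → 0 < common d
      common>0 d = *->0 (^->0 d wk>0) (^->0 d wk+1>0)

      aboveˡ : ∀ j → tangentˡ (k + j) ≡ common k * (w (k + j) * w k ^ j)
      aboveˡ j = trans (cong (λ x → w (k + j) * (x * w (suc k) ^ k)) (^-distribˡ-+-* (w k) k j)) (identity (w (k + j)) (w k ^ k) (w k ^ j) (w (suc k) ^ k))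
        where
        identity : ∀ x a b c → x * (a * b * c) ≡ a * c * (x * b)
        identity = solve-∀

      aboveʳ : ∀ j → tangentʳ (k + j) ≡ common k * (w k * w (suc k) ^ j)
      aboveʳ j = trans (cong (w k ^ suc k *_) (^-distribˡ-+-* (w (suc k)) k j)) (identity (w k) _ _ _)
        where
        identity : ∀ x a b c → x * a * (b * c) ≡ a * b * (x * c)
        identity = solve-∀

      belowˡ : ∀ j i → i + j ≡ k → tangentˡ i ≡ common i * (w i * w (suc k) ^ j)
      belowˡ j i i+j≡k = trans (cong (λ x → w i * (w k ^ i * x))
          (trans (cong (w (suc k) ^_) (sym i+j≡k)) (^-distribˡ-+-* (w (suc k)) i j))) (identity (w i) (w k ^ i) (w (suc k) ^ i) (w (suc k) ^ j))
        where
        identity : ∀ x a b c → x * (a * (b * c)) ≡ a * b * (x * c)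
        identity = solve-∀

      belowʳ : ∀ j i → i + j ≡ k → tangentʳ i ≡ common i * w k ^ suc j
      belowʳ j i i+j≡k = trans (cong (λ x → w k * x * w (suc k) ^ i)
          (trans (cong (w k ^_) (sym i+j≡k)) (^-distribˡ-+-* (w k) i j))) (identity (w k) (w k ^ i) (w k ^ j) (w (suc k) ^ i))
        where
        identity : ∀ x a b c → x * (a * b) * c ≡ a * c * (x * b)
        identity = solve-∀

    tangent-cases : ∀ d → d ≤ bound → (Near d × tangentˡ d ≡ tangentʳ d) ⊎ (¬ Near d × tangentˡ d < tangentʳ d)
    tangent-cases d d≤B with ≤-<-connex k d
    ... | inj₁ k≤d with m≤n⇒∃[o]m+o≡n k≤d
    ...   | zero , refl = inj₁ (inj₁ (+-identityʳ k) , trans (aboveˡ 0) (trans (cong (λ x → common k * (w x * 1)) (+-identityʳ k)) (sym (aboveʳ 0))))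
    ...   | suc zero , refl = inj₁ (inj₂ (+-comm k 1) , trans (aboveˡ 1)
              (trans (cong (common k *_) (trans (cong (λ x → w x * w k ^ 1) (+-comm k 1)) (identity (w (suc k)) (w k)))) (sym (aboveʳ 1))))
      where
      identity : ∀ x y → x * (y * 1) ≡ y * (x * 1)
      identity = solve-∀
    ...   | suc (suc j) , refl = inj₂ (far , subst₂ _<_ (sym (aboveˡ _)) (sym (aboveʳ _)) (*-monoʳ-<′ (common k) (common>0 k) (above-< j d≤B)))
      where
      far : ¬ Near (k + suc (suc j))
      far (inj₁ eq) = contradiction (+-cancelˡ-≡ k _ 0 (trans eq (sym (+-identityʳ k)))) λ ()
      far (inj₂ eq) = contradiction (+-cancelˡ-≡ k _ 1 (trans eq (sym (+-comm k 1)))) λ ()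
    tangent-cases d d≤B | inj₂ d<k with m≤n⇒∃[o]m+o≡n d<k
    ...   | j , eq = inj₂ (far , subst₂ _<_ (sym (belowˡ (suc j) d d+≡k)) (sym (belowʳ (suc j) d d+≡k))
              (*-monoʳ-<′ (common d) (common>0 d) (below-< j d d+≡k)))
      where
      d+≡k : d + suc j ≡ k
      d+≡k = trans (+-suc d j) eq
      far : ¬ Near d
      far (inj₁ refl) = <-irrefl refl d<k
      far (inj₂ refl) = <-asym d<k (n<1+n k)

    module Degrees {N : ℕ} (deg : Fin N → ℕ) (deg≤B : ∀ v → deg v ≤ bound) (β γ : ℕ)
      (N≡ : N ≡ β + γ) (sum≡ : sum deg ≡ N * k + β) where

      optimum : ℕ
      optimum = w k ^ γ * w (suc k) ^ β

      private
        scale : ℕ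
        scale = w k ^ (N * k + β) * w (suc k) ^ (N * k)

        scale>0 : 0 < scale
        scale>0 = *->0 (^->0 (N * k + β) wk>0) (^->0 (N * k) wk+1>0)

        prodˡ : prod (tangentˡ ∘ deg) ≡ scale * prod (w ∘ deg)
        prodˡ = trans (prod-* (w ∘ deg) _) (trans (cong (prod (w ∘ deg) *_)
          (trans (prod-* (λ v → w k ^ deg v) (λ _ → w (suc k) ^ k))
            (cong₂ _*_ (trans (^-sum (w k) deg) (cong (w k ^_) sum≡))
              (trans (^-sum (w (suc k)) (λ (_ : Fin N) → k)) (cong (w (suc k) ^_) (sum-const N k))))))
          (*-comm (prod (w ∘ deg)) scale))

        prodʳ : prod (tangentʳ ∘ deg) ≡ scale * optimum
        prodʳ = begin
          prod (tangentʳ ∘ deg)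
            ≡⟨ prod-* (λ (_ : Fin N) → w k ^ suc k) (λ v → w (suc k) ^ deg v) ⟩
          prod {N} (λ _ → w k ^ suc k) * prod (λ v → w (suc k) ^ deg v)
            ≡⟨ cong₂ _*_ (trans (^-sum (w k) (λ (_ : Fin N) → suc k)) (cong (w k ^_) (trans (sum-const N (suc k)) N*)))
                 (trans (^-sum (w (suc k)) deg) (cong (w (suc k) ^_) sum≡)) ⟩
          w k ^ (N * k + β + γ) * w (suc k) ^ (N * k + β)
            ≡⟨ cong₂ _*_ (^-distribˡ-+-* (w k) (N * k + β) γ) (^-distribˡ-+-* (w (suc k)) (N * k) β) ⟩
          w k ^ (N * k + β) * w k ^ γ * (w (suc k) ^ (N * k) * w (suc k) ^ β)
            ≡⟨ identity (w k ^ (N * k + β)) (w k ^ γ) _ _ ⟩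
          scale * optimum ∎
          where
          open ≡-Reasoning
          identity : ∀ a b c d → a * b * (c * d) ≡ a * c * (b * d)
          identity = solve-∀
          N* : N * suc k ≡ N * k + β + γ
          N* = trans (*-suc N k) (trans (+-comm N (N * k)) (trans (cong (N * k +_) N≡) (sym (+-assoc (N * k) β γ))))

        tangent≤ : ∀ v → tangentˡ (deg v) ≤ tangentʳ (deg v)
        tangent≤ v with tangent-cases (deg v) (deg≤B v)
        ... | inj₁ (_ , eq) = ≤-reflexive eq
        ... | inj₂ (_ , lt) = <⇒≤ lt

      optimum>0 : 0 < optimum
      optimum>0 = *->0 (^->0 γ wk>0) (^->0 β wk+1>0)

      -- The bounding line is linear in d, so its product over all vertices depends on the degree
      -- sum alone; on both sides the common part is `scale`.
      prod-w≤optimum : prod (w ∘ deg) ≤ optimum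
      prod-w≤optimum = *-cancelˡ-≤′ scale scale>0 (subst₂ _≤_ prodˡ prodʳ (prod-≤ tangent≤))

      near⇒optimum : (∀ v → Near (deg v)) → prod (w ∘ deg) ≡ optimum
      near⇒optimum near = *-cancelˡ-≡′ scale scale>0 (trans (sym prodˡ) (trans (prod-cong tangent≡) prodʳ))
        where
        tangent≡ : ∀ v → tangentˡ (deg v) ≡ tangentʳ (deg v)
        tangent≡ v with tangent-cases (deg v) (deg≤B v)
        ... | inj₁ (_ , eq)  = eq
        ... | inj₂ (far , _) = contradiction (near v) far

      optimum⇒near : prod (w ∘ deg) ≡ optimum → ∀ v → Near (deg v)
      optimum⇒near eq v with tangent-cases (deg v) (deg≤B v)
      ... | inj₁ (near , _) = near
      ... | inj₂ (_ , lt)   = contradiction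
        (prod-squeeze tangent≤ (subst (0 <_) (sym prodʳ) (*->0 scale>0 optimum>0))
          (trans prodˡ (trans (cong (scale *_) eq) (sym prodʳ))) v)
        (<⇒≢ lt)

-- Almost regular degree sequences

-- `bound !` is a multiple of every positive d up to `bound`, so the root of order d becomes an
-- integral power. At d = 0 the law `w-^` reads 1 = 1.
rootWeight : ∀ bound → Weight bound
rootWeight bound = record
  { exponent = bound ! ; exponent>0 = 1≤n! bound ; w = w ; w-zero = refl ; w-^ = w-^ }
  where
  w : ℕ → ℕ
  w zero      = 0
  w d@(suc _) = (d !) ^ (bound ! / d)
  w-^ : ∀ d → d ≤ bound → w d ^ d ≡ (d !) ^ (bound !)
  w-^ zero      _     = sym (^-zeroˡ (bound !))
  w-^ d@(suc e) d≤b = trans (^-*-assoc (d !) (bound ! / d) d)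
    (cong ((d !) ^_) (m/n*n≡m (∣-trans (m∣m*n {d} (e !)) (m≤n⇒m!∣n! d≤b))))

restrict : ∀ {b b′} → b ≤ b′ → Weight b′ → Weight b
restrict b≤b′ weight = record
  { exponent = exponent ; exponent>0 = exponent>0 ; w = w ; w-zero = w-zero
  ; w-^ = λ d d≤b → w-^ d (≤-trans d≤b b≤b′) }
  where open Weight weight

sum-< : ∀ {n} {f g : Fin n → ℕ} → (∀ i → f i ≤ g i) → ∀ i → f i < g i → sum f < sum g
sum-< f≤g zero    f<g = +-mono-<-≤ f<g (sum-≤ (f≤g ∘ suc))
sum-< f≤g (suc i) f<g = +-mono-≤-< (f≤g zero) (sum-< (f≤g ∘ suc) i f<g)

module NearAverage {N} (d : Fin N → ℕ) (k β : ℕ) (β<N : β < N) (sum≡ : sum d ≡ N * k + β) where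

  Nearᵏ : Set
  Nearᵏ = ∀ v → d v ≡ k ⊎ d v ≡ suc k

  -- The average degree lies in the interval from k to k + 1, with k + 1 excluded. A degree below k
  -- would force all degrees to be at most k, one above k + 1 would force all to be at least k + 1;
  -- either contradicts the sum.
  almostRegular⇒near : (∀ u v → ∣ d u - d v ∣ ≤ 1) → Nearᵏ
  almostRegular⇒near reg v with <-cmp (d v) k
  ... | tri≈ _ dv≡k _ = inj₁ dv≡k
  ... | tri< dv<k _ _ = contradiction
    (≤-trans (≤-trans (m≤m+n (N * k) β) (≤-reflexive (sym sum≡))) (≤-reflexive (sym (+-identityʳ _))))
    (<⇒≱ (subst₂ _<_ (sym (+-identityʳ _)) (sum-const N k) (sum-< {f = d} {g = λ _ → k} ≤k v dv<k)))
    where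
    ≤k : ∀ u → d u ≤ k
    ≤k u = ≤-trans (m≤n+∣m-n∣ (d u) (d v)) (≤-trans (+-monoʳ-≤ (d v) (reg u v)) (≤-trans (≤-reflexive (+-comm (d v) 1)) dv<k))
  ... | tri> _ _ k<dv with m≤n⇒m<n∨m≡n k<dv
  ...   | inj₂ 1+k≡dv = inj₂ (sym 1+k≡dv)
  ...   | inj₁ 1+k<dv = contradiction sum≡ (≢-sym (<⇒≢ (<-trans average (sum-< {f = λ _ → suc k} {g = d} ≥1+k v 1+k<dv))))
    where
    ≥1+k : ∀ u → suc k ≤ d u
    ≥1+k u = s≤s⁻¹ (≤-trans 1+k<dv (≤-trans (m≤n+∣m-n∣ (d v) (d u)) (≤-trans (+-monoʳ-≤ (d u) (reg v u)) (≤-reflexive (+-comm (d u) 1)))))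
    average : N * k + β < sum {N} (λ _ → suc k)
    average = ≤-trans (+-monoʳ-< (N * k) β<N) (≤-reflexive (trans (+-comm (N * k) N) (trans (sym (*-suc N k)) (sym (sum-const N (suc k))))))

  near⇒almostRegular : Nearᵏ → ∀ u v → ∣ d u - d v ∣ ≤ 1
  near⇒almostRegular near u v with near u | near v
  ... | inj₁ eu | inj₁ ev rewrite eu | ev | ∣n-n∣≡0 k = z≤n
  ... | inj₂ eu | inj₂ ev rewrite eu | ev | ∣n-n∣≡0 k = z≤n
  ... | inj₁ eu | inj₂ ev rewrite eu | ev | m≤n⇒∣m-n∣≡n∸m (n≤1+n k) = ≤-reflexive (m+n∸n≡m 1 k)
  ... | inj₂ eu | inj₁ ev rewrite eu | ev | m≤n⇒∣n-m∣≡n∸m (n≤1+n k) = ≤-reflexive (m+n∸n≡m 1 k)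

  -- Were all degrees k + 1, their sum would be N k + N. This vertex later yields ℓ₁ ≥ 1.
  near⇒∃k : Nearᵏ → ∃[ v ] d v ≡ k
  near⇒∃k near with Fin.any? (λ v → d v ≟ k)
  ... | yes found = found
  ... | no ¬found  = contradiction
    (trans (sym sum≡) (trans (sum-cong-≗ λ v → [ (λ eq → contradiction (v , eq) ¬found) , id ]′ (near v)) (trans (sum-const N (suc k)) (trans (*-suc N k) (+-comm N (N * k))))))
    (<⇒≢ (+-monoʳ-< (N * k) β<N))

-- Radicals are compared through their L-th powers, for L a common multiple of their indices:
-- r ≃[ L ] x says that r ^ L is the natural number x.
_≃[_]_ : Radical → ℕ → ℕ → Set
root a p ≃[ L ] x = a ^ L ≡ x ^ p

module _ {L : ℕ} where

  ≃-· : ∀ {r s x y} → r ≃[ L ] x → s ≃[ L ] y → (r · s) ≃[ L ] (x * y)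
  ≃-· {root a p} {root b q} {x} {y} ≃x ≃y = begin
    (a ^ q * b ^ p) ^ L           ≡⟨ ^-distribʳ-* (a ^ q) (b ^ p) L ⟩
    (a ^ q) ^ L * (b ^ p) ^ L     ≡⟨ cong₂ _*_ (^-comm a q L) (^-comm b p L) ⟩
    (a ^ L) ^ q * (b ^ L) ^ p     ≡⟨ cong₂ (λ u v → u ^ q * v ^ p) ≃x ≃y ⟩
    (x ^ p) ^ q * (y ^ q) ^ p     ≡⟨ cong₂ _*_ (^-*-assoc x p q) (trans (^-*-assoc y q p) (cong (y ^_) (*-comm q p))) ⟩
    x ^ (p * q) * y ^ (p * q)     ≡⟨ ^-distribʳ-* x y (p * q) ⟨
    (x * y) ^ (p * q)             ∎
    where open ≡-Reasoning

  ≃-∏ : ∀ {n} {A : Set} (f : A → Radical) (x : A → ℕ) → (∀ a → f a ≃[ L ] x a) → (g : Fin n → A) →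
    ∏ (map f (tabulate g)) ≃[ L ] prod (x ∘ g)
  ≃-∏ {zero}  f x f≃x g = trans (^-zeroˡ L) (sym (^-zeroˡ 1))
  ≃-∏ {suc n} f x f≃x g = ≃-· {f (g zero)} {∏ (map f (tabulate (g ∘ suc)))} (f≃x (g zero)) (≃-∏ f x f≃x (g ∘ suc))

  ≃-⌜⌝ : ∀ a → ⌜ a ⌝ ≃[ L ] (a ^ L)
  ≃-⌜⌝ a = sym (*-identityʳ (a ^ L))

  ≃-÷ : ∀ a e q x → 0 < q → (a ^ e) ^ L ≡ x ^ q → (a ^ e ÷ q) ≃[ L ] x
  ≃-÷ a e (suc q) x _ eq = eq

  module _ (0<L : 0 < L) where

    ≃-cross : ∀ {r s x y} → r ≃[ L ] x → s ≃[ L ] y →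
      (Radical.radicand r ^ Radical.index s) ^ L ≡ x ^ (Radical.index r * Radical.index s)
    ≃-cross {root a p} {root b q} {x} ≃x _ = trans (^-comm a q L) (trans (cong (_^ q) ≃x) (^-*-assoc x p q))

    index>0 : ∀ r → 0 < Radical.index r
    index>0 (root a p) = >-nonZero⁻¹ p

    ≃⇒≤ᴿ : ∀ {r s x y} → r ≃[ L ] x → s ≃[ L ] y → x ≤ y → r ≤ᴿ s
    ≃⇒≤ᴿ {r@(root a p)} {s@(root b q)} {x} {y} ≃x ≃y x≤y = ^-cancelʳ-≤ L 0<L
      (subst₂ _≤_ (sym (≃-cross {r} {s} {x} {y} ≃x ≃y)) (sym (trans (≃-cross {s} {r} {y} {x} ≃y ≃x) (cong (y ^_) (*-comm q p))))
        (^-monoˡ-≤ (p * q) x≤y))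

    ≃⇒≈ᴿ : ∀ {r s x y} → r ≃[ L ] x → s ≃[ L ] y → x ≡ y → r ≈ᴿ s
    ≃⇒≈ᴿ {r@(root a p)} {s@(root b q)} {x} ≃x ≃y refl = ^-cancelʳ-≡ L 0<L
      (trans (≃-cross {r} {s} {x} {x} ≃x ≃y) (sym (trans (≃-cross {s} {r} {x} {x} ≃y ≃x) (cong (x ^_) (*-comm q p)))))

    ≈ᴿ⇒≡ : ∀ {r s x y} → r ≃[ L ] x → s ≃[ L ] y → r ≈ᴿ s → x ≡ y
    ≈ᴿ⇒≡ {r@(root a p)} {s@(root b q)} {x} {y} ≃x ≃y eq = ^-cancelʳ-≡ (p * q) (*->0 (index>0 r) (index>0 s))
      (trans (sym (≃-cross {r} {s} {x} {y} ≃x ≃y)) (trans (cong (_^ L) eq)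
        (trans (≃-cross {s} {r} {y} {x} ≃y ≃x) (cong (y ^_) (*-comm q p)))))

module _ {bound : ℕ} (weight : Weight bound) where
  open Weight weight

  !-root-≃ : ∀ d → d ≤ bound → ((d !) ^ 1 ÷ (2 * d)) ≃[ 2 * exponent ] w d
  -- An isolated vertex: the radical is `⌜ 0 ⌝` by convention, and `w 0` is 0 too.
  !-root-≃ zero      _     = trans (0^>0 (*->0 {2} z<s exponent>0)) (cong (_* 1) (sym w-zero))
  !-root-≃ d@(suc e) d≤b = ≃-÷ {2 * exponent} (d !) 1 (2 * d) (w d) z<s (begin
    ((d !) ^ 1) ^ (2 * exponent)  ≡⟨ cong (_^ (2 * exponent)) (*-identityʳ (d !)) ⟩
    (d !) ^ (2 * exponent)        ≡⟨ cong ((d !) ^_) (*-comm 2 exponent) ⟩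
    (d !) ^ (exponent * 2)        ≡⟨ ^-*-assoc (d !) exponent 2 ⟨
    ((d !) ^ exponent) ^ 2        ≡⟨ cong (_^ 2) (w-^ d d≤b) ⟨
    (w d ^ d) ^ 2                 ≡⟨ ^-*-assoc (w d) d 2 ⟩
    w d ^ (d * 2)                 ≡⟨ cong (w d ^_) (*-comm d 2) ⟩
    w d ^ (2 * d)                 ∎)
    where open ≡-Reasoning

  !-power-≃ : ∀ d e → 0 < d → d ≤ bound → ((d !) ^ e ÷ d) ≃[ 2 * exponent ] (w d ^ (2 * e))
  !-power-≃ d e 0<d d≤b = ≃-÷ {2 * exponent} (d !) e d (w d ^ (2 * e)) 0<d (begin
    ((d !) ^ e) ^ (2 * exponent)       ≡⟨ ^-*-assoc (d !) e (2 * exponent) ⟩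
    (d !) ^ (e * (2 * exponent))       ≡⟨ cong ((d !) ^_) (identity e exponent) ⟩
    (d !) ^ (exponent * (2 * e))       ≡⟨ ^-*-assoc (d !) exponent (2 * e) ⟨
    ((d !) ^ exponent) ^ (2 * e)       ≡⟨ cong (_^ (2 * e)) (w-^ d d≤b) ⟨
    (w d ^ d) ^ (2 * e)                ≡⟨ ^-comm (w d) d (2 * e) ⟩
    (w d ^ (2 * e)) ^ d                ∎)
    where
    open ≡-Reasoning
    identity : ∀ e x → e * (2 * x) ≡ x * (2 * e)
    identity = solve-∀

-- Floor, ceiling and the powers of ω

[q*n+r]/n≡q : ∀ q n r .{{_ : NonZero n}} → r < n → (q * n + r) / n ≡ q
[q*n+r]/n≡q q n r r<n = trans (+-distrib-/-∣ˡ r (n∣m*n q)) (trans (cong₂ _+_ (m*n/n≡m q n) (m<n⇒m/n≡0 r<n)) (+-identityʳ q))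

module Quotient (m n : ℕ) .{{_ : NonZero n}} (n≤m : n ≤ m) where

  k α : ℕ
  k = m / n
  α = m ∸ n * k

  0<k : 0 < k
  0<k = m≥n⇒m/n>0 n≤m

  α≡ : α ≡ m % n
  α≡ = trans (cong (_∸ n * k) (trans (m≡m%n+[m/n]*n m n) (cong (m % n +_) (*-comm k n)))) (m+n∸n≡m (m % n) (n * k))

  m≡ : m ≡ n * k + α
  m≡ = trans (m≡m%n+[m/n]*n m n) (trans (cong₂ _+_ (sym α≡) (*-comm k n)) (+-comm α (n * k)))

  α<n : α < n
  α<n = subst (_< n) (sym α≡) (m%n<n m n)

  -- When n divides m, the ceiling is k and not k + 1, but then the second factor of `ω` has
  -- exponent α = 0. So `ω-≃` can use k + 1 in both cases.
  ceiling : (0 < α × ⌈ m / n ⌉ ≡ suc k) ⊎ (α ≡ 0 × ⌈ m / n ⌉ ≡ k)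
  ceiling = go n m α m≡ α<n
    where
    go : ∀ n′ m′ α′ .{{_ : NonZero n′}} → m′ ≡ n′ * k + α′ → α′ < n′ →
      (0 < α′ × ⌈ m′ / n′ ⌉ ≡ suc k) ⊎ (α′ ≡ 0 × ⌈ m′ / n′ ⌉ ≡ k)
    go n′@(suc n₋) m′ zero     refl _    = inj₂ (refl , trans (cong (_/ n′) (identity n′ k n₋)) ([q*n+r]/n≡q k n′ n₋ ≤-refl))
      where
      identity : ∀ n k x → n * k + 0 + x ≡ k * n + x
      identity = solve-∀
    go n′@(suc n₋) m′ (suc α₋) refl α′<n = inj₁ (z<s , trans (cong (_/ n′) (identity n₋ k α₋)) ([q*n+r]/n≡q (suc k) n′ α₋ (<⇒≤ α′<n)))
      where
      identity : ∀ n k x → suc n * k + suc x + n ≡ suc k * suc n + x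
      identity = solve-∀

  module _ {bound} (weight : Weight bound) (k<B : suc k ≤ bound) where
    open Weight weight

    ω-≃ : ω n m ≃[ 2 * exponent ] (w k ^ (2 * (n ∸ α)) * w (suc k) ^ (2 * α))
    ω-≃ = ≃-· {2 * exponent} {(k !) ^ (n ∸ α) ÷ k} {(⌈ m / n ⌉ !) ^ α ÷ ⌈ m / n ⌉}
      (!-power-≃ weight k (n ∸ α) 0<k (<⇒≤ k<B)) ceil-≃
      where
      ceil-≃ : ((⌈ m / n ⌉ !) ^ α ÷ ⌈ m / n ⌉) ≃[ 2 * exponent ] (w (suc k) ^ (2 * α))
      ceil-≃ with ceiling
      ... | inj₁ (_ , eq) rewrite eq = !-power-≃ weight (suc k) α z<s k<B
      ... | inj₂ (α≡0 , eq) rewrite eq | α≡0 = !-power-≃ weight k 0 0<k (<⇒≤ k<B)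

-- Upper bounds for a single graph and their equality cases

module Extremal (m n : ℕ) .{{_ : NonZero n}} (n≤m : n ≤ m) (weight : Weight (2 * n + suc m)) where
  open Quotient m n n≤m public

  N bound : ℕ
  N = 2 * n
  -- Large enough for every degree, which is at most N, and for k + 1, which is at most m + 1.
  bound = N + suc m

  weightᴺ : Weight N
  weightᴺ = restrict (m≤m+n N (suc m)) weight

  open Weight weight public using (exponent; exponent>0; w)

  k≤m : k ≤ m
  k≤m = ≤-trans (m≤n*m k n) (≤-trans (m≤m+n (n * k) α) (≤-reflexive (sym m≡)))

  k<bound : suc k ≤ bound
  k<bound = ≤-trans (s≤s k≤m) (m≤n+m (suc m) N)

  L : ℕ
  L = 2 * exponent

  L>0 : 0 < L
  L>0 = *->0 {2} z<s exponent>0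

  optimum : ℕ
  optimum = w k ^ (2 * (n ∸ α)) * w (suc k) ^ (2 * α)

  ω-optimum : ω n m ≃[ L ] optimum
  ω-optimum = ω-≃ weight k<bound

  N≡ : N ≡ 2 * α + 2 * (n ∸ α)
  N≡ = trans (cong (2 *_) (sym (m+[n∸m]≡n (<⇒≤ α<n)))) (*-distribˡ-+ 2 α (n ∸ α))

  2α<N : 2 * α < N
  2α<N = *-monoʳ-< 2 α<n

  module InClass (G : Graph (Fin N)) (G∈ : G ∈ 𝒢 N m) where

    P : Radical
    P = ∏ (map (λ v → (deg G v !) ^ 1 ÷ (2 * deg G v)) (allFin N))

    deg≤N : ∀ v → deg G v ≤ N
    deg≤N v = subst (_≤ N) (sym (deg≡degIn G v)) (degIn≤ (adj G) all v)

    deg≤bound : ∀ v → deg G v ≤ bound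
    deg≤bound v = ≤-trans (deg≤N v) (m≤m+n N (suc m))

    product : ℕ
    product = prod (w ∘ deg G)

    P-≃ : P ≃[ L ] product
    P-≃ = ≃-∏ {L} _ (w ∘ deg G) (λ v → !-root-≃ weight (deg G v) (deg≤bound v)) id

    sum-deg : sum (deg G) ≡ N * k + 2 * α
    sum-deg = trans (handshake G) (trans (cong (2 *_) (trans G∈ m≡)) (identity n k α))
      where
      identity : ∀ n k α → 2 * (n * k + α) ≡ 2 * n * k + 2 * α
      identity = solve-∀

    open LogConcave.Tangent weight k 0<k k<bound
    open Degrees (deg G) deg≤bound (2 * α) (2 * (n ∸ α)) N≡ sum-deg public
      using (optimum>0; prod-w≤optimum; near⇒optimum; optimum⇒near)
    open NearAverage (deg G) k (2 * α) 2α<N sum-deg public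

    part₁ : (P ≤ᴿ ω n m) × (P ≈ᴿ ω n m ⇔ AlmostRegular G)
    part₁ = ≃⇒≤ᴿ L>0 {P} {ω n m} P-≃ ω-optimum prod-w≤optimum , mk⇔
      (λ eq → near⇒almostRegular (optimum⇒near (≈ᴿ⇒≡ L>0 {P} {ω n m} P-≃ ω-optimum eq)))
      (λ reg → ≃⇒≈ᴿ L>0 {P} {ω n m} P-≃ ω-optimum (near⇒optimum (almostRegular⇒near reg)))

    open KahnLovasz G weightᴺ

    perfmat^≤optimum : perfmat G ^ L ≤ optimum
    perfmat^≤optimum = ≤-trans kahn-lovász prod-w≤optimum

    -- The degree product lies between the two sides, so equality splits into tightness of the
    -- Kahn-Lovász bound and of the degree bound; the number of matchings is positive because the
    -- optimum is.
    attained⇒balanced×near : perfmat G ^ L ≡ optimum → Balanced G × Nearᵏ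
    attained⇒balanced×near eq =
      tight⇒balanced 0<perfmat (≤-antisym kahn-lovász (≤-trans prod-w≤optimum (≤-reflexive (sym eq)))) ,
      optimum⇒near (≤-antisym prod-w≤optimum (≤-trans (≤-reflexive (sym eq)) kahn-lovász))
      where
      0<perfmat : 0 < perfmat G
      0<perfmat with ≡0⊎>0 (perfmat G)
      ... | inj₂ 0<pm = 0<pm
      ... | inj₁ pm≡0 = contradiction (trans (sym eq) (trans (cong (_^ L) pm≡0) (0^>0 L>0))) (≢-sym (<⇒≢ optimum>0))

    balanced×near⇒attained : Balanced G → Nearᵏ → perfmat G ^ L ≡ optimum
    balanced×near⇒attained bal near = trans (balanced⇒tight bal) (near⇒optimum near)

-- A balanced graph is a disjoint union of balanced complete bipartite graphs

record Enumeration {N} (d : ℕ) (P : Fin N → Bool) : Set where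
  field
    at        : Fin d → Fin N
    injective : ∀ {i j} → at i ≡ at j → i ≡ j
    image     : ∀ i → P (at i) ≡ true
    onto      : ∀ v → P v ≡ true → ∃[ i ] at i ≡ v

enumerate : ∀ {N} (P : Fin N → Bool) → Enumeration (count P) P
enumerate {zero}  P = record { at = λ () ; injective = λ { {()} } ; image = λ () ; onto = λ () }
enumerate {suc N} P with P zero in P₀
... | true  = record { at = at′ ; injective = injective′ _ _ ; image = image′ ; onto = onto′ }
  where
  open Enumeration (enumerate (P ∘ suc))
  at′ : Fin (suc (count (P ∘ suc))) → Fin (suc N)
  at′ zero    = zero
  at′ (suc i) = suc (at i)
  injective′ : ∀ i j → at′ i ≡ at′ j → i ≡ j
  injective′ zero    zero    _  = refl
  injective′ (suc i) (suc j) eq = cong suc (injective (Fin.suc-injective eq))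
  image′ : ∀ i → P (at′ i) ≡ true
  image′ zero    = P₀
  image′ (suc i) = image i
  onto′ : ∀ v → P v ≡ true → ∃[ i ] at′ i ≡ v
  onto′ zero    _  = zero , refl
  onto′ (suc v) Pv with onto v Pv
  ... | i , eq = suc i , cong suc eq
... | false = record { at = suc ∘ at ; injective = injective ∘ Fin.suc-injective ; image = image ; onto = onto′ }
  where
  open Enumeration (enumerate (P ∘ suc))
  onto′ : ∀ v → P v ≡ true → ∃[ i ] suc (at i) ≡ v
  onto′ zero    Pv = contradiction (trans (sym Pv) P₀) λ ()
  onto′ (suc v) Pv with onto v Pv
  ... | i , eq = i , cong suc eq

enumeration-≤ : ∀ {N d d′} {P : Fin N → Bool} → Enumeration d P → Enumeration d′ P → d ≤ d′
enumeration-≤ E F = Fin.injective⇒≤ {f = index} λ {i} {j} eq → E.injective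
  (trans (sym (proj₂ (F.onto (E.at i) (E.image i)))) (trans (cong F.at eq) (proj₂ (F.onto (E.at j) (E.image j)))))
  where
  module E = Enumeration E
  module F = Enumeration F
  index : Fin _ → Fin _
  index i = proj₁ (F.onto (E.at i) (E.image i))

enumeration⇒count : ∀ {N d} {P : Fin N → Bool} → Enumeration d P → count P ≡ d
enumeration⇒count {P = P} E = ≤-antisym (enumeration-≤ (enumerate P) E) (enumeration-≤ E (enumerate P))

deg≡count : ∀ {N} (G : Graph (Fin N)) v → deg G v ≡ count (adj G v)
deg≡count G v = trans (deg≡degIn G v) (sum-cong-≗ λ u → *-identityʳ (χ (adj G v u)))

-- An isomorphism from H to the subgraph of G induced by S. Keeping S as a predicate on Fin N allows
-- pieces to be glued along disjoint sets without renumbering vertices.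
record Embedding {V : Set} (H : Graph V) {N} (G : Graph (Fin N)) (S : Fin N → Bool) : Set where
  field
    to        : V → Fin N
    injective : ∀ {x y} → to x ≡ to y → x ≡ y
    image     : ∀ x → S (to x) ≡ true
    onto      : ∀ v → S v ≡ true → ∃[ x ] to x ≡ v
    preserves : ∀ x y → Adj H x y ⇔ Adj G (to x) (to y)

module _ {N} {G : Graph (Fin N)} where

  embedding-cong : ∀ {V} {H : Graph V} {S T} → (∀ v → S v ≡ T v) → Embedding H G S → Embedding H G T
  embedding-cong S≗T E = record
    { to = to ; injective = injective ; image = λ x → trans (sym (S≗T (to x))) (image x)
    ; onto = λ v Tv → onto v (trans (S≗T v) Tv) ; preserves = preserves }
    where open Embedding E

  embedding-≅ : ∀ {V W} {H : Graph V} {H′ : Graph W} {S} → H′ ≅ H → Embedding H G S → Embedding H′ G S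
  embedding-≅ H′≅H E = record
    { to        = to ∘ f.to
    ; injective = λ {x} {y} eq → trans (sym (f.strictlyInverseʳ x)) (trans (cong f.from (injective eq)) (f.strictlyInverseʳ y))
    ; image     = image ∘ f.to
    ; onto      = λ v Sv → let x , eq = onto v Sv in f.from x , trans (cong to (f.strictlyInverseˡ x)) eq
    ; preserves = λ x y → mk⇔
        (Equivalence.to (preserves _ _) ∘ Equivalence.to (_≅_.preserves H′≅H x y))
        (Equivalence.from (_≅_.preserves H′≅H x y) ∘ Equivalence.from (preserves _ _))
    }
    where
    open Embedding E
    module f = Inverse (_≅_.bijection H′≅H)

  embedding-all : ∀ {V} {H : Graph V} → Embedding H G all → G ≅ H
  embedding-all {H = H} E = record
    { bijection = mk↔ₛ′ inv to inv-to to-inv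
    ; preserves = λ u v → mk⇔
        (λ e → Equivalence.from (preserves _ _) (subst₂ (Adj G) (sym (to-inv u)) (sym (to-inv v)) e))
        (λ e → subst₂ (Adj G) (to-inv u) (to-inv v) (Equivalence.to (preserves _ _) e))
    }
    where
    open Embedding E
    inv : Fin N → _
    inv v = proj₁ (onto v refl)
    to-inv : ∀ v → to (inv v) ≡ v
    to-inv v = proj₂ (onto v refl)
    inv-to : ∀ x → inv (to x) ≡ x
    inv-to x = injective (to-inv (to x))

  embedding-⊍ : ∀ {V W} {H : Graph V} {H′ : Graph W} {S T} →
    (∀ {u v} → S u ≡ true → T v ≡ true → u ≢ v × ¬ Adj G u v) →
    Embedding H G S → Embedding H′ G T → Embedding (H ⊍ H′) G (λ v → S v ∨ T v)
  embedding-⊍ {V} {W} {H} {H′} {S} {T} apart E F = record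
    { to = to ; injective = λ {x} {y} → injective x y ; image = image ; onto = onto ; preserves = preserves }
    where
    module E = Embedding E
    module F = Embedding F
    to : V ⊎ W → Fin N
    to = [ E.to , F.to ]′
    injective : ∀ x y → to x ≡ to y → x ≡ y
    injective (inj₁ x) (inj₁ y) eq = cong inj₁ (E.injective eq)
    injective (inj₁ x) (inj₂ y) eq = contradiction eq (proj₁ (apart (E.image x) (F.image y)))
    injective (inj₂ x) (inj₁ y) eq = contradiction (sym eq) (proj₁ (apart (E.image y) (F.image x)))
    injective (inj₂ x) (inj₂ y) eq = cong inj₂ (F.injective eq)
    image : ∀ x → S (to x) ∨ T (to x) ≡ true
    image (inj₁ x) rewrite E.image x = refl
    image (inj₂ x) rewrite F.image x = Bool.∨-zeroʳ _
    onto : ∀ v → S v ∨ T v ≡ true → ∃[ x ] to x ≡ v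
    onto v STv with S v in Sv
    ... | true  = let x , eq = E.onto v Sv in inj₁ x , eq
    ... | false = let x , eq = F.onto v STv in inj₂ x , eq
    preserves : ∀ x y → Adj (H ⊍ H′) x y ⇔ Adj G (to x) (to y)
    preserves (inj₁ x) (inj₁ y) = mk⇔ (λ { (⊎.inj₁ e) → Equivalence.to (E.preserves x y) e }) (⊎.inj₁ ∘ Equivalence.from (E.preserves x y))
    preserves (inj₁ x) (inj₂ y) = mk⇔ (λ ()) λ e → contradiction e (proj₂ (apart (E.image x) (F.image y)))
    preserves (inj₂ x) (inj₁ y) = mk⇔ (λ ()) λ e → contradiction (symm G e) (proj₂ (apart (E.image y) (F.image x)))
    preserves (inj₂ x) (inj₂ y) = mk⇔ (λ { (⊎.inj₂ e) → Equivalence.to (F.preserves x y) e }) (⊎.inj₂ ∘ Equivalence.from (F.preserves x y))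

suc-copies : ∀ {V} ℓ (H : Graph V) → suc ℓ copies H ≅ (H ⊍ ℓ copies H)
suc-copies {V} ℓ H = record { bijection = mk↔ₛ′ to from to-from from-to ; preserves = preserves }
  where
  to : Fin (suc ℓ) × V → V ⊎ (Fin ℓ × V)
  to (zero  , v) = inj₁ v
  to (suc i , v) = inj₂ (i , v)
  from : V ⊎ (Fin ℓ × V) → Fin (suc ℓ) × V
  from (inj₁ v)       = zero , v
  from (inj₂ (i , v)) = suc i , v
  to-from : ∀ x → to (from x) ≡ x
  to-from (inj₁ v)       = refl
  to-from (inj₂ (i , v)) = refl
  from-to : ∀ x → from (to x) ≡ x
  from-to (zero  , v) = refl
  from-to (suc i , v) = refl
  preserves : ∀ x y → Adj (suc ℓ copies H) x y ⇔ Adj (H ⊍ ℓ copies H) (to x) (to y)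
  preserves (zero  , u) (zero  , v) = mk⇔ (λ (_ , e) → ⊎.inj₁ e) λ { (⊎.inj₁ e) → refl , e }
  preserves (zero  , u) (suc j , v) = mk⇔ (λ { (() , _) }) λ ()
  preserves (suc i , u) (zero  , v) = mk⇔ (λ { (() , _) }) λ ()
  preserves (suc i , u) (suc j , v) = mk⇔ (λ (i≡j , e) → ⊎.inj₂ (Fin.suc-injective i≡j , e)) λ { (⊎.inj₂ (refl , e)) → refl , e }

module Decompose {N} (G : Graph (Fin N)) (bal : Balanced G) where
  open Balanced bal

  Closed : (Fin N → Bool) → Set
  Closed S = ∀ {u v} → S u ≡ true → adj G u v ≡ true → S v ≡ true

  flip : ∀ {u v} → adj G u v ≡ true → adj G v u ≡ true
  flip {u} {v} uv = trans (adj-sym G v u) uv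

  loop : ∀ {v} → adj G v v ≡ true → ⊥
  loop {v} vv = contradiction (trans (sym vv) (adj-irrefl G v)) λ ()

  module Component (d : ℕ) (a b : Fin N) (ab : adj G a b ≡ true) (deg-a : deg G a ≡ d) where

    component : Fin N → Bool
    component v = adj G b v ∨ adj G a v

    from-component : ∀ {v} → component v ≡ true → adj G b v ≡ true ⊎ adj G a v ≡ true
    from-component {v} cv with adj G b v
    ... | true  = inj₁ refl
    ... | false = inj₂ cv

    side-b : ∀ {v} → adj G b v ≡ true → component v ≡ true
    side-b bv rewrite bv = refl

    side-a : ∀ {v} → adj G a v ≡ true → component v ≡ true
    side-a {v} av rewrite av = Bool.∨-zeroʳ (adj G b v)

    ba : adj G b a ≡ true
    ba = flip ab

    closed : Closed component
    closed {u} {v} cu uv with from-component cu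
    ... | inj₁ bu = side-a (exchange a b u v ab (flip bu) uv)
    ... | inj₂ au = side-b (exchange b a u v ba (flip au) uv)

    -- The two sides of the component are N(b) ∋ a and N(a) ∋ b.
    sides : ∀ {v} → adj G b v ≡ true → adj G a v ≡ true → ⊥
    sides {v} bv av = loop (exchange a b v a ab (flip bv) (flip av))

    left : Enumeration d (adj G b)
    left = subst (λ d → Enumeration d (adj G b)) (trans (sym (deg≡count G b)) (trans (regular b a ba) deg-a)) (enumerate (adj G b))

    right : Enumeration d (adj G a)
    right = subst (λ d → Enumeration d (adj G a)) (trans (sym (deg≡count G a)) deg-a) (enumerate (adj G a))

    embedding : Embedding (K d d) G component
    embedding = record { to = to ; injective = λ {x} {y} → injective x y ; image = image ; onto = onto ; preserves = preserves }
      where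
      module E = Enumeration left
      module F = Enumeration right
      to : Fin d ⊎ Fin d → Fin N
      to = [ E.at , F.at ]′
      injective : ∀ x y → to x ≡ to y → x ≡ y
      injective (inj₁ i) (inj₁ j) eq = cong inj₁ (E.injective eq)
      injective (inj₁ i) (inj₂ j) eq = ⊥-elim (sides (E.image i) (subst (λ v → adj G a v ≡ true) (sym eq) (F.image j)))
      injective (inj₂ i) (inj₁ j) eq = ⊥-elim (sides (E.image j) (subst (λ v → adj G a v ≡ true) eq (F.image i)))
      injective (inj₂ i) (inj₂ j) eq = cong inj₂ (F.injective eq)
      image : ∀ x → component (to x) ≡ true
      image (inj₁ i) = side-b (E.image i)
      image (inj₂ i) = side-a (F.image i)
      onto : ∀ v → component v ≡ true → ∃[ x ] to x ≡ v
      onto v cv with from-component cv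
      ... | inj₁ bv = let i , eq = E.onto v bv in inj₁ i , eq
      ... | inj₂ av = let i , eq = F.onto v av in inj₂ i , eq
      independent : ∀ {c x y} → adj G c x ≡ true → adj G c y ≡ true → ¬ Adj G x y
      independent {c} {x} {y} cx cy xy = loop (exchange c y x c cy (Adj⇒adj G xy) (flip cx))
      complete : ∀ {x y} → adj G b x ≡ true → adj G a y ≡ true → Adj G x y
      complete {x} {y} bx ay = adj⇒Adj G (exchange x b a y (flip bx) ab ay)
      preserves : ∀ x y → Adj (K d d) x y ⇔ Adj G (to x) (to y)
      preserves (inj₁ i) (inj₁ j) = mk⇔ (λ ()) λ e → independent (E.image i) (E.image j) e
      preserves (inj₁ i) (inj₂ j) = mk⇔ (λ _ → complete (E.image i) (F.image j)) (λ _ → tt)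
      preserves (inj₂ i) (inj₁ j) = mk⇔ (λ _ → symm G (complete (E.image j) (F.image i))) (λ _ → tt)
      preserves (inj₂ i) (inj₂ j) = mk⇔ (λ ()) λ e → independent (F.image i) (F.image j) e

  -- As d is positive, a vertex of S has a neighbour, and the component of that edge is peeled off.
  -- Closedness keeps the component inside S and leaves no edges between it and the rest.
  decompose : ∀ d → 0 < d → ∀ k S → count S ≤ k → Closed S → (∀ v → S v ≡ true → deg G v ≡ d) →
    ∃[ ℓ ] Embedding (ℓ copies K d d) G S
  decompose d 0<d k S S≤k closed S-deg with ∅⊎∋ S
  decompose d 0<d k S S≤k closed S-deg | inj₁ S∅ = 0 , record
    { to = λ { (() , _) } ; injective = λ { {() , _} } ; image = λ { (() , _) }
    ; onto = λ v Sv → contradiction (trans (sym Sv) (S∅ v)) λ () ; preserves = λ { (() , _) } }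
  decompose d 0<d zero S S≤k closed S-deg | inj₂ (a , Sa) = contradiction (trans (sym Sa) (count≡0⇒∅ S (n≤0⇒n≡0 S≤k) a)) λ ()
  decompose d 0<d (suc k) S S≤k closed S-deg | inj₂ (a , Sa)
    with sum>0⇒∃ (χ ∘ adj G a) (subst (0 <_) (trans (sym (S-deg a Sa)) (deg≡count G a)) 0<d)
  ... | b , 0<ab = suc (proj₁ rest) , embedding-≅ (suc-copies (proj₁ rest) (K d d))
          (embedding-cong cover (embedding-⊍ apart embedding (proj₂ rest)))
    where
    ab : adj G a b ≡ true
    ab = χ>0⇒true 0<ab
    open Component d a b ab (S-deg a Sa) renaming (closed to component-closed)
    S′ : Fin N → Bool
    S′ v = S v ∧ not (component v)
    S′⁻ : ∀ {v} → S′ v ≡ true → S v ≡ true × component v ≡ false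
    S′⁻ {v} S′v with S v | component v
    ... | true | false = refl , refl
    component⊆S : ∀ {v} → component v ≡ true → S v ≡ true
    component⊆S cv with from-component cv
    ... | inj₁ bv = closed (closed Sa ab) bv
    ... | inj₂ av = closed Sa av
    avoids : ∀ {u v} → component u ≡ true → S′ v ≡ true → adj G u v ≡ true → ⊥
    avoids cu S′v uv = contradiction (trans (sym (component-closed cu uv)) (proj₂ (S′⁻ S′v))) λ ()
    closed′ : Closed S′
    closed′ {u} {v} S′u uv with component v in cv
    ... | true  = ⊥-elim (avoids cv S′u (flip uv))
    ... | false rewrite closed (proj₁ (S′⁻ S′u)) uv = refl
    apart : ∀ {u v} → component u ≡ true → S′ v ≡ true → u ≢ v × ¬ Adj G u v
    apart cu S′v = (λ { refl → contradiction (trans (sym cu) (proj₂ (S′⁻ S′v))) λ () }) , avoids cu S′v ∘ Adj⇒adj G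
    -- a lies in its own component, being a neighbour of b, so the set really shrinks.
    S′≤S⊖a : ∀ v → χ (S′ v) ≤ χ ((S ⊖ a) v)
    S′≤S⊖a v with v Fin.≟ a
    ... | yes refl rewrite side-b ba | Bool.∧-zeroʳ (S v) = z≤n
    ... | no _     with S v | component v
    ...   | true  | true  = z≤n
    ...   | true  | false = ≤-refl
    ...   | false | _     = z≤n
    S′≤k : count S′ ≤ k
    S′≤k = ≤-trans (sum-≤ S′≤S⊖a) (s≤s⁻¹ (≤-trans (≤-reflexive (count-⊖ S a Sa)) S≤k))
    rest : ∃[ ℓ ] Embedding (ℓ copies K d d) G S′
    rest = decompose d 0<d k S′ S′≤k closed′ λ v S′v → S-deg v (proj₁ (S′⁻ S′v))
    cover : ∀ v → component v ∨ S′ v ≡ S v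
    cover v with component v in cv
    ... | true  = sym (component⊆S cv)
    ... | false = Bool.∧-identityʳ (S v)

  hasDegree : ℕ → Fin N → Bool
  hasDegree d v = does (deg G v ≟ d)

  hasDegree⁻ : ∀ d v → hasDegree d v ≡ true → deg G v ≡ d
  hasDegree⁻ d v eq = ≡ᵇ⇒≡ (deg G v) d (subst T (sym eq) tt)

  hasDegree⁺ : ∀ d v → deg G v ≡ d → hasDegree d v ≡ true
  hasDegree⁺ d v = dec-true (deg G v ≟ d)

  hasDegree-closed : ∀ d → Closed (hasDegree d)
  hasDegree-closed d {u} {v} du uv = hasDegree⁺ d v (trans (sym (regular u v uv)) (hasDegree⁻ d u du))

  -- Adjacent vertices have equal degrees, so the two degree classes are unions of components and
  -- can be decomposed separately.
  balanced⇒union : ∀ k → 0 < k → (∀ v → deg G v ≡ k ⊎ deg G v ≡ suc k) → ∃[ v ] deg G v ≡ k →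
    ∃[ ℓ₁ ] ∃[ ℓ₂ ] ℓ₁ ≥ 1 × G ≅ BalancedUnion k ℓ₁ ℓ₂
  balanced⇒union k 0<k near (v₀ , v₀-deg) = proj₁ part-k , proj₁ part-k+1 , nonempty (proj₂ part-k) ,
    embedding-all (embedding-cong cover (embedding-⊍ apart (proj₂ part-k) (proj₂ part-k+1)))
    where
    part-k : ∃[ ℓ ] Embedding (ℓ copies K k k) G (hasDegree k)
    part-k = decompose k 0<k _ (hasDegree k) ≤-refl (hasDegree-closed k) (hasDegree⁻ k)
    part-k+1 : ∃[ ℓ ] Embedding (ℓ copies K (suc k) (suc k)) G (hasDegree (suc k))
    part-k+1 = decompose (suc k) z<s _ (hasDegree (suc k)) ≤-refl (hasDegree-closed (suc k)) (hasDegree⁻ (suc k))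
    nonempty : ∀ {ℓ} → Embedding (ℓ copies K k k) G (hasDegree k) → ℓ ≥ 1
    nonempty {zero}  E with Embedding.onto E v₀ (hasDegree⁺ k v₀ v₀-deg)
    ... | (() , _) , _
    nonempty {suc ℓ} E = z<s
    apart : ∀ {u v} → hasDegree k u ≡ true → hasDegree (suc k) v ≡ true → u ≢ v × ¬ Adj G u v
    apart {u} {v} uk vk+1 =
      (λ { refl → contradiction (trans (sym (hasDegree⁻ k u uk)) (hasDegree⁻ (suc k) u vk+1)) (<⇒≢ (n<1+n k)) }) ,
      (λ e → contradiction (trans (sym (hasDegree⁻ k u uk)) (trans (regular u v (Adj⇒adj G e)) (hasDegree⁻ (suc k) v vk+1))) (<⇒≢ (n<1+n k)))
    cover : ∀ v → hasDegree k v ∨ hasDegree (suc k) v ≡ true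
    cover v with near v
    ... | inj₁ eq rewrite hasDegree⁺ k v eq = refl
    ... | inj₂ eq rewrite hasDegree⁺ (suc k) v eq = Bool.∨-zeroʳ (hasDegree k v)

-- Vertex degrees, order and size of BalancedUnion

-- What degrees and `Balanced` require, stated for an arbitrary vertex type: each neighbourhood is
-- enumerated by a Fin. In this form it passes to copies and disjoint unions.
record Local {V : Set} (H : Graph V) (size : V → ℕ) : Set where
  field
    neighbour : ∀ x → Fin (size x) → V
    injective : ∀ x {i j} → neighbour x i ≡ neighbour x j → i ≡ j
    adjacent  : ∀ x i → Adj H x (neighbour x i)
    onto      : ∀ x y → Adj H x y → ∃[ i ] neighbour x i ≡ y
    exchange  : ∀ {i c j c′} → Adj H i c → Adj H j c → Adj H j c′ → Adj H i c′
    regular   : ∀ {x y} → Adj H x y → size x ≡ size y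

K-local : ∀ r → Local (K r r) (λ _ → r)
K-local r = record
  { neighbour = λ { (inj₁ _) → inj₂ ; (inj₂ _) → inj₁ }
  ; injective = λ { (inj₁ _) refl → refl ; (inj₂ _) refl → refl }
  ; adjacent  = λ { (inj₁ _) _ → tt ; (inj₂ _) _ → tt }
  ; onto      = λ { (inj₁ _) (inj₂ j) _ → j , refl ; (inj₂ _) (inj₁ j) _ → j , refl }
  ; exchange  = λ {i} {c} {j} {c′} → exchange i c j c′
  ; regular   = λ _ → refl
  }
  where
  exchange : ∀ i c j c′ → Adj (K r r) i c → Adj (K r r) j c → Adj (K r r) j c′ → Adj (K r r) i c′
  exchange (inj₁ _) (inj₂ _) (inj₁ _) (inj₂ _) _ _ _ = tt
  exchange (inj₂ _) (inj₁ _) (inj₂ _) (inj₁ _) _ _ _ = tt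

copies-local : ∀ {V} {H : Graph V} {size} ℓ → Local H size → Local (ℓ copies H) (size ∘ proj₂)
copies-local ℓ H-local = record
  { neighbour = λ (i , x) j → i , neighbour x j
  ; injective = λ (i , x) eq → injective x (cong proj₂ eq)
  ; adjacent  = λ (i , x) j → refl , adjacent x j
  ; onto      = λ { (i , x) (.i , y) (refl , e) → let j , eq = onto x y e in j , cong (i ,_) eq }
  ; exchange  = λ (i≡c , ic) (j≡c , jc) (j≡c′ , jc′) → trans i≡c (trans (sym j≡c) j≡c′) , exchange ic jc jc′
  ; regular   = regular ∘ proj₂
  }
  where open Local H-local

⊍-local : ∀ {V W} {H : Graph V} {H′ : Graph W} {size size′} → Local H size → Local H′ size′ →
  Local (H ⊍ H′) [ size , size′ ]′
⊍-local H-local H′-local = record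
  { neighbour = λ { (inj₁ x) → inj₁ ∘ E.neighbour x ; (inj₂ x) → inj₂ ∘ F.neighbour x }
  ; injective = λ { (inj₁ x) eq → E.injective x (Sum.inj₁-injective eq) ; (inj₂ x) eq → F.injective x (Sum.inj₂-injective eq) }
  ; adjacent  = λ { (inj₁ x) i → ⊎.inj₁ (E.adjacent x i) ; (inj₂ x) i → ⊎.inj₂ (F.adjacent x i) }
  ; onto      = λ { (inj₁ x) (inj₁ y) (⊎.inj₁ e) → let i , eq = E.onto x y e in i , cong inj₁ eq
                  ; (inj₂ x) (inj₂ y) (⊎.inj₂ e) → let i , eq = F.onto x y e in i , cong inj₂ eq }
  ; exchange  = λ { (⊎.inj₁ ic) (⊎.inj₁ jc) (⊎.inj₁ jc′) → ⊎.inj₁ (E.exchange ic jc jc′)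
                  ; (⊎.inj₂ ic) (⊎.inj₂ jc) (⊎.inj₂ jc′) → ⊎.inj₂ (F.exchange ic jc jc′) }
  ; regular   = λ { (⊎.inj₁ e) → E.regular e ; (⊎.inj₂ e) → F.regular e }
  }
  where
  module E = Local H-local
  module F = Local H′-local

sum-++ : ∀ a {b} (f : Fin (a + b) → ℕ) → sum f ≡ sum (λ i → f (i Fin.↑ˡ b)) + sum (λ j → f (a Fin.↑ʳ j))
sum-++ zero    f = refl
sum-++ (suc a) f = trans (cong (f zero +_) (sum-++ a (f ∘ suc))) (sym (+-assoc (f zero) _ _))

module Union (n₁ ℓ₁ ℓ₂ : ℕ) where

  U : Graph ((Fin ℓ₁ × (Fin n₁ ⊎ Fin n₁)) ⊎ (Fin ℓ₂ × (Fin (suc n₁) ⊎ Fin (suc n₁))))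
  U = BalancedUnion n₁ ℓ₁ ℓ₂

  Vertex : Set
  Vertex = (Fin ℓ₁ × (Fin n₁ ⊎ Fin n₁)) ⊎ (Fin ℓ₂ × (Fin (suc n₁) ⊎ Fin (suc n₁)))

  size : Vertex → ℕ
  size = [ (λ _ → n₁) , (λ _ → suc n₁) ]′

  U-local : Local U size
  U-local = ⊍-local (copies-local ℓ₁ (K-local n₁)) (copies-local ℓ₂ (K-local (suc n₁)))

  block₁ block₂ order : ℕ
  block₁ = ℓ₁ * (n₁ + n₁)
  block₂ = ℓ₂ * (suc n₁ + suc n₁)
  order = block₁ + block₂

  copies-↔ : ∀ ℓ r → Fin (ℓ * (r + r)) ↔ (Fin ℓ × (Fin r ⊎ Fin r))
  copies-↔ ℓ r = ↔-trans Fin.*↔× (↔-refl ×-↔ Fin.+↔⊎)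

  vertices : Fin order ↔ Vertex
  vertices = ↔-trans Fin.+↔⊎ (copies-↔ ℓ₁ n₁ ⊎-↔ copies-↔ ℓ₂ (suc n₁))

  sum-size : sum (size ∘ Inverse.to vertices) ≡ block₁ * n₁ + block₂ * suc n₁
  sum-size = trans (sum-++ block₁ (size ∘ Inverse.to vertices)) (cong₂ _+_
    (trans (sum-cong-≗ left) (sum-const block₁ n₁)) (trans (sum-cong-≗ right) (sum-const block₂ (suc n₁))))
    where
    left : ∀ i → size (Inverse.to vertices (i Fin.↑ˡ block₂)) ≡ n₁
    left i rewrite Fin.splitAt-↑ˡ block₁ i block₂ = refl
    right : ∀ j → size (Inverse.to vertices (block₁ Fin.↑ʳ j)) ≡ suc n₁
    right j rewrite Fin.splitAt-↑ʳ block₁ block₂ j = refl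

  module Isomorphic {N} (G : Graph (Fin N)) (G≅U : G ≅ U) where
    private
      module f = Inverse (_≅_.bijection G≅U)
      module L = Local U-local

    to-adj : ∀ {u v} → adj G u v ≡ true → Adj U (f.to u) (f.to v)
    to-adj {u} {v} uv = Equivalence.to (_≅_.preserves G≅U u v) (adj⇒Adj G uv)

    from-adj : ∀ {u v} → Adj U (f.to u) (f.to v) → adj G u v ≡ true
    from-adj {u} {v} e = Adj⇒adj G (Equivalence.from (_≅_.preserves G≅U u v) e)

    neighbourhood : ∀ v → Enumeration (size (f.to v)) (adj G v)
    neighbourhood v = record
      { at        = f.from ∘ L.neighbour (f.to v)
      ; injective = λ {i} {j} eq → L.injective (f.to v)
          (trans (sym (f.strictlyInverseˡ _)) (trans (cong f.to eq) (f.strictlyInverseˡ _)))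
      ; image     = λ i → from-adj (subst (Adj U (f.to v)) (sym (f.strictlyInverseˡ _)) (L.adjacent (f.to v) i))
      ; onto      = λ u vu → let i , eq = L.onto (f.to v) (f.to u) (to-adj vu) in
          i , trans (cong f.from eq) (f.strictlyInverseʳ u)
      }

    deg-size : ∀ v → deg G v ≡ size (f.to v)
    deg-size v = trans (deg≡count G v) (enumeration⇒count (neighbourhood v))

    balanced : Balanced G
    balanced = record
      { exchange = λ i c j c′ ic jc jc′ → from-adj (L.exchange (to-adj ic) (to-adj jc) (to-adj jc′))
      ; regular  = λ u v uv → trans (deg-size u) (trans (L.regular (to-adj uv)) (sym (deg-size v)))
      }

    near : ∀ v → deg G v ≡ n₁ ⊎ deg G v ≡ suc n₁
    near v with f.to v | deg-size v
    ... | inj₁ _ | eq = inj₁ eq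
    ... | inj₂ _ | eq = inj₂ eq

    relabel : Fin order ↔ Fin N
    relabel = ↔-trans vertices (↔-sym (_≅_.bijection G≅U))

    order≡ : N ≡ order
    order≡ = sym (Perm.↔⇒≡ relabel)

    edges≡ : 2 * length (edges G) ≡ block₁ * n₁ + block₂ * suc n₁
    edges≡ = begin
      2 * length (edges G)                          ≡⟨ handshake G ⟨
      sum (deg G)                                   ≡⟨ sum-permute (deg G) relabel ⟩
      sum (deg G ∘ f.from ∘ Inverse.to vertices)    ≡⟨ (sum-cong-≗ λ i → trans (deg-size _) (cong size (f.strictlyInverseˡ (Inverse.to vertices i)))) ⟩
      sum (size ∘ Inverse.to vertices)              ≡⟨ sum-size ⟩
      block₁ * n₁ + block₂ * suc n₁                   ∎
      where open ≡-Reasoning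

  -- Edge counts and `perfmat` exist for graphs on Fin N only, so the union is transported along
  -- `vertices`.
  pullback : ∀ {N} → N ≡ order → Σ[ G ∈ Graph (Fin N) ] G ≅ U
  pullback {N} refl = G , record { bijection = vertices ; preserves = λ u v → mk⇔ id id }
    where
    φ : Fin N → Vertex
    φ = Inverse.to vertices
    G : Graph (Fin N)
    G = record
      { Adj    = λ u v → Adj U (φ u) (φ v)
      ; symm   = symm U
      ; irrefl = irrefl U
      ; adj?   = λ u v → adj? U (φ u) (φ v)
      }

  2*≡order : ∀ {n} → n ≡ ℓ₁ * n₁ + ℓ₂ * (n₁ + 1) → 2 * n ≡ order
  2*≡order refl = identity n₁ ℓ₁ ℓ₂
    where
    identity : ∀ n₁ ℓ₁ ℓ₂ → 2 * (ℓ₁ * n₁ + ℓ₂ * (n₁ + 1)) ≡ ℓ₁ * (n₁ + n₁) + ℓ₂ * (suc n₁ + suc n₁)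
    identity = solve-∀

  order≡2*⇒ : ∀ {n} → 2 * n ≡ order → n ≡ ℓ₁ * n₁ + ℓ₂ * (n₁ + 1)
  order≡2*⇒ {n} eq = *-cancelˡ-≡′ 2 z<s (trans eq (sym (2*≡order refl)))

  edges⇒ : ∀ {m} → 2 * m ≡ block₁ * n₁ + block₂ * suc n₁ → m ≡ ℓ₁ * n₁ ^ 2 + ℓ₂ * (n₁ + 1) ^ 2
  edges⇒ {m} eq = *-cancelˡ-≡′ 2 z<s (trans eq (identity n₁ ℓ₁ ℓ₂))
    where
    identity : ∀ n₁ ℓ₁ ℓ₂ → ℓ₁ * (n₁ + n₁) * n₁ + ℓ₂ * (suc n₁ + suc n₁) * suc n₁
                          ≡ 2 * (ℓ₁ * (n₁ * (n₁ * 1)) + ℓ₂ * ((n₁ + 1) * ((n₁ + 1) * 1)))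
    identity = solve-∀

-- The maximum number of perfect matchings

edges-cong : ∀ {N} (G H : Graph (Fin N)) → (∀ i j → Adj G i j ⇔ Adj H i j) → edges G ≡ edges H
edges-cong {N} G H G⇔H = List.filter-≐ (λ (i , j) → adj? G i j) (λ (i , j) → adj? H i j)
  ((λ {(i , j)} → Equivalence.to (G⇔H i j)) , (λ {(i , j)} → Equivalence.from (G⇔H i j))) (pairs N)

-- A graph need not occur literally in the enumeration, but one with the same adjacency does; the
-- two have the same edge list, on which alone `perfmat` depends.
perfmat≤μ : ∀ {N m} (G : Graph (Fin N)) → G ∈ 𝒢 N m → perfmat G ≤ μ N m
perfmat≤μ {N} {m} G G∈ with graphs-complete G
... | H , H∈graphs , G⇔H = ≤-trans (≤-reflexive (cong (length ∘ filter perfect? ∘ subsets) edges≡))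
    (All.lookup (xs≤max 0 (map perfmat (filter (𝒢? N m) (graphs N))))
      (List.∈-map⁺ perfmat (List.∈-filter⁺ (𝒢? N m) H∈graphs (trans (cong length (sym edges≡)) G∈))))
  where
  edges≡ : edges G ≡ edges H
  edges≡ = edges-cong G H G⇔H

-- The first alternative is the base value of the maximum. When μ equals ω, it is excluded by the
-- positivity of the optimum.
μ-attained : ∀ N m → μ N m ≡ 0 ⊎ (∃[ G ] G ∈ 𝒢 N m × perfmat G ≡ μ N m)
μ-attained N m with argmax-sel id 0 (map perfmat (filter (𝒢? N m) (graphs N)))
... | inj₁ μ≡0 = inj₁ μ≡0
... | inj₂ μ∈ with List.∈-map⁻ perfmat μ∈
...   | G , G∈ , μ≡ = inj₂ (G , proj₂ (List.∈-filter⁻ (𝒢? N m) {xs = graphs N} G∈) , sym μ≡)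

-- From single graphs to the maximum: equality and uniqueness

module Theorem (m n : ℕ) .{{_ : NonZero n}} (n≤m : n ≤ m) (weight : Weight (2 * n + suc m)) where
  open Extremal m n n≤m weight

  UnionIn : Set₁
  UnionIn = ∃[ G⋆ ] G⋆ ∈ 𝒢 N m × (∃[ n₁ ] ∃[ ℓ₁ ] ∃[ ℓ₂ ] n₁ ≥ 1 × ℓ₁ ≥ 1 × G⋆ ≅ BalancedUnion n₁ ℓ₁ ℓ₂)

  module _ (n₁ ℓ₁ ℓ₂ : ℕ) where

    -- A copy of K r r has r edges per vertex of one side, so n₁ n misses one edge for each such
    -- vertex of the larger copies. As ℓ₁ ≥ 1 keeps the rest below n, this is the division of m by
    -- n: the quotient gives n₁ and the remainder gives ℓ₂.
    m≡quotient : n ≡ ℓ₁ * n₁ + ℓ₂ * (n₁ + 1) → m ≡ ℓ₁ * n₁ ^ 2 + ℓ₂ * (n₁ + 1) ^ 2 → m ≡ n₁ * n + ℓ₂ * (n₁ + 1)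
    m≡quotient n≡ m≡ = trans m≡ (trans (identity n₁ ℓ₁ ℓ₂) (cong (λ x → n₁ * x + ℓ₂ * (n₁ + 1)) (sym n≡)))
      where
      identity : ∀ n₁ ℓ₁ ℓ₂ → ℓ₁ * (n₁ * (n₁ * 1)) + ℓ₂ * ((n₁ + 1) * ((n₁ + 1) * 1)) ≡ n₁ * (ℓ₁ * n₁ + ℓ₂ * (n₁ + 1)) + ℓ₂ * (n₁ + 1)
      identity = solve-∀

    n₁≡k : n₁ ≥ 1 → ℓ₁ ≥ 1 → n ≡ ℓ₁ * n₁ + ℓ₂ * (n₁ + 1) → m ≡ ℓ₁ * n₁ ^ 2 + ℓ₂ * (n₁ + 1) ^ 2 → n₁ ≡ k
    n₁≡k n₁≥1 ℓ₁≥1 n≡ m≡ = sym (trans (cong (_/ n) (m≡quotient n≡ m≡)) ([q*n+r]/n≡q n₁ n _ remainder<n))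
      where
      remainder<n : ℓ₂ * (n₁ + 1) < n
      remainder<n = subst (ℓ₂ * (n₁ + 1) <_) (sym n≡) (m<n+m _ (*->0 ℓ₁≥1 n₁≥1))

  ℓ-unique : ∀ n₁ ℓ₁ ℓ₂ ℓ₁′ ℓ₂′ → n₁ ≥ 1 →
    n ≡ ℓ₁ * n₁ + ℓ₂ * (n₁ + 1) → m ≡ ℓ₁ * n₁ ^ 2 + ℓ₂ * (n₁ + 1) ^ 2 →
    n ≡ ℓ₁′ * n₁ + ℓ₂′ * (n₁ + 1) → m ≡ ℓ₁′ * n₁ ^ 2 + ℓ₂′ * (n₁ + 1) ^ 2 → ℓ₁ ≡ ℓ₁′ × ℓ₂ ≡ ℓ₂′
  ℓ-unique n₁ ℓ₁ ℓ₂ ℓ₁′ ℓ₂′ n₁≥1 n≡ m≡ n≡′ m≡′ = ℓ₁≡ , ℓ₂≡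
    where
    ℓ₂≡ : ℓ₂ ≡ ℓ₂′
    ℓ₂≡ = *-cancelʳ-≡′ (n₁ + 1) (m≤n+m 1 n₁) (+-cancelˡ-≡ (n₁ * n) _ _
      (trans (sym (m≡quotient n₁ ℓ₁ ℓ₂ n≡ m≡)) (m≡quotient n₁ ℓ₁′ ℓ₂′ n≡′ m≡′)))
    ℓ₁≡ : ℓ₁ ≡ ℓ₁′
    ℓ₁≡ = *-cancelʳ-≡′ n₁ n₁≥1 (+-cancelʳ-≡ (ℓ₂ * (n₁ + 1)) _ _
      (trans (sym n≡) (trans n≡′ (cong (λ x → ℓ₁′ * n₁ + x * (n₁ + 1)) (sym ℓ₂≡)))))

  module _ {n₁ ℓ₁ ℓ₂ : ℕ} where
    open Union n₁ ℓ₁ ℓ₂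

    union-numbers : (G : Graph (Fin N)) → G ∈ 𝒢 N m → G ≅ BalancedUnion n₁ ℓ₁ ℓ₂ →
      n ≡ ℓ₁ * n₁ + ℓ₂ * (n₁ + 1) × m ≡ ℓ₁ * n₁ ^ 2 + ℓ₂ * (n₁ + 1) ^ 2
    union-numbers G G∈ G≅U = order≡2*⇒ order≡ , edges⇒ (trans (cong (2 *_) (sym G∈)) edges≡)
      where open Isomorphic G G≅U

    numbers-union : n ≡ ℓ₁ * n₁ + ℓ₂ * (n₁ + 1) → m ≡ ℓ₁ * n₁ ^ 2 + ℓ₂ * (n₁ + 1) ^ 2 →
      ∃[ G ] G ∈ 𝒢 N m × G ≅ BalancedUnion n₁ ℓ₁ ℓ₂
    numbers-union n≡ m≡ with pullback (2*≡order n≡)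
    ... | G , G≅U = G , trans (edges⇒ edges≡) (sym m≡) , G≅U
      where open Isomorphic G G≅U

    union-attains : n₁ ≥ 1 → ℓ₁ ≥ 1 → (G : Graph (Fin N)) → G ∈ 𝒢 N m → G ≅ BalancedUnion n₁ ℓ₁ ℓ₂ →
      perfmat G ^ L ≡ optimum
    union-attains n₁≥1 ℓ₁≥1 G G∈ G≅U = balanced×near⇒attained balanced
      (subst (λ k → ∀ v → deg G v ≡ k ⊎ deg G v ≡ suc k) (n₁≡k n₁ ℓ₁ ℓ₂ n₁≥1 ℓ₁≥1 (proj₁ numbers) (proj₂ numbers)) near)
      where
      open InClass G G∈
      open Isomorphic G G≅U
      numbers : n ≡ ℓ₁ * n₁ + ℓ₂ * (n₁ + 1) × m ≡ ℓ₁ * n₁ ^ 2 + ℓ₂ * (n₁ + 1) ^ 2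
      numbers = union-numbers G G∈ G≅U

  attains-union : (G : Graph (Fin N)) → G ∈ 𝒢 N m → perfmat G ^ L ≡ optimum →
    ∃[ ℓ₁ ] ∃[ ℓ₂ ] ℓ₁ ≥ 1 × G ≅ BalancedUnion k ℓ₁ ℓ₂
  attains-union G G∈ eq = let bal , near = attained⇒balanced×near eq in
    Decompose.balanced⇒union G bal k 0<k near (near⇒∃k near)
    where open InClass G G∈

  0^L≡0 : 0 ^ L ≡ 0
  0^L≡0 = 0^>0 L>0

  μ^≤optimum : μ N m ^ L ≤ optimum
  μ^≤optimum with μ-attained N m
  ... | inj₁ μ≡0 = subst (λ x → x ^ L ≤ optimum) (sym μ≡0) (≤-trans (≤-reflexive 0^L≡0) z≤n)
  ... | inj₂ (G , G∈ , eq) = subst (λ x → x ^ L ≤ optimum) eq (InClass.perfmat^≤optimum G G∈)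

  optimum⇒μ : (G : Graph (Fin N)) → G ∈ 𝒢 N m → perfmat G ^ L ≡ optimum → perfmat G ≡ μ N m
  optimum⇒μ G G∈ eq = ≤-antisym (perfmat≤μ G G∈) (^-cancelʳ-≤ L L>0 (≤-trans μ^≤optimum (≤-reflexive (sym eq))))

  μ-≃ : ⌜ μ N m ⌝ ≃[ L ] (μ N m ^ L)
  μ-≃ = ≃-⌜⌝ {L} (μ N m)

  μ≤ω : ⌜ μ N m ⌝ ≤ᴿ ω n m
  μ≤ω = ≃⇒≤ᴿ L>0 {⌜ μ N m ⌝} {ω n m} μ-≃ ω-optimum μ^≤optimum

  union⇒μ≡ω : UnionIn → ⌜ μ N m ⌝ ≈ᴿ ω n m
  union⇒μ≡ω (G , G∈ , n₁ , ℓ₁ , ℓ₂ , n₁≥1 , ℓ₁≥1 , G≅U) = ≃⇒≈ᴿ L>0 {⌜ μ N m ⌝} {ω n m} μ-≃ ω-optimum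
    (subst (λ x → x ^ L ≡ optimum) (optimum⇒μ G G∈ attains) attains)
    where
    attains : perfmat G ^ L ≡ optimum
    attains = union-attains n₁≥1 ℓ₁≥1 G G∈ G≅U

  μ≡ω⇒union : ⌜ μ N m ⌝ ≈ᴿ ω n m → UnionIn
  μ≡ω⇒union eq with μ-attained N m
  ... | inj₂ (G , G∈ , perfmat≡μ) =
    let ℓ₁ , ℓ₂ , ℓ₁≥1 , G≅U = attains-union G G∈ (trans (cong (_^ L) perfmat≡μ) μ^≡optimum)
    in G , G∈ , k , ℓ₁ , ℓ₂ , 0<k , ℓ₁≥1 , G≅U
    where
    μ^≡optimum : μ N m ^ L ≡ optimum
    μ^≡optimum = ≈ᴿ⇒≡ L>0 {⌜ μ N m ⌝} {ω n m} μ-≃ ω-optimum eq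
  ... | inj₁ μ≡0 = contradiction
    (trans (sym 0^L≡0) (trans (cong (_^ L) (sym μ≡0)) (≈ᴿ⇒≡ L>0 {⌜ μ N m ⌝} {ω n m} μ-≃ ω-optimum eq)))
    (<⇒≢ 0<optimum)
    where
    open LogConcave.Tangent weight k 0<k k<bound
    0<optimum : 0 < optimum
    0<optimum = *->0 (^->0 (2 * (n ∸ α)) wk>0) (^->0 (2 * α) wk+1>0)

  part₂-⇔ : ⌜ μ N m ⌝ ≈ᴿ ω n m ⇔ UnionIn
  part₂-⇔ = mk⇔ μ≡ω⇒union union⇒μ≡ω

  union⇔numbers : UnionIn ⇔ (∃[ n₁ ] ∃[ ℓ₁ ] ∃[ ℓ₂ ] n₁ ≥ 1 × ℓ₁ ≥ 1
    × n ≡ ℓ₁ * n₁ + ℓ₂ * (n₁ + 1) × m ≡ ℓ₁ * n₁ ^ 2 + ℓ₂ * (n₁ + 1) ^ 2)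
  union⇔numbers = mk⇔
    (λ (G , G∈ , n₁ , ℓ₁ , ℓ₂ , n₁≥1 , ℓ₁≥1 , G≅U) → n₁ , ℓ₁ , ℓ₂ , n₁≥1 , ℓ₁≥1 , union-numbers G G∈ G≅U)
    (λ (n₁ , ℓ₁ , ℓ₂ , n₁≥1 , ℓ₁≥1 , n≡ , m≡) →
      let G , G∈ , G≅U = numbers-union n≡ m≡ in G , G∈ , n₁ , ℓ₁ , ℓ₂ , n₁≥1 , ℓ₁≥1 , G≅U)

  union-unique : ∀ {n₁ ℓ₁ ℓ₂ n₁′ ℓ₁′ ℓ₂′} {G : Graph (Fin N)} → n₁ ≥ 1 → n₁ ≡ n₁′ →
    n ≡ ℓ₁ * n₁ + ℓ₂ * (n₁ + 1) × m ≡ ℓ₁ * n₁ ^ 2 + ℓ₂ * (n₁ + 1) ^ 2 →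
    n ≡ ℓ₁′ * n₁′ + ℓ₂′ * (n₁′ + 1) × m ≡ ℓ₁′ * n₁′ ^ 2 + ℓ₂′ * (n₁′ + 1) ^ 2 →
    G ≅ BalancedUnion n₁′ ℓ₁′ ℓ₂′ → G ≅ BalancedUnion n₁ ℓ₁ ℓ₂
  union-unique {n₁} {ℓ₁} {ℓ₂} {_} {ℓ₁′} {ℓ₂′} {G} n₁≥1 refl (n≡ , m≡) (n≡′ , m≡′) =
    subst₂ (λ x y → G ≅ BalancedUnion n₁ x y) (sym (proj₁ ℓ≡)) (sym (proj₂ ℓ≡))
    where
    ℓ≡ : ℓ₁ ≡ ℓ₁′ × ℓ₂ ≡ ℓ₂′
    ℓ≡ = ℓ-unique n₁ ℓ₁ ℓ₂ ℓ₁′ ℓ₂′ n₁≥1 n≡ m≡ n≡′ m≡′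

  -- The union G₀ built from the numbers attains the optimum, so every maximiser attains it and is
  -- itself a union with parameter k. Its order and size then force the same n₁, ℓ₁ and ℓ₂.
  part₃ : ∀ n₁ ℓ₁ ℓ₂ → n₁ ≥ 1 → ℓ₁ ≥ 1 →
    n ≡ ℓ₁ * n₁ + ℓ₂ * (n₁ + 1) → m ≡ ℓ₁ * n₁ ^ 2 + ℓ₂ * (n₁ + 1) ^ 2 →
    (∃[ G ] G ∈ 𝒢 N m × perfmat G ≡ μ N m × G ≅ BalancedUnion n₁ ℓ₁ ℓ₂)
    × (∀ G → G ∈ 𝒢 N m → perfmat G ≡ μ N m → G ≅ BalancedUnion n₁ ℓ₁ ℓ₂)
  part₃ n₁ ℓ₁ ℓ₂ n₁≥1 ℓ₁≥1 n≡ m≡ = conclude (numbers-union n≡ m≡)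
    where
    conclude : (∃[ G ] G ∈ 𝒢 N m × G ≅ BalancedUnion n₁ ℓ₁ ℓ₂) → _
    conclude (G₀ , G₀∈ , G₀≅U) = (G₀ , G₀∈ , G₀≡μ , G₀≅U) , unique
      where
      G₀-attains : perfmat G₀ ^ L ≡ optimum
      G₀-attains = union-attains n₁≥1 ℓ₁≥1 G₀ G₀∈ G₀≅U
      G₀≡μ : perfmat G₀ ≡ μ N m
      G₀≡μ = optimum⇒μ G₀ G₀∈ G₀-attains
      unique : ∀ G → G ∈ 𝒢 N m → perfmat G ≡ μ N m → G ≅ BalancedUnion n₁ ℓ₁ ℓ₂
      unique G G∈ G≡μ =
        let ℓ₁′ , ℓ₂′ , _ , G≅U = attains-union G G∈ (trans (cong (_^ L) (trans G≡μ (sym G₀≡μ))) G₀-attains)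
        in union-unique n₁≥1 (n₁≡k n₁ ℓ₁ ℓ₂ n₁≥1 ℓ₁≥1 n≡ m≡) (n≡ , m≡) (union-numbers G G∈ G≅U) G≅U

theorem4 : (m n : ℕ) .{{_ : NonZero m}} .{{_ : NonZero n}} →
  n ≤ m → m ≤ (2 * n) C 2 →
  -- (1)
  ((G : Graph (Fin (2 * n))) → G ∈ 𝒢 (2 * n) m →
    let P = ∏ (map (λ v → (deg G v !) ^ 1 ÷ (2 * deg G v)) (allFin (2 * n))) in
    (P ≤ᴿ ω n m) × (P ≈ᴿ ω n m ⇔ AlmostRegular G))
  ×
  -- (2)
  ((⌜ μ (2 * n) m ⌝ ≤ᴿ ω n m)
    × (⌜ μ (2 * n) m ⌝ ≈ᴿ ω n m
        ⇔ (∃[ G⋆ ] G⋆ ∈ 𝒢 (2 * n) m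
            × (∃[ n₁ ] ∃[ ℓ₁ ] ∃[ ℓ₂ ] n₁ ≥ 1 × ℓ₁ ≥ 1 × G⋆ ≅ BalancedUnion n₁ ℓ₁ ℓ₂)))
    × ((∃[ G⋆ ] G⋆ ∈ 𝒢 (2 * n) m
            × (∃[ n₁ ] ∃[ ℓ₁ ] ∃[ ℓ₂ ] n₁ ≥ 1 × ℓ₁ ≥ 1 × G⋆ ≅ BalancedUnion n₁ ℓ₁ ℓ₂))
        ⇔ (∃[ n₁ ] ∃[ ℓ₁ ] ∃[ ℓ₂ ] n₁ ≥ 1 × ℓ₁ ≥ 1
            × n ≡ ℓ₁ * n₁ + ℓ₂ * (n₁ + 1)
            × m ≡ ℓ₁ * n₁ ^ 2 + ℓ₂ * (n₁ + 1) ^ 2)))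
  ×
  -- (3)
  (∀ n₁ ℓ₁ ℓ₂ → n₁ ≥ 1 → ℓ₁ ≥ 1 →
    n ≡ ℓ₁ * n₁ + ℓ₂ * (n₁ + 1) → m ≡ ℓ₁ * n₁ ^ 2 + ℓ₂ * (n₁ + 1) ^ 2 →
    (∃[ G ] G ∈ 𝒢 (2 * n) m × perfmat G ≡ μ (2 * n) m × G ≅ BalancedUnion n₁ ℓ₁ ℓ₂)
    × (∀ G → G ∈ 𝒢 (2 * n) m → perfmat G ≡ μ (2 * n) m → G ≅ BalancedUnion n₁ ℓ₁ ℓ₂))
theorem4 m n n≤m _ =
  (λ G G∈ → InClass.part₁ G G∈) ,
  (μ≤ω , part₂-⇔ , union⇔numbers) ,
  part₃
  where
  weight : Weight (2 * n + suc m)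
  weight = rootWeight (2 * n + suc m)
  open Extremal m n n≤m weight
  open Theorem m n n≤m weight
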